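{- For $n,k\ge 1$, the number $r_0(n,k)$ of reduced partitions of genus $1$ of the set $\{1,\dots,n\}$ having $k$ blocks is $$r_0(n,k)=\binom{n}{2k}\binom{k+1}{3}.$$ Moreover $$R_0(x,y)=\sum_{n,k}r_0(n,k)x^ny^k=\frac{y^2x^4(1-x)^3}{\bigl((1-x)^2-yx^2\bigr)^4}.$$
   Context: Permutations are composed right to left; $\zeta_n=(1,\dots,n)$; $z(\pi)$ is the number of cycles; the genus of $\alpha\in S_n$ is defined by $n+1-2g(\alpha)=z(\alpha)+z(\alpha^{ -1}\zeta_n)$. A partition of $\{1,\dots,n\}$ is identified with the permutation whose cycles are its blocks written in increasing order; its genus is that of this permutation. A trivial cycle is a cycle $(i,i+1,\dots,i+p)$ with entries modulo $n$ (fixed points included); a partition is reduced if its permutation has no trivial cycle. -}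

module Defs where

open import Data.Nat using (ℕ; zero; suc; _+_; _*_; _∸_; _≤_; _<_; _≤ᵇ_; _<ᵇ_)
open import Data.Nat.DivMod using (_%_; m%n<n)
open import Data.Bool using (Bool; true; false; _∧_; if_then_else_)
open import Data.Fin using (Fin; toℕ; fromℕ<) renaming (_≟_ to _≟ᶠ_)
open import Data.List using (List; []; _∷_; length; filterᵇ; upTo; allFin)
open import Data.Vec using (Vec; lookup)
open import Data.Integer using (ℤ; +_) renaming (_+_ to _+ℤ_; _*_ to _*ℤ_; -_ to -ℤ_)
open import Data.Product using (Σ; _×_)
open import Data.List.Membership.Propositional using (_∈_)
open import Data.List.Relation.Unary.Unique.Propositional using (Unique)
open import Relation.Binary.PropositionalEquality using (_≡_)
open import Relation.Nullary using (¬_; does)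
open import Function using (_∘_; _⇔_)

-- Permutations of {1,…,n} are modelled as maps Fin n → Fin n
-- (Fin n = {0,…,n-1}, element i standing for i+1).

shift : {n : ℕ} → Fin n → ℕ → Fin n
shift {suc n} i t = fromℕ< (m%n<n (toℕ i + t) (suc n))

zeta : {n : ℕ} → Fin n → Fin n
zeta i = shift i 1

iter : {n : ℕ} → (Fin n → Fin n) → ℕ → Fin n → Fin n
iter α zero    i = i
iter α (suc m) i = α (iter α m i)

allᵇ : {A : Set} → (A → Bool) → List A → Bool
allᵇ p []       = true
allᵇ p (x ∷ xs) = p x ∧ allᵇ p xs

isCycleMin : {n : ℕ} → (Fin n → Fin n) → Fin n → Bool
isCycleMin {n} α i = allᵇ (λ m → toℕ i ≤ᵇ toℕ (iter α m i)) (upTo (suc n))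

z : {n : ℕ} → (Fin n → Fin n) → ℕ
z {n} α = length (filterᵇ (isCycleMin α) (allFin n))

findPre : {n : ℕ} → (Fin n → Fin n) → Fin n → List (Fin n) → Fin n
findPre α j []       = j
findPre α j (i ∷ is) = if does (α i ≟ᶠ j) then i else findPre α j is

inv : {n : ℕ} → (Fin n → Fin n) → Fin n → Fin n
inv {n} α j = findPre α j (allFin n)

-- α has genus g :  n + 1 - 2g = z(α) + z(α⁻¹ ζ_n)   (composition right to left)
HasGenus : (n : ℕ) → (Fin n → Fin n) → ℕ → Set
HasGenus n α g = z α + z (inv α ∘ zeta) + 2 * g ≡ n + 1

HasTrivialCycle : (n : ℕ) → (Fin n → Fin n) → Set
HasTrivialCycle n σ =
  Σ (Fin n) λ i → Σ ℕ λ p → p < n ×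
    ((∀ t → t < p → σ (shift i t) ≡ shift i (suc t)) × σ (shift i p) ≡ i)

-- Set partitions of {1,…,n}: encoded canonically by the map
-- sending each element to the least element of its block.

IsPartition : (n : ℕ) → Vec (Fin n) n → Set
IsPartition n f = ∀ i → (toℕ (lookup f i) ≤ toℕ i) × (lookup f (lookup f i) ≡ lookup f i)

blocks : {n : ℕ} → Vec (Fin n) n → ℕ
blocks {n} f = length (filterᵇ (λ i → does (lookup f i ≟ᶠ i)) (allFin n))

firstOr : {A : Set} → A → List A → A
firstOr d []      = d
firstOr d (x ∷ _) = x

-- the permutation of a partition: each block is a cycle in increasing order;
-- i ↦ next larger element of its block, or the block minimum if none
partPerm : {n : ℕ} → Vec (Fin n) n → Fin n → Fin n
partPerm {n} f i =
  firstOr (lookup f i)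
    (filterᵇ (λ j → (toℕ i <ᵇ toℕ j) ∧ does (lookup f j ≟ᶠ lookup f i)) (allFin n))

IsReducedGenus1 : (n k : ℕ) → Vec (Fin n) n → Set
IsReducedGenus1 n k f =
  IsPartition n f × blocks f ≡ k ×
  ¬ HasTrivialCycle n (partPerm f) × HasGenus n (partPerm f) 1

HasCard : {A : Set} → (A → Set) → ℕ → Set
HasCard {A} P m = Σ (List A) λ L → Unique L × (∀ a → (a ∈ L) ⇔ P a) × length L ≡ m

Series : Set
Series = ℕ → ℕ → ℤ

sumTo : ℕ → (ℕ → ℤ) → ℤ
sumTo zero    h = h 0
sumTo (suc n) h = sumTo n h +ℤ h (suc n)

_⊗_ : Series → Series → Series
(F ⊗ G) n k = sumTo n λ a → sumTo k λ b → F a b *ℤ G (n ∸ a) (k ∸ b)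

_⊕ₛ_ : Series → Series → Series
(F ⊕ₛ G) n k = F n k +ℤ G n k

⊖_ : Series → Series
(⊖ F) n k = -ℤ (F n k)

oneS : Series
oneS zero zero = + 1
oneS _    _    = + 0

xS : Series
xS 1 zero = + 1
xS _ _    = + 0

yS : Series
yS zero 1 = + 1
yS _ _    = + 0

powS : Series → ℕ → Series
powS F zero    = oneS
powS F (suc m) = F ⊗ powS F m

denomS : Series
denomS = powS ((powS (oneS ⊕ₛ (⊖ xS)) 2) ⊕ₛ (⊖ (yS ⊗ powS xS 2))) 4

numerS : Series
numerS = powS yS 2 ⊗ (powS xS 4 ⊗ powS (oneS ⊕ₛ (⊖ xS)) 3)

fromNat : (ℕ → ℕ → ℕ) → Series
fromNat r n k = + (r n k)

{-# OPTIONS --safe #-}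
module Submission where

-- Let α be the permutation of a partition into k blocks and β = α⁻¹ζ.  Every cycle minimum of β is a
-- weak ascent, β x ≥ x.  The strict ascents of β are the x such that x + 1 is the least element of a
-- block other than the first one, so there are k - 1 of them; the fixed points are the x with α x = ζ x.
-- Calling S the set of the points with α x ≠ ζ x (the ends of the maximal runs of
-- cyclically consecutive elements of a block), z(β) ≤ n - |S| + k - 1.  A reduced partition has at
-- least two runs in each block, so genus 1, that is z(β) = n - 1 - k, forces equality everywhere:
-- every block has exactly two runs, and every weak ascent of β is the minimum of its cycle.
--
-- Contracting the runs to points leaves a chord diagram μ on 2k points, and β becomes r ↦ μ (r + 1).
-- That its ascents are minima of their cycles only allows diagrams with at most three classes of
-- parallel chords; read from the point 0 (where one class may be cut into I and J) they are given by
-- three numbers a < b < t ≤ k.  The set S and the diagram determine the partition.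
--
-- For the series, P_c = Σ C(n,2k) c(k) xⁿ yᵏ and D = (1 - x)² - y x² satisfy
-- D P_c = x² y P_Δc + c(0) (1 - x), which is applied to c(k) = C(k+1,3) and its differences.

-- Behind the three classes is a count. Each cycle of `r ↦ μ (r + 1)` has exactly one ascent, and
-- there are k - 1 ascents, one before each opening point other than 0. So 2k points without fixed
-- points form k - 1 cycles: all are 2-cycles, except for two 3-cycles or one 4-cycle. A 2-cycle is
-- a pair of neighbouring parallel chords; merging parallel chords leaves the hexagon or the square
-- with opposite sides glued, both of which are tori. The proof does not count these cycles. Reading
-- the points in increasing order, one local rule (`next`) tells which chord may close right after a
-- given one, and it forces the sums r + μ r to be constant on intervals. The class cut by the base
-- point consists of I, which contains 0, and J; B is nonempty, and C is empty in the case of the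
-- square, so that each diagram is described once. The sizes a + 1, b - a, t - b - 1, k - t of I, B,
-- C, J account for all 3-subsets of k + 1 numbers, whence the factor C(k+1,3).

open import Defs
open import Level using (0ℓ)
open import Algebra.Bundles using (CommutativeRing)
import Algebra.Construct.Pointwise as Pointwise
import Algebra.Solver.Ring.NaturalCoefficients.Default as RingSolver
open import Data.Bool using (Bool; true; false; _∧_; if_then_else_; T; not)
open import Data.Bool.Properties using (T-∧)
open import Data.Empty using (⊥; ⊥-elim)
open import Data.Fin using (Fin; zero; suc; toℕ; inject₁) renaming (_≟_ to _≟ᶠ_)
import Data.Fin.Properties as Fin
open import Data.Integer as ℤ using (ℤ) renaming (+_ to pos)
import Data.Integer.Properties as ℤ
open import Data.List using (List; []; _∷_; map; _++_; concatMap; filterᵇ; replicate; zipWith; length; upTo; allFin; tabulate; cartesianProduct)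
open import Data.List.Membership.DecPropositional using () renaming (_∈?_ to member?)
open import Data.List.Membership.Propositional using (_∈_)
open import Data.List.Membership.Propositional.Properties using (∈-∃++; ∈-++⁺ˡ; ∈-++⁺ʳ; ∈-++⁻; ∈-filter⁺; ∈-filter⁻; ∈-allFin; ∈-upTo⁺; ∈-map⁺; ∈-map⁻; ∈-cartesianProduct⁺; ∈-cartesianProduct⁻)
open import Data.List.Properties using (length-++; length-tabulate; length-map)
open import Data.List.Relation.Unary.All as All using ([]; _∷_)
open import Data.List.Relation.Unary.AllPairs using ([]; _∷_)
open import Data.List.Relation.Unary.Any using (here; there)
open import Data.List.Relation.Unary.Unique.Propositional using (Unique)
import Data.List.Relation.Unary.Unique.Propositional.Properties as Unique
open import Data.Nat
open import Data.Nat.Combinatorics using (_C_; nCk+nC[k+1]≡[n+1]C[k+1])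
open import Data.Nat.DivMod using (_%_; %-distribˡ-+; m<n⇒m%n≡m; n%n≡0; m%n%n≡m%n; [m+n]%n≡m%n)
open import Data.Nat.GeneralisedArithmetic using (fold)
import Data.Nat.Properties as ℕ
open import Data.Product using (_×_; _,_; proj₁; proj₂; ∃-syntax)
open import Data.Sum using (_⊎_; inj₁; inj₂; [_,_])
open import Data.Unit using (⊤; tt)
open import Data.Vec as Vec using (Vec; []; _∷_; lookup)
open import Data.Vec.N-ary using (N-ary; ∀ⁿ; curryⁿ; _$ⁿ_; uncurry-∀ⁿ; left-inverse)
import Data.Vec.Properties as Vec
open import Function using (id; case_of_; _∘_; _⇔_; mk⇔)
open import Function.Bundles using (module Equivalence)
open import Relation.Binary using (tri<; tri≈; tri>)
open import Relation.Binary.PropositionalEquality using (_≡_; _≢_; refl; sym; trans; cong; cong₂; subst; subst₂)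
import Relation.Binary.Reasoning.Setoid as SetoidReasoning
open import Relation.Nullary using (¬_; yes; no; Dec; does)
open import Relation.Nullary.Decidable using (T?)
open import Algebra.Properties.CommutativeSemigroup ℕ.+-commutativeSemigroup using (interchange)

-- Linear arithmetic over ℕ.  A sequent is refuted by a nonnegative combination of its
-- hypotheses, found by Fourier–Motzkin elimination; only the check of the combination
-- needs a correctness proof.

infixl 7 _:*_
infixl 6 _:+_
infix 4 _:≤_ _:<_ _:≡_
infixr 3 _⇒_

data Expr (n : ℕ) : Set where
  var  : Fin n → Expr n
  #_   : ℕ → Expr n
  :suc : Expr n → Expr n
  _:+_ : Expr n → Expr n → Expr n
  _:*_ : ℕ → Expr n → Expr n

data Form (n : ℕ) : Set where
  _:≤_ _:<_ _:≡_ : Expr n → Expr n → Form n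
  :⊥  : Form n
  _⇒_ : Form n → Form n → Form n

⟦_⟧ : ∀ {n} → Expr n → Vec ℕ n → ℕ
⟦ var i ⟧ ρ = Vec.lookup ρ i
⟦ # c ⟧ ρ = c
⟦ :suc e ⟧ ρ = suc (⟦ e ⟧ ρ)
⟦ e :+ e′ ⟧ ρ = ⟦ e ⟧ ρ + ⟦ e′ ⟧ ρ
⟦ c :* e ⟧ ρ = c * ⟦ e ⟧ ρ

⟦_⟧ᶠ : ∀ {n} → Form n → Vec ℕ n → Set
⟦ a :≤ b ⟧ᶠ ρ = ⟦ a ⟧ ρ ≤ ⟦ b ⟧ ρ
⟦ a :< b ⟧ᶠ ρ = ⟦ a ⟧ ρ < ⟦ b ⟧ ρ
⟦ a :≡ b ⟧ᶠ ρ = ⟦ a ⟧ ρ ≡ ⟦ b ⟧ ρ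
⟦ :⊥ ⟧ᶠ ρ = ⊥
⟦ F ⇒ G ⟧ᶠ ρ = ⟦ F ⟧ᶠ ρ → ⟦ G ⟧ᶠ ρ

Linear : ℕ → Set
Linear n = ℕ × Vec ℕ n

⟦_⟧ˡ : ∀ {n} → Vec ℕ n → Vec ℕ n → ℕ
⟦ [] ⟧ˡ [] = 0
⟦ c ∷ cs ⟧ˡ (x ∷ ρ) = c * x + ⟦ cs ⟧ˡ ρ

0ᵛ : ∀ {n} → Vec ℕ n
0ᵛ = Vec.replicate _ 0

unit : ∀ {n} → Fin n → Vec ℕ n
unit zero = 1 ∷ 0ᵛ
unit (suc i) = 0 ∷ unit i

linear : ∀ {n} → Expr n → Linear n
linear (var i) = 0 , unit i
linear (# c) = c , 0ᵛ
linear (:suc e) = let (c , cs) = linear e in suc c , cs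
linear (e :+ e′) = let (c , cs) = linear e ; (d , ds) = linear e′ in c + d , Vec.zipWith _+_ cs ds
linear (k :* e) = let (c , cs) = linear e in k * c , Vec.map (k *_) cs

0ᵛ-correct : ∀ {n} (ρ : Vec ℕ n) → ⟦ 0ᵛ ⟧ˡ ρ ≡ 0
0ᵛ-correct [] = refl
0ᵛ-correct (x ∷ ρ) = 0ᵛ-correct ρ

unit-correct : ∀ {n} (i : Fin n) ρ → ⟦ unit i ⟧ˡ ρ ≡ Vec.lookup ρ i
unit-correct zero (x ∷ ρ) = trans (cong₂ _+_ (ℕ.+-identityʳ x) (0ᵛ-correct ρ)) (ℕ.+-identityʳ x)
unit-correct (suc i) (x ∷ ρ) = unit-correct i ρ

+-correct : ∀ {n} (cs ds ρ : Vec ℕ n) → ⟦ Vec.zipWith _+_ cs ds ⟧ˡ ρ ≡ ⟦ cs ⟧ˡ ρ + ⟦ ds ⟧ˡ ρ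
+-correct [] [] [] = refl
+-correct (c ∷ cs) (d ∷ ds) (x ∷ ρ) =
  trans (cong ((c + d) * x +_) (+-correct cs ds ρ)) (trans (cong (_+ (⟦ cs ⟧ˡ ρ + ⟦ ds ⟧ˡ ρ)) (ℕ.*-distribʳ-+ x c d)) (interchange (c * x) _ _ _))

*-correct : ∀ {n} k (cs ρ : Vec ℕ n) → ⟦ Vec.map (k *_) cs ⟧ˡ ρ ≡ k * ⟦ cs ⟧ˡ ρ
*-correct k [] [] = sym (ℕ.*-zeroʳ k)
*-correct k (c ∷ cs) (x ∷ ρ) = trans (cong (k * c * x +_) (*-correct k cs ρ)) (trans (cong (_+ k * ⟦ cs ⟧ˡ ρ) (ℕ.*-assoc k c x)) (sym (ℕ.*-distribˡ-+ k (c * x) _)))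

linear-correct : ∀ {n} (e : Expr n) ρ → proj₁ (linear e) + ⟦ proj₂ (linear e) ⟧ˡ ρ ≡ ⟦ e ⟧ ρ
linear-correct (var i) ρ = unit-correct i ρ
linear-correct (# c) ρ = trans (cong (c +_) (0ᵛ-correct ρ)) (ℕ.+-identityʳ c)
linear-correct (:suc e) ρ = cong suc (linear-correct e ρ)
linear-correct (e :+ e′) ρ =
  trans (cong (proj₁ (linear e) + proj₁ (linear e′) +_) (+-correct (proj₂ (linear e)) _ ρ))
    (trans (interchange (proj₁ (linear e)) _ _ _) (cong₂ _+_ (linear-correct e ρ) (linear-correct e′ ρ)))
linear-correct (k :* e) ρ =
  trans (cong (k * proj₁ (linear e) +_) (*-correct k (proj₂ (linear e)) ρ))
    (trans (sym (ℕ.*-distribˡ-+ k _ _)) (cong (k *_) (linear-correct e ρ)))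

_≤ᵛ_ : ∀ {n} → Vec ℕ n → Vec ℕ n → Bool
[] ≤ᵛ [] = true
(c ∷ cs) ≤ᵛ (d ∷ ds) = (c ≤ᵇ d) ∧ (cs ≤ᵛ ds)

≤ᵛ-correct : ∀ {n} (cs ds ρ : Vec ℕ n) → T (cs ≤ᵛ ds) → ⟦ cs ⟧ˡ ρ ≤ ⟦ ds ⟧ˡ ρ
≤ᵛ-correct [] [] [] _ = z≤n
≤ᵛ-correct (c ∷ cs) (d ∷ ds) (x ∷ ρ) t =
  let (p , q) = Equivalence.to (T-∧ {c ≤ᵇ d}) t
  in ℕ.+-mono-≤ (ℕ.*-monoˡ-≤ x (ℕ.≤ᵇ⇒≤ c d p)) (≤ᵛ-correct cs ds ρ q)

Ineq : ℕ → Set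
Ineq n = Expr n × Expr n

combine : ∀ {n} → List ℕ → List (Ineq n) → Ineq n
combine (c ∷ cs) ((l , r) ∷ hs) = let (l′ , r′) = combine cs hs in c :* l :+ l′ , c :* r :+ r′
combine _ _ = # 0 , # 0

Holds : ∀ {n} → List (Ineq n) → Vec ℕ n → Set
Holds [] ρ = ⊤
Holds ((l , r) ∷ hs) ρ = (⟦ l ⟧ ρ ≤ ⟦ r ⟧ ρ) × Holds hs ρ

combine-correct : ∀ {n} cs (hs : List (Ineq n)) ρ → Holds hs ρ →
  ⟦ proj₁ (combine cs hs) ⟧ ρ ≤ ⟦ proj₂ (combine cs hs) ⟧ ρ
combine-correct (c ∷ cs) (h ∷ hs) ρ (p , ps) = ℕ.+-mono-≤ (ℕ.*-monoʳ-≤ c p) (combine-correct cs hs ρ ps)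
combine-correct (c ∷ cs) [] ρ _ = z≤n
combine-correct [] _ ρ _ = z≤n

-- The variables are natural numbers, so l ≤ r already fails when the constants are in the wrong
-- order and no coefficient on the right exceeds its counterpart on the left.
contradictory : ∀ {n} → Ineq n → Bool
contradictory (l , r) =
  (proj₁ (linear r) <ᵇ proj₁ (linear l)) ∧ (proj₂ (linear r) ≤ᵛ proj₂ (linear l))

contradictory-correct : ∀ {n} (h : Ineq n) ρ → T (contradictory h) → ¬ (⟦ proj₁ h ⟧ ρ ≤ ⟦ proj₂ h ⟧ ρ)
contradictory-correct (l , r) ρ t l≤r =
  let (p , q) = Equivalence.to (T-∧ {proj₁ (linear r) <ᵇ proj₁ (linear l)}) t
  in ℕ.<⇒≱ (subst₂ _<_ (linear-correct r ρ) (linear-correct l ρ)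
       (ℕ.+-mono-<-≤ (ℕ.<ᵇ⇒< _ _ p) (≤ᵛ-correct (proj₂ (linear r)) _ ρ q))) l≤r

-- The first list records which combination of the hypotheses the row is; the pairs are the
-- coefficients on the smaller and on the larger side.
Row : Set
Row = List ℕ × List (ℕ × ℕ)

headPair : List (ℕ × ℕ) → ℕ × ℕ
headPair [] = 0 , 0
headPair ((l , r) ∷ _) = l ∸ r , r ∸ l

tailRow : Row → Row
tailRow (m , []) = m , []
tailRow (m , _ ∷ r) = m , r

scaleAdd : ℕ → ℕ → Row → Row → Row
scaleAdd a b (m , r) (m′ , r′) =
  zipWith (λ x y → a * x + b * y) m m′ ,
  zipWith (λ (l , u) (l′ , u′) → let L = a * l + b * l′ ; U = a * u + b * u′ in L ∸ U , U ∸ L) r r′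

posHead negHead : Row → Bool
posHead (_ , r) = 0 <ᵇ proj₁ (headPair r)
negHead (_ , r) = 0 <ᵇ proj₂ (headPair r)

-- Dropping a positive coefficient on the smaller side is sound, the variables being natural numbers.
eliminate : List Row → List Row
eliminate rs =
  map tailRow (filterᵇ (λ r → if negHead r then false else true) rs) ++
  concatMap (λ p → map (λ q → tailRow (scaleAdd (proj₂ (headPair (proj₂ q))) (proj₁ (headPair (proj₂ p))) p q))
                       (filterᵇ negHead rs))
            (filterᵇ posHead rs)

eliminateAll : ℕ → List Row → List Row
eliminateAll zero rs = rs
eliminateAll (suc n) rs = eliminateAll n (eliminate rs)

-- Row i starts with the i-th unit vector of multipliers. The constants come last: they are the head
-- once the n variables are eliminated, and `posHead` then detects a contradiction.
rows : ∀ {n} → ℕ → ℕ → List (Ineq n) → List Row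
rows i m [] = []
rows i m ((l , r) ∷ hs) =
  let (c , cs) = linear l ; (d , ds) = linear r
  in (replicate i 0 ++ 1 ∷ replicate (m ∸ suc i) 0 ,
      Vec.toList (Vec.zipWith _,_ cs ds) ++ (c , d) ∷ []) ∷ rows (suc i) m hs

search : ∀ {n} → List (Ineq n) → List ℕ
search {n} hs with filterᵇ posHead (eliminateAll n (rows 0 (length hs) hs))
... | [] = []
... | (m , _) ∷ _ = m

refutable : ∀ {n} → List (Ineq n) → Bool
refutable hs = contradictory (combine (search hs) hs)

refutable-correct : ∀ {n} (hs : List (Ineq n)) ρ → T (refutable hs) → ¬ Holds hs ρ
refutable-correct hs ρ t ps = contradictory-correct (combine (search hs) hs) ρ t (combine-correct (search hs) hs ρ ps)

valid : ∀ {n} → List (Ineq n) → Form n → Bool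
valid hs (a :≤ b) = refutable ((:suc b , a) ∷ hs)
valid hs (a :< b) = refutable ((b , a) ∷ hs)
valid hs (a :≡ b) = refutable ((:suc b , a) ∷ hs) ∧ refutable ((:suc a , b) ∷ hs)
valid hs :⊥ = refutable hs
valid hs (a :≤ b ⇒ G) = valid ((a , b) ∷ hs) G
valid hs (a :< b ⇒ G) = valid ((:suc a , b) ∷ hs) G
valid hs (a :≡ b ⇒ G) = valid ((a , b) ∷ (b , a) ∷ hs) G
valid hs (_ ⇒ G) = valid hs G

valid-correct : ∀ {n} (hs : List (Ineq n)) (F : Form n) ρ → T (valid hs F) → Holds hs ρ → ⟦ F ⟧ᶠ ρ
valid-correct hs (a :≤ b) ρ t ps = ℕ.≮⇒≥ λ q → refutable-correct ((:suc b , a) ∷ hs) ρ t (q , ps)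
valid-correct hs (a :< b) ρ t ps = ℕ.≰⇒> λ q → refutable-correct ((b , a) ∷ hs) ρ t (q , ps)
valid-correct hs (a :≡ b) ρ t ps =
  let (p , q) = Equivalence.to (T-∧ {refutable ((:suc b , a) ∷ hs)}) t
  in ℕ.≤-antisym (ℕ.≮⇒≥ λ r → refutable-correct ((:suc b , a) ∷ hs) ρ p (r , ps))
                 (ℕ.≮⇒≥ λ r → refutable-correct ((:suc a , b) ∷ hs) ρ q (r , ps))
valid-correct hs :⊥ ρ t ps = refutable-correct hs ρ t ps
valid-correct hs (a :≤ b ⇒ G) ρ t ps h = valid-correct _ G ρ t (h , ps)
valid-correct hs (a :< b ⇒ G) ρ t ps h = valid-correct _ G ρ t (h , ps)
valid-correct hs (a :≡ b ⇒ G) ρ t ps h = valid-correct _ G ρ t (ℕ.≤-reflexive h , ℕ.≤-reflexive (sym h) , ps)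
valid-correct hs (:⊥ ⇒ G) ρ t ps h = valid-correct _ G ρ t ps
valid-correct hs ((_ ⇒ _) ⇒ G) ρ t ps h = valid-correct _ G ρ t ps

close : ∀ n → N-ary n (Expr n) (Form n) → Form n
close n F = F $ⁿ Vec.map var (Vec.allFin n)

lia : ∀ n (F : N-ary n (Expr n) (Form n)) {_ : T (valid [] (close n F))} → ∀ⁿ n (curryⁿ ⟦ close n F ⟧ᶠ)
lia n F {t} = Equivalence.from (uncurry-∀ⁿ n) λ ρ →
  subst id (sym (left-inverse ⟦ close n F ⟧ᶠ ρ)) (valid-correct [] (close n F) ρ t tt)

-- Chord diagrams

-- Reduction modulo `N` for arguments up to `N`, such as successors of points and ranks.
wrap : ℕ → ℕ → ℕ
wrap N s with s ≟ N
... | yes _ = 0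
... | no _ = s

wrap-< : ∀ {N s} → s < N → wrap N s ≡ s
wrap-< {N} {s} s<N with s ≟ N
... | yes refl = ⊥-elim (ℕ.<-irrefl refl s<N)
... | no _ = refl

wrap-self : ∀ N → wrap N N ≡ 0
wrap-self N with N ≟ N
... | yes _ = refl
... | no N≢N = ⊥-elim (N≢N refl)

module _ (N : ℕ) (μ : ℕ → ℕ) where

  rotated : ℕ → ℕ
  rotated r = μ (wrap N (suc r))

  rotated-suc : ∀ {r} → suc r < N → rotated r ≡ μ (suc r)
  rotated-suc r<N = cong μ (wrap-< r<N)

  rotated-last : ∀ {r} → suc r ≡ N → rotated r ≡ μ 0
  rotated-last refl = cong μ (wrap-self N)

  -- The rotation r ↦ μ (r + 1) of a chord diagram μ is conjugate to the action of α⁻¹ζ on its support.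
  record ChordDiagram : Set where
    field
      bounded     : ∀ {r} → r < N → μ r < N
      involutive  : ∀ {r} → r < N → μ (μ r) ≡ r
      irreflexive : ∀ {r} → r < N → μ r ≢ r
      reduced     : ∀ {r} → r < N → rotated r ≢ r
      ascentMin   : ∀ {r} → r < N → r ≤ rotated r → ∀ m → r ≤ fold r rotated m

select : List (ℕ × ℕ) → ℕ → ℕ → ℕ
select [] d r = d
select ((c , s) ∷ cs) d r with r <? c
... | yes _ = s
... | no _ = select cs d r

-- A derivation lists the tests that fail and the one that succeeds, so that a branch of `chord` is
-- reached without splitting on the tests again.
data Selects (d r : ℕ) : List (ℕ × ℕ) → ℕ → Set where
  default : Selects d r [] d
  here    : ∀ {c s cs} → r < c → Selects d r ((c , s) ∷ cs) s
  there   : ∀ {c s cs x} → c ≤ r → Selects d r cs x → Selects d r ((c , s) ∷ cs) x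

select-correct : ∀ {d r cs s} → Selects d r cs s → select cs d r ≡ s
select-correct default = refl
select-correct {r = r} (here {c} r<c) with r <? c
... | yes _ = refl
... | no r≮c = ⊥-elim (r≮c r<c)
select-correct {r = r} (there {c} c≤r S) with r <? c
... | yes r<c = ⊥-elim (ℕ.<⇒≱ r<c c≤r)
... | no _ = select-correct S

-- The diagram consists of the parallel classes I = [0,a], B = (a,b], C = (b,t) and
-- J = (t+a,k+a], whose closing points I′, B′, C′, J′ are met in the order I B C I′ J B′ C′ J′.
record Shape (k a b t : ℕ) (μ : ℕ → ℕ) : Set where
  field
    onI  : ∀ {r} → r ≤ a → r + μ r ≡ t + a
    onB  : ∀ {r} → a < r → r ≤ b → r + μ r ≡ suc (k + a + b)
    onC  : ∀ {r} → b < r → r < t → r + μ r ≡ k + b + t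
    onI′ : ∀ {r} → t ≤ r → r ≤ t + a → r + μ r ≡ t + a
    onJ  : ∀ {r} → t + a < r → r ≤ k + a → r + μ r ≡ 2 * k + t + a
    onB′ : ∀ {r} → k + a < r → r ≤ k + b → r + μ r ≡ suc (k + a + b)
    onC′ : ∀ {r} → k + b < r → r < k + t → r + μ r ≡ k + b + t
    onJ′ : ∀ {r} → k + t ≤ r → r < 2 * k → r + μ r ≡ 2 * k + t + a

data Region (k a b t r s : ℕ) : Set where
  inI  : r ≤ a → r + s ≡ t + a → Region k a b t r s
  inB  : a < r → r ≤ b → r + s ≡ suc (k + a + b) → Region k a b t r s
  inC  : b < r → r < t → r + s ≡ k + b + t → Region k a b t r s
  inI′ : t ≤ r → r ≤ t + a → r + s ≡ t + a → Region k a b t r s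
  inJ  : t + a < r → r ≤ k + a → r + s ≡ 2 * k + t + a → Region k a b t r s
  inB′ : k + a < r → r ≤ k + b → r + s ≡ suc (k + a + b) → Region k a b t r s
  inC′ : k + b < r → r < k + t → r + s ≡ k + b + t → Region k a b t r s
  inJ′ : k + t ≤ r → r < 2 * k → r + s ≡ 2 * k + t + a → Region k a b t r s

region : ∀ {k a b t μ r} → Shape k a b t μ → r < 2 * k → Region k a b t r (μ r)
region {k} {a} {b} {t} {μ} {r} S r<N
  with r ≤? a | r ≤? b | r <? t | r ≤? t + a | r ≤? k + a | r ≤? k + b | r <? k + t
... | yes p | _ | _ | _ | _ | _ | _ = inI p (Shape.onI S p)
... | no p | yes q | _ | _ | _ | _ | _ = inB (ℕ.≰⇒> p) q (Shape.onB S (ℕ.≰⇒> p) q)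
... | no _ | no p | yes q | _ | _ | _ | _ = inC (ℕ.≰⇒> p) q (Shape.onC S (ℕ.≰⇒> p) q)
... | no _ | no _ | no p | yes q | _ | _ | _ = inI′ (ℕ.≮⇒≥ p) q (Shape.onI′ S (ℕ.≮⇒≥ p) q)
... | no _ | no _ | no _ | no p | yes q | _ | _ = inJ (ℕ.≰⇒> p) q (Shape.onJ S (ℕ.≰⇒> p) q)
... | no _ | no _ | no _ | no _ | no p | yes q | _ = inB′ (ℕ.≰⇒> p) q (Shape.onB′ S (ℕ.≰⇒> p) q)
... | no _ | no _ | no _ | no _ | no _ | no p | yes q = inC′ (ℕ.≰⇒> p) q (Shape.onC′ S (ℕ.≰⇒> p) q)
... | no _ | no _ | no _ | no _ | no _ | no _ | no p = inJ′ (ℕ.≮⇒≥ p) r<N (Shape.onJ′ S (ℕ.≮⇒≥ p) r<N)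

-- Parallel chords are nested, so their two ends have a constant sum. Each entry is the end of an
-- interval with the sum valid there; the last interval, J′, is the default in `chord`.
sums : ℕ → ℕ → ℕ → ℕ → List (ℕ × ℕ)
sums k a b t =
  (suc a , t + a) ∷ (suc b , suc (k + a + b)) ∷ (t , k + b + t) ∷ (suc (t + a) , t + a) ∷
  (suc (k + a) , 2 * k + t + a) ∷ (suc (k + b) , suc (k + a + b)) ∷ (k + t , k + b + t) ∷ []

chord : ℕ → ℕ → ℕ → ℕ → ℕ → ℕ
chord k a b t r = select (sums k a b t) (2 * k + t + a) r ∸ r

module _ {k a b t : ℕ} (a<b : a < b) (b<t : b < t) (t≤k : t ≤ k) where

  private
    chord-sum : ∀ {r s} → r ≤ s → Selects (2 * k + t + a) r (sums k a b t) s → r + chord k a b t r ≡ s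
    chord-sum {r} r≤s S =
      trans (cong (λ x → r + (x ∸ r)) (select-correct S)) (ℕ.m+[n∸m]≡n r≤s)

    -- Each of these passes from the lower bound of one interval to that of an earlier one; their
    -- composites supply the failed tests.
    ab = λ {r} → lia 3 (λ a b r → a :< b ⇒ b :< r ⇒ :suc a :≤ r) a b r a<b
    c₁ = λ {r} → lia 4 (λ a b t r → a :< b ⇒ b :< t ⇒ t :≤ r ⇒ :suc a :≤ r) a b t r a<b b<t
    c₂ = λ {r} → lia 3 (λ b t r → b :< t ⇒ t :≤ r ⇒ :suc b :≤ r) b t r b<t
    c₄ = λ {r} → lia 4 (λ a t k r → t :≤ k ⇒ k :+ a :< r ⇒ t :+ a :< r) a t k r t≤k
    c₃ = λ {r} → lia 3 (λ a t r → t :+ a :< r ⇒ t :≤ r) a t r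
    c₅ = λ {r} → lia 4 (λ a b k r → a :< b ⇒ k :+ b :< r ⇒ k :+ a :< r) a b k r a<b
    c₆ = λ {r} → lia 4 (λ b t k r → b :< t ⇒ k :+ t :≤ r ⇒ k :+ b :< r) b t k r b<t

  chord-shape : Shape k a b t (chord k a b t)
  chord-shape = record
    { onI = λ {r} p → chord-sum (lia 3 (λ r a t → r :≤ a ⇒ r :≤ t :+ a) r a t p) (here (s≤s p))
    ; onB = λ {r} p q → chord-sum (lia 4 (λ r a b k → r :≤ b ⇒ r :≤ :suc (k :+ a :+ b)) r a b k q)
        (there p (here (s≤s q)))
    ; onC = λ {r} p q → chord-sum (lia 4 (λ r b t k → r :< t ⇒ r :≤ k :+ b :+ t) r b t k q)
        (there (ab p) (there p (here q)))
    ; onI′ = λ {r} p q → chord-sum q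
        (there (c₁ p) (there (c₂ p) (there p (here (s≤s q)))))
    ; onJ = λ {r} p q → chord-sum (lia 4 (λ r a t k → r :≤ k :+ a ⇒ r :≤ 2 :* k :+ t :+ a) r a t k q)
        (there (c₁ (c₃ p)) (there (c₂ (c₃ p)) (there (c₃ p) (there p (here (s≤s q))))))
    ; onB′ = λ {r} p q → chord-sum (lia 4 (λ r a b k → r :≤ k :+ b ⇒ r :≤ :suc (k :+ a :+ b)) r a b k q)
        (there (c₁ (c₃ (c₄ p))) (there (c₂ (c₃ (c₄ p))) (there (c₃ (c₄ p)) (there (c₄ p) (there p (here (s≤s q)))))))
    ; onC′ = λ {r} p q → chord-sum (lia 4 (λ r b t k → r :< k :+ t ⇒ r :≤ k :+ b :+ t) r b t k q)
        (there (c₁ (c₃ (c₄ (c₅ p)))) (there (c₂ (c₃ (c₄ (c₅ p)))) (there (c₃ (c₄ (c₅ p))) (there (c₄ (c₅ p)) (there (c₅ p) (there p (here q)))))))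
    ; onJ′ = λ {r} p q → chord-sum (lia 4 (λ r a t k → r :< 2 :* k ⇒ r :≤ 2 :* k :+ t :+ a) r a t k q)
        (there (c₁ (c₃ (c₄ (c₅ (c₆ p))))) (there (c₂ (c₃ (c₄ (c₅ (c₆ p))))) (there (c₃ (c₄ (c₅ (c₆ p)))) (there (c₄ (c₅ (c₆ p))) (there (c₅ (c₆ p)) (there (c₆ p) (there p default)))))))
    }

  shape-unique : ∀ {μ ν r} → Shape k a b t μ → Shape k a b t ν → r < 2 * k → μ r ≡ ν r
  shape-unique {μ} {ν} {r} S S′ r<N with region S r<N
  ... | inI p e = ℕ.+-cancelˡ-≡ r _ _ (trans e (sym (Shape.onI S′ p)))
  ... | inB p q e = ℕ.+-cancelˡ-≡ r _ _ (trans e (sym (Shape.onB S′ p q)))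
  ... | inC p q e = ℕ.+-cancelˡ-≡ r _ _ (trans e (sym (Shape.onC S′ p q)))
  ... | inI′ p q e = ℕ.+-cancelˡ-≡ r _ _ (trans e (sym (Shape.onI′ S′ p q)))
  ... | inJ p q e = ℕ.+-cancelˡ-≡ r _ _ (trans e (sym (Shape.onJ S′ p q)))
  ... | inB′ p q e = ℕ.+-cancelˡ-≡ r _ _ (trans e (sym (Shape.onB′ S′ p q)))
  ... | inC′ p q e = ℕ.+-cancelˡ-≡ r _ _ (trans e (sym (Shape.onC′ S′ p q)))
  ... | inJ′ p q e = ℕ.+-cancelˡ-≡ r _ _ (trans e (sym (Shape.onJ′ S′ p q)))

-- Every shape is a chord diagram whose ascents are cycle minima

fold-invariant : ∀ {A : Set} (Q : A → Set) {f : A → A} → (∀ {x} → Q x → Q (f x)) →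
                 ∀ {x} → Q x → ∀ m → Q (fold x f m)
fold-invariant Q step q zero = q
fold-invariant Q step q (suc m) = step (fold-invariant Q step q m)

-- Tailored to cycles of length 2, 3 and 4: length 4, or length 2 with x₂ = x₀, closes by f x₃ = x₀,
-- while length 3 with x₃ = x₀ closes by f x₃ = x₁.
shortOrbit-≤ : ∀ {f : ℕ → ℕ} {x₀} x₁ x₂ x₃ → f x₀ ≡ x₁ → f x₁ ≡ x₂ → f x₂ ≡ x₃ → f x₃ ≡ x₀ ⊎ f x₃ ≡ x₁ →
               x₀ ≤ x₁ → x₀ ≤ x₂ → x₀ ≤ x₃ → ∀ m → x₀ ≤ fold x₀ f m
shortOrbit-≤ {f} {x₀} x₁ x₂ x₃ e₀ e₁ e₂ e₃ l₁ l₂ l₃ m = bound (fold-invariant Q step (inj₁ refl) m)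
  where
  Q : ℕ → Set
  Q y = y ≡ x₀ ⊎ y ≡ x₁ ⊎ y ≡ x₂ ⊎ y ≡ x₃
  step : ∀ {y} → Q y → Q (f y)
  step (inj₁ refl) = inj₂ (inj₁ e₀)
  step (inj₂ (inj₁ refl)) = inj₂ (inj₂ (inj₁ e₁))
  step (inj₂ (inj₂ (inj₁ refl))) = inj₂ (inj₂ (inj₂ e₂))
  step (inj₂ (inj₂ (inj₂ refl))) = [ inj₁ , (λ e → inj₂ (inj₁ e)) ] e₃
  bound : ∀ {y} → Q y → x₀ ≤ y
  bound (inj₁ refl) = ℕ.≤-refl
  bound (inj₂ (inj₁ refl)) = l₁
  bound (inj₂ (inj₂ (inj₁ refl))) = l₂
  bound (inj₂ (inj₂ (inj₂ refl))) = l₃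

module ShapeProperties {k a b t : ℕ} (a<b : a < b) (b<t : b < t) (t≤k : t ≤ k)
         {μ : ℕ → ℕ} (S : Shape k a b t μ) where

  open Shape S

  N : ℕ
  N = 2 * k

  private
    context : ∀ n → List (Ineq (4 + n))
    context n = (:suc (var (suc zero)) , var (suc (suc zero))) ∷
                (:suc (var (suc (suc zero))) , var (suc (suc (suc zero)))) ∷
                (var (suc (suc (suc zero))) , var zero) ∷ []

  -- The first four variables stand for k, a, b, t, and a < b < t ≤ k is assumed.
  lia′ : ∀ n (F : N-ary (4 + n) (Expr (4 + n)) (Form (4 + n))) →
         {_ : T (valid (context n) (close (4 + n) F))} →
         ∀ⁿ n (curryⁿ λ ρ → ⟦ close (4 + n) F ⟧ᶠ (k ∷ a ∷ b ∷ t ∷ ρ))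
  lia′ n F {v} = Equivalence.from (uncurry-∀ⁿ n) λ ρ →
    subst id (sym (left-inverse (λ ρ → ⟦ close (4 + n) F ⟧ᶠ (k ∷ a ∷ b ∷ t ∷ ρ)) ρ))
      (valid-correct (context n) (close (4 + n) F) (k ∷ a ∷ b ∷ t ∷ ρ) v (a<b , b<t , t≤k , tt))

  bounded : ∀ {r} → r < N → μ r < N
  bounded {r} r<N with region S r<N
  ... | inI _ e = lia′ 2 (λ k a b t r s → r :+ s :≡ t :+ a ⇒ s :< 2 :* k) r (μ r) e
  ... | inB p _ e = lia′ 2 (λ k a b t r s → a :< r ⇒ r :+ s :≡ :suc (k :+ a :+ b) ⇒ s :< 2 :* k) r (μ r) p e
  ... | inC p _ e = lia′ 2 (λ k a b t r s → b :< r ⇒ r :+ s :≡ k :+ b :+ t ⇒ s :< 2 :* k) r (μ r) p e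
  ... | inI′ _ _ e = lia′ 2 (λ k a b t r s → r :+ s :≡ t :+ a ⇒ s :< 2 :* k) r (μ r) e
  ... | inJ p _ e = lia′ 2 (λ k a b t r s → t :+ a :< r ⇒ r :+ s :≡ 2 :* k :+ t :+ a ⇒ s :< 2 :* k) r (μ r) p e
  ... | inB′ p _ e = lia′ 2 (λ k a b t r s → k :+ a :< r ⇒ r :+ s :≡ :suc (k :+ a :+ b) ⇒ s :< 2 :* k) r (μ r) p e
  ... | inC′ p _ e = lia′ 2 (λ k a b t r s → k :+ b :< r ⇒ r :+ s :≡ k :+ b :+ t ⇒ s :< 2 :* k) r (μ r) p e
  ... | inJ′ p _ e = lia′ 2 (λ k a b t r s → k :+ t :≤ r ⇒ r :+ s :≡ 2 :* k :+ t :+ a ⇒ s :< 2 :* k) r (μ r) p e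

  private
    same-sum : ∀ {r s r′ c} → r + s ≡ c → s + r′ ≡ c → r′ ≡ r
    same-sum {r} {s} {r′} {c} = lia 4 (λ r s r′ c → r :+ s :≡ c ⇒ s :+ r′ :≡ c ⇒ r′ :≡ r) r s r′ c

  -- The opening and the closing interval of a class carry the same sum, so it is enough to locate
  -- `μ r` in the opposite interval.
  involutive : ∀ {r} → r < N → μ (μ r) ≡ r
  involutive {r} r<N with region S r<N
  ... | inI p e = same-sum e (onI′
    (lia′ 2 (λ k a b t r s → r :≤ a ⇒ r :+ s :≡ t :+ a ⇒ t :≤ s) r (μ r) p e)
    (lia′ 2 (λ k a b t r s → r :+ s :≡ t :+ a ⇒ s :≤ t :+ a) r (μ r) e))
  ... | inB p q e = same-sum e (onB′
    (lia′ 2 (λ k a b t r s → r :≤ b ⇒ r :+ s :≡ :suc (k :+ a :+ b) ⇒ k :+ a :< s) r (μ r) q e)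
    (lia′ 2 (λ k a b t r s → a :< r ⇒ r :+ s :≡ :suc (k :+ a :+ b) ⇒ s :≤ k :+ b) r (μ r) p e))
  ... | inC p q e = same-sum e (onC′
    (lia′ 2 (λ k a b t r s → r :< t ⇒ r :+ s :≡ k :+ b :+ t ⇒ k :+ b :< s) r (μ r) q e)
    (lia′ 2 (λ k a b t r s → b :< r ⇒ r :+ s :≡ k :+ b :+ t ⇒ s :< k :+ t) r (μ r) p e))
  ... | inI′ p q e = same-sum e (onI
    (lia′ 2 (λ k a b t r s → t :≤ r ⇒ r :+ s :≡ t :+ a ⇒ s :≤ a) r (μ r) p e))
  ... | inJ p q e = same-sum e (onJ′
    (lia′ 2 (λ k a b t r s → r :≤ k :+ a ⇒ r :+ s :≡ 2 :* k :+ t :+ a ⇒ k :+ t :≤ s) r (μ r) q e)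
    (bounded r<N))
  ... | inB′ p q e = same-sum e (onB
    (lia′ 2 (λ k a b t r s → r :≤ k :+ b ⇒ r :+ s :≡ :suc (k :+ a :+ b) ⇒ a :< s) r (μ r) q e)
    (lia′ 2 (λ k a b t r s → k :+ a :< r ⇒ r :+ s :≡ :suc (k :+ a :+ b) ⇒ s :≤ b) r (μ r) p e))
  ... | inC′ p q e = same-sum e (onC
    (lia′ 2 (λ k a b t r s → r :< k :+ t ⇒ r :+ s :≡ k :+ b :+ t ⇒ b :< s) r (μ r) q e)
    (lia′ 2 (λ k a b t r s → k :+ b :< r ⇒ r :+ s :≡ k :+ b :+ t ⇒ s :< t) r (μ r) p e))
  ... | inJ′ p q e = same-sum e (onJ
    (lia′ 2 (λ k a b t r s → r :< 2 :* k ⇒ r :+ s :≡ 2 :* k :+ t :+ a ⇒ t :+ a :< s) r (μ r) q e)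
    (lia′ 2 (λ k a b t r s → k :+ t :≤ r ⇒ r :+ s :≡ 2 :* k :+ t :+ a ⇒ s :≤ k :+ a) r (μ r) p e))

  irreflexive : ∀ {r} → r < N → μ r ≢ r
  irreflexive {r} r<N μr≡r with region S r<N
  ... | inI p e = lia′ 2 (λ k a b t r s → s :≡ r ⇒ r :≤ a ⇒ r :+ s :≡ t :+ a ⇒ :⊥) r (μ r) μr≡r p e
  ... | inB p q e = lia′ 2 (λ k a b t r s → s :≡ r ⇒ r :≤ b ⇒ r :+ s :≡ :suc (k :+ a :+ b) ⇒ :⊥) r (μ r) μr≡r q e
  ... | inC p q e = lia′ 2 (λ k a b t r s → s :≡ r ⇒ r :< t ⇒ r :+ s :≡ k :+ b :+ t ⇒ :⊥) r (μ r) μr≡r q e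
  ... | inI′ p q e = lia′ 2 (λ k a b t r s → s :≡ r ⇒ t :≤ r ⇒ r :+ s :≡ t :+ a ⇒ :⊥) r (μ r) μr≡r p e
  ... | inJ p q e = lia′ 2 (λ k a b t r s → s :≡ r ⇒ r :≤ k :+ a ⇒ r :+ s :≡ 2 :* k :+ t :+ a ⇒ :⊥) r (μ r) μr≡r q e
  ... | inB′ p q e = lia′ 2 (λ k a b t r s → s :≡ r ⇒ k :+ a :< r ⇒ r :+ s :≡ :suc (k :+ a :+ b) ⇒ :⊥) r (μ r) μr≡r p e
  ... | inC′ p q e = lia′ 2 (λ k a b t r s → s :≡ r ⇒ k :+ b :< r ⇒ r :+ s :≡ k :+ b :+ t ⇒ :⊥) r (μ r) μr≡r p e
  ... | inJ′ p q e = lia′ 2 (λ k a b t r s → s :≡ r ⇒ k :+ t :≤ r ⇒ r :+ s :≡ 2 :* k :+ t :+ a ⇒ :⊥) r (μ r) μr≡r p e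

  γ : ℕ → ℕ
  γ = rotated N μ

  μ0 : μ 0 ≡ t + a
  μ0 = onI z≤n

  γ-closer : ∀ {r} → suc r < N → μ (suc r) ≢ r
  γ-closer {r} r<N eq with region S r<N
  ... | inI p e = lia′ 2 (λ k a b t r s → s :≡ r ⇒ :suc r :≤ a ⇒ :suc r :+ s :≡ t :+ a ⇒ :⊥) r (μ (suc r)) eq p e
  ... | inB p q e = lia′ 2 (λ k a b t r s → s :≡ r ⇒ :suc r :≤ b ⇒ :suc r :+ s :≡ :suc (k :+ a :+ b) ⇒ :⊥) r (μ (suc r)) eq q e
  ... | inC p q e = lia′ 2 (λ k a b t r s → s :≡ r ⇒ :suc r :< t ⇒ :suc r :+ s :≡ k :+ b :+ t ⇒ :⊥) r (μ (suc r)) eq q e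
  ... | inI′ p q e = lia′ 2 (λ k a b t r s → s :≡ r ⇒ t :≤ :suc r ⇒ :suc r :+ s :≡ t :+ a ⇒ :⊥) r (μ (suc r)) eq p e
  ... | inJ p q e = lia′ 2 (λ k a b t r s → s :≡ r ⇒ :suc r :≤ k :+ a ⇒ :suc r :+ s :≡ 2 :* k :+ t :+ a ⇒ :⊥) r (μ (suc r)) eq q e
  ... | inB′ p q e = lia′ 2 (λ k a b t r s → s :≡ r ⇒ k :+ a :< :suc r ⇒ :suc r :+ s :≡ :suc (k :+ a :+ b) ⇒ :⊥) r (μ (suc r)) eq p e
  ... | inC′ p q e = lia′ 2 (λ k a b t r s → s :≡ r ⇒ k :+ b :< :suc r ⇒ :suc r :+ s :≡ k :+ b :+ t ⇒ :⊥) r (μ (suc r)) eq p e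
  ... | inJ′ p q e = lia′ 2 (λ k a b t r s → s :≡ r ⇒ k :+ t :≤ :suc r ⇒ :suc r :+ s :≡ 2 :* k :+ t :+ a ⇒ :⊥) r (μ (suc r)) eq p e

  γ-irreflexive : ∀ {r} → r < N → γ r ≢ r
  γ-irreflexive {r} r<N eq with ℕ.m≤n⇒m<n∨m≡n r<N
  ... | inj₁ p = γ-closer p (trans (sym (rotated-suc N μ p)) eq)
  ... | inj₂ p = lia′ 2 (λ k a b t r s → :suc r :≡ 2 :* k ⇒ s :≡ t :+ a ⇒ s :≡ r ⇒ :⊥) r (μ 0) p μ0
                   (trans (sym (rotated-last N μ p)) eq)

  private
    γ-value : ∀ {r c} s → suc r < N → suc r + μ (suc r) ≡ c → suc r + s ≡ c → γ r ≡ s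
    γ-value {r} s p e e′ = trans (rotated-suc N μ p) (ℕ.+-cancelˡ-≡ (suc r) _ _ (trans e (sym e′)))

    γ-last : ∀ {r} s → suc r ≡ N → s ≡ t + a → γ r ≡ s
    γ-last s p e = trans (rotated-last N μ p) (trans μ0 (sym e))

    twoCycle : ∀ {r} s → γ r ≡ s → γ s ≡ r → r ≤ s → ∀ m → r ≤ fold r γ m
    twoCycle {r} s e e′ l = shortOrbit-≤ s r s e e′ e (inj₁ e′) l ℕ.≤-refl l

  -- The region of r + 1 decides. Inside a class γ exchanges r and s = μ (r + 1), because the chords
  -- joining r + 1 with s and r with s + 1 are neighbours. Longer cycles begin at `a` and `b`, the
  -- points before B and C. If r + 1 closes a chord, r is a descent.
  ascentMin : ∀ {r} → r < N → r ≤ γ r → ∀ m → r ≤ fold r γ m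
  ascentMin {r} r<N r≤γr with ℕ.m≤n⇒m<n∨m≡n r<N
  ... | inj₂ p = ⊥-elim (lia′ 2 (λ k a b t r s → :suc r :≡ 2 :* k ⇒ s :≡ t :+ a ⇒ r :≤ s ⇒ :⊥) r (γ r) p
                   (trans (rotated-last N μ p) μ0) r≤γr)
  ... | inj₁ p with region S p
  ...   | inI u e = twoCycle (μ (suc r)) γr
            (γ-value r (lia′ 2 (λ k a b t r s → :suc r :+ s :≡ t :+ a ⇒ :suc s :< 2 :* k) r (μ (suc r)) e)
              (onI′ (lia′ 2 (λ k a b t r s → :suc r :≤ a ⇒ :suc r :+ s :≡ t :+ a ⇒ t :≤ :suc s) r (μ (suc r)) u e)
                    (lia′ 2 (λ k a b t r s → :suc r :+ s :≡ t :+ a ⇒ :suc s :≤ t :+ a) r (μ (suc r)) e))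
              (lia′ 2 (λ k a b t r s → :suc r :+ s :≡ t :+ a ⇒ :suc s :+ r :≡ t :+ a) r (μ (suc r)) e))
            (subst (r ≤_) γr r≤γr)
    where γr = rotated-suc N μ p
  ...   | inB u v e = case ℕ.m≤n⇒m<n∨m≡n u of λ where
            (inj₁ u′) → twoCycle (μ (suc r)) γr
              (γ-value r (lia′ 2 (λ k a b t r s → :suc a :< :suc r ⇒ :suc r :+ s :≡ :suc (k :+ a :+ b) ⇒ :suc s :< 2 :* k) r (μ (suc r)) u′ e)
                (onB′ (lia′ 2 (λ k a b t r s → :suc r :≤ b ⇒ :suc r :+ s :≡ :suc (k :+ a :+ b) ⇒ k :+ a :< :suc s) r (μ (suc r)) v e)
                      (lia′ 2 (λ k a b t r s → :suc a :< :suc r ⇒ :suc r :+ s :≡ :suc (k :+ a :+ b) ⇒ :suc s :≤ k :+ b) r (μ (suc r)) u′ e))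
                (lia′ 2 (λ k a b t r s → :suc r :+ s :≡ :suc (k :+ a :+ b) ⇒ :suc s :+ r :≡ :suc (k :+ a :+ b)) r (μ (suc r)) e))
              (subst (r ≤_) γr r≤γr)
            (inj₂ refl) → orbit-a
    where
    γr = rotated-suc N μ p
    γa : γ a ≡ k + b
    γa = γ-value (k + b) (lia′ 0 (λ k a b t → :suc a :< 2 :* k))
           (onB ℕ.≤-refl a<b) (lia′ 0 (λ k a b t → :suc a :+ (k :+ b) :≡ :suc (k :+ a :+ b)))
    γ[k+a] : ∀ {x} → x ≡ k + a → t ≡ suc b → γ x ≡ b
    γ[k+a] {x} e t≡ = γ-value b (lia′ 1 (λ k a b t x → x :≡ k :+ a ⇒ :suc x :< 2 :* k) x e)
      (onB′ (lia′ 1 (λ k a b t x → x :≡ k :+ a ⇒ k :+ a :< :suc x) x e)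
            (lia′ 1 (λ k a b t x → x :≡ k :+ a ⇒ :suc x :≤ k :+ b) x e))
      (lia′ 1 (λ k a b t x → x :≡ k :+ a ⇒ :suc x :+ b :≡ :suc (k :+ a :+ b)) x e)
    γ[t-1] : ∀ {x} → suc x ≡ t → γ x ≡ a
    γ[t-1] {x} e = γ-value a (lia′ 1 (λ k a b t x → :suc x :≡ t ⇒ :suc x :< 2 :* k) x e)
      (onI′ (ℕ.≤-reflexive (sym e)) (lia′ 1 (λ k a b t x → :suc x :≡ t ⇒ :suc x :≤ t :+ a) x e))
      (lia′ 1 (λ k a b t x → :suc x :≡ t ⇒ :suc x :+ a :≡ t :+ a) x e)
    -- The 3-cycle a, k + b, t - 1 if C is nonempty, and the 4-cycle a, k + b, k + a, b if C is
    -- empty.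
    orbit-a : ∀ m → a ≤ fold a γ m
    orbit-a with ℕ.m≤n⇒m<n∨m≡n b<t
    ... | inj₁ b<t′ = shortOrbit-≤ (k + b) x a γa γ[k+b] (γ[t-1] sx≡t) (inj₂ γa) 
            (lia′ 0 (λ k a b t → a :≤ k :+ b)) (lia′ 1 (λ k a b t x → :suc x :≡ t ⇒ a :≤ x) x sx≡t) ℕ.≤-refl
      where
      x = pred t
      sx≡t : suc x ≡ t
      sx≡t = ℕ.suc-pred t {{>-nonZero (ℕ.≤-<-trans z≤n b<t)}}
      γ[k+b] : γ (k + b) ≡ x
      γ[k+b] = γ-value x (lia′ 0 (λ k a b t → :suc b :< t ⇒ :suc (k :+ b) :< 2 :* k) b<t′)
        (onC′ (lia′ 0 (λ k a b t → k :+ b :< :suc (k :+ b))) (lia′ 0 (λ k a b t → :suc b :< t ⇒ :suc (k :+ b) :< k :+ t) b<t′))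
        (lia′ 1 (λ k a b t x → :suc x :≡ t ⇒ :suc (k :+ b) :+ x :≡ k :+ b :+ t) x sx≡t)
    ... | inj₂ refl = shortOrbit-≤ (k + b) (k + a) b γa γ[k+b] (γ[k+a] refl refl) (inj₁ (γ[t-1] refl))
            (lia′ 0 (λ k a b t → a :≤ k :+ b)) (lia′ 0 (λ k a b t → a :≤ k :+ a)) (ℕ.<⇒≤ a<b)
      where
      γ[k+b] : γ (k + b) ≡ k + a
      γ[k+b] with ℕ.m≤n⇒m<n∨m≡n t≤k
      ... | inj₁ t<k = γ-value (k + a) (lia′ 0 (λ k a b t → t :< k ⇒ t :≡ :suc b ⇒ :suc (k :+ b) :< 2 :* k) t<k refl)
              (onJ′ (lia′ 0 (λ k a b t → t :≡ :suc b ⇒ k :+ t :≤ :suc (k :+ b)) refl)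
                    (lia′ 0 (λ k a b t → t :< k ⇒ t :≡ :suc b ⇒ :suc (k :+ b) :< 2 :* k) t<k refl))
              (lia′ 0 (λ k a b t → t :≡ :suc b ⇒ :suc (k :+ b) :+ (k :+ a) :≡ 2 :* k :+ t :+ a) refl)
      -- With C and J both empty k + b is the last point, so that the next one is 0.
      ... | inj₂ refl = γ-last (k + a) (lia′ 0 (λ k a b t → t :≡ k ⇒ t :≡ :suc b ⇒ :suc (k :+ b) :≡ 2 :* k) refl refl) refl
  ...   | inC u v e = case ℕ.m≤n⇒m<n∨m≡n u of λ where
            (inj₁ u′) → twoCycle (μ (suc r)) γr
              (γ-value r (lia′ 2 (λ k a b t r s → :suc b :< :suc r ⇒ :suc r :+ s :≡ k :+ b :+ t ⇒ :suc s :< 2 :* k) r (μ (suc r)) u′ e)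
                (onC′ (lia′ 2 (λ k a b t r s → :suc r :< t ⇒ :suc r :+ s :≡ k :+ b :+ t ⇒ k :+ b :< :suc s) r (μ (suc r)) v e)
                      (lia′ 2 (λ k a b t r s → :suc b :< :suc r ⇒ :suc r :+ s :≡ k :+ b :+ t ⇒ :suc s :< k :+ t) r (μ (suc r)) u′ e))
                (lia′ 2 (λ k a b t r s → :suc r :+ s :≡ k :+ b :+ t ⇒ :suc s :+ r :≡ k :+ b :+ t) r (μ (suc r)) e))
              (subst (r ≤_) γr r≤γr)
            (inj₂ refl) → orbit-b v
    where
    γr = rotated-suc N μ p
    -- The other 3-cycle b, k + t - 1, k + a, present only if C is nonempty.
    orbit-b : suc b < t → ∀ m → b ≤ fold b γ m
    orbit-b b<t′ = shortOrbit-≤ x (k + a) b γb γx γ[k+a] (inj₂ γb)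
        (lia′ 1 (λ k a b t x → :suc x :≡ k :+ t ⇒ b :≤ x) x sx≡) (lia′ 0 (λ k a b t → b :≤ k :+ a)) ℕ.≤-refl
      where
      x = pred (k + t)
      sx≡ : suc x ≡ k + t
      sx≡ = ℕ.suc-pred (k + t) {{>-nonZero (lia′ 0 (λ k a b t → # 0 :< k :+ t))}}
      γb : γ b ≡ x
      γb = γ-value x (lia′ 0 (λ k a b t → :suc b :< 2 :* k)) (onC ℕ.≤-refl b<t′)
             (lia′ 1 (λ k a b t x → :suc x :≡ k :+ t ⇒ :suc b :+ x :≡ k :+ b :+ t) x sx≡)
      γ[k+a] : γ (k + a) ≡ b
      γ[k+a] = γ-value b (lia′ 0 (λ k a b t → :suc (k :+ a) :< 2 :* k))
        (onB′ ℕ.≤-refl (lia′ 0 (λ k a b t → :suc (k :+ a) :≤ k :+ b)))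
        (lia′ 0 (λ k a b t → :suc (k :+ a) :+ b :≡ :suc (k :+ a :+ b)))
      γx : γ x ≡ k + a
      γx with ℕ.m≤n⇒m<n∨m≡n t≤k
      ... | inj₁ t<k = γ-value (k + a) sx<N (onJ′ (ℕ.≤-reflexive (sym sx≡)) sx<N)
              (lia′ 1 (λ k a b t x → :suc x :≡ k :+ t ⇒ :suc x :+ (k :+ a) :≡ 2 :* k :+ t :+ a) x sx≡)
        where
        sx<N : suc x < N
        sx<N = lia′ 1 (λ k a b t x → :suc x :≡ k :+ t ⇒ t :< k ⇒ :suc x :< 2 :* k) x sx≡ t<k
      ... | inj₂ refl = γ-last (k + a) (lia′ 1 (λ k a b t x → :suc x :≡ k :+ t ⇒ t :≡ k ⇒ :suc x :≡ 2 :* k) x sx≡ refl) refl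
  ...   | inI′ u v e = ⊥-elim (lia′ 2 (λ k a b t r s → t :≤ :suc r ⇒ :suc r :+ s :≡ t :+ a ⇒ r :≤ s ⇒ :⊥) r (μ (suc r)) u e (subst (r ≤_) (rotated-suc N μ p) r≤γr))
  ...   | inJ u v e = case ℕ.m≤n⇒m<n∨m≡n u of λ where
            (inj₁ u′) → twoCycle (μ (suc r)) γr
              (γ-value r (ss<N u′)
                (onJ′ (lia′ 2 (λ k a b t r s → :suc r :≤ k :+ a ⇒ :suc r :+ s :≡ 2 :* k :+ t :+ a ⇒ k :+ t :≤ :suc s) r (μ (suc r)) v e)
                      (ss<N u′))
                (lia′ 2 (λ k a b t r s → :suc r :+ s :≡ 2 :* k :+ t :+ a ⇒ :suc s :+ r :≡ 2 :* k :+ t :+ a) r (μ (suc r)) e))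
              (subst (r ≤_) γr r≤γr)
            -- The first chord of J ends at 2k - 1, next to 0, and is therefore the neighbour of the
            -- outermost chord of I: here the class cut at the base point is closed up.
            (inj₂ refl) → twoCycle (μ (suc r)) γr
              (γ-last r (lia′ 2 (λ k a b t r s → :suc (t :+ a) :≡ :suc r ⇒ :suc r :+ s :≡ 2 :* k :+ t :+ a ⇒ :suc s :≡ 2 :* k) r (μ (suc r)) refl e) refl)
              (subst (r ≤_) γr r≤γr)
    where
    γr = rotated-suc N μ p
    ss<N : suc (t + a) < suc r → suc (μ (suc r)) < N
    ss<N u′ = lia′ 2 (λ k a b t r s → :suc (t :+ a) :< :suc r ⇒ :suc r :+ s :≡ 2 :* k :+ t :+ a ⇒ :suc s :< 2 :* k) r (μ (suc r)) u′ e
  ...   | inB′ u v e = ⊥-elim (lia′ 2 (λ k a b t r s → k :+ a :< :suc r ⇒ :suc r :+ s :≡ :suc (k :+ a :+ b) ⇒ r :≤ s ⇒ :⊥) r (μ (suc r)) u e (subst (r ≤_) (rotated-suc N μ p) r≤γr))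
  ...   | inC′ u v e = ⊥-elim (lia′ 2 (λ k a b t r s → k :+ b :< :suc r ⇒ :suc r :+ s :≡ k :+ b :+ t ⇒ r :≤ s ⇒ :⊥) r (μ (suc r)) u e (subst (r ≤_) (rotated-suc N μ p) r≤γr))
  ...   | inJ′ u v e = ⊥-elim (lia′ 2 (λ k a b t r s → k :+ t :≤ :suc r ⇒ :suc r :+ s :≡ 2 :* k :+ t :+ a ⇒ r :≤ s ⇒ :⊥) r (μ (suc r)) u e (subst (r ≤_) (rotated-suc N μ p) r≤γr))

  chordDiagram : ChordDiagram N μ
  chordDiagram = record
    { bounded = bounded ; involutive = involutive ; irreflexive = irreflexive
    ; reduced = γ-irreflexive ; ascentMin = ascentMin }

-- The diagram determines its three parameters

-- The partner of t in μ lies before t, whereas in ν every point before t′ opens its chord.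
first-closer : ∀ {k a b t a′ b′ t′ μ ν} → a < b → b < t → t ≤ k → a′ < b′ → b′ < t′ → t′ ≤ k →
               Shape k a b t μ → Shape k a′ b′ t′ ν → (∀ {r} → r < 2 * k → μ r ≡ ν r) → t′ ≤ t
first-closer {k} {a} {b} {t} {a′} {b′} {t′} {μ} {ν} a<b b<t t≤k a<b′ b<t′ t≤k′ S S′ μ≗ν = ℕ.≮⇒≥ λ t<t′ →
  let t<N = lia 3 (λ t t′ k → t :< t′ ⇒ t′ :≤ k ⇒ t :< 2 :* k) t t′ k t<t′ t≤k′
      μt<t = lia 4 (λ a b t s → a :< b ⇒ b :< t ⇒ t :+ s :≡ t :+ a ⇒ s :< t) a b t (ν t) a<b b<t
               (trans (cong (t +_) (sym (μ≗ν t<N))) (Shape.onI′ S ℕ.≤-refl (ℕ.m≤m+n t a)))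
  in case region S′ t<N of λ where
    (inI p e) → P′.lia′ 2 (λ k a b t r s → r :≤ a ⇒ s :< r ⇒ r :+ s :≡ t :+ a ⇒ :⊥) t (ν t) p μt<t e
    (inB _ p e) → P′.lia′ 2 (λ k a b t r s → r :≤ b ⇒ s :< r ⇒ r :+ s :≡ :suc (k :+ a :+ b) ⇒ :⊥) t (ν t) p μt<t e
    (inC _ p e) → P′.lia′ 2 (λ k a b t r s → r :< t ⇒ s :< r ⇒ r :+ s :≡ k :+ b :+ t ⇒ :⊥) t (ν t) p μt<t e
    (inI′ p _ _) → ℕ.<⇒≱ t<t′ p
    (inJ p _ _) → P′.lia′ 1 (λ k a b t r → r :< t ⇒ t :+ a :< r ⇒ :⊥) t t<t′ p
    (inB′ p _ _) → P′.lia′ 1 (λ k a b t r → r :< t ⇒ k :+ a :< r ⇒ :⊥) t t<t′ p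
    (inC′ p _ _) → P′.lia′ 1 (λ k a b t r → r :< t ⇒ k :+ b :< r ⇒ :⊥) t t<t′ p
    (inJ′ p _ _) → P′.lia′ 1 (λ k a b t r → r :< t ⇒ k :+ t :≤ r ⇒ :⊥) t t<t′ p
  where module P′ = ShapeProperties a<b′ b<t′ t≤k′ S′

-- The first closing point is t, the partner of 0 is t + a, and the partner of k + a + 1 is b.
shape-parameters : ∀ {k a b t a′ b′ t′ μ ν} → a < b → b < t → t ≤ k → a′ < b′ → b′ < t′ → t′ ≤ k →
                   Shape k a b t μ → Shape k a′ b′ t′ ν → (∀ {r} → r < 2 * k → μ r ≡ ν r) →
                   a ≡ a′ × b ≡ b′ × t ≡ t′
shape-parameters {k} {a} {b} {t} {a′} {b′} {t′} {μ} {ν} a<b b<t t≤k a<b′ b<t′ t≤k′ S S′ μ≗ν = a≡ , b≡ , t≡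
  where
  module P = ShapeProperties a<b b<t t≤k S
  module P′ = ShapeProperties a<b′ b<t′ t≤k′ S′
  t≡ : t ≡ t′
  t≡ = ℕ.≤-antisym (first-closer a<b′ b<t′ t≤k′ a<b b<t t≤k S′ S (λ r<N → sym (μ≗ν r<N)))
                   (first-closer a<b b<t t≤k a<b′ b<t′ t≤k′ S S′ μ≗ν)

  0<N : 0 < 2 * k
  0<N = P.lia′ 0 (λ k a b t → # 0 :< 2 :* k)

  a≡ : a ≡ a′
  a≡ = ℕ.+-cancelˡ-≡ t a a′ (trans (sym P.μ0) (trans (μ≗ν 0<N) (trans P′.μ0 (cong (_+ a′) (sym t≡)))))

  b≡ : b ≡ b′
  b≡ = ℕ.+-cancelˡ-≡ (suc (k + a)) b b′
    (trans (sym (partner S a<b)) (trans (cong (suc (k + a) +_) (μ≗ν (P.lia′ 0 (λ k a b t → :suc (k :+ a) :< 2 :* k))))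
      (subst (λ x → suc (k + x) + ν (suc (k + x)) ≡ suc (k + x + b′)) (sym a≡) (partner S′ a<b′))))
    where
    partner : ∀ {a b t μ} → Shape k a b t μ → a < b → suc (k + a) + μ (suc (k + a)) ≡ suc (k + a + b)
    partner {a} {b} S a<b = Shape.onB′ S ℕ.≤-refl (lia 3 (λ k a b → a :< b ⇒ :suc (k :+ a) :≤ k :+ b) k a b a<b)

-- Classification: every such chord diagram has a shape

leastFrom : ∀ {P : ℕ → Set} → (∀ i → Dec (P i)) → ∀ w d → P (w + d) →
            ∃[ m ] w ≤ m × m ≤ w + d × P m × (∀ {i} → w ≤ i → i < m → ¬ P i)
leastFrom P? w d Pd with P? w
... | yes Pw = w , ℕ.≤-refl , ℕ.m≤m+n w d , Pw , λ w≤i i<w → ⊥-elim (ℕ.<⇒≱ i<w w≤i)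
leastFrom {P} P? w zero Pd | no ¬Pw = ⊥-elim (¬Pw (subst P (ℕ.+-identityʳ w) Pd))
leastFrom {P} P? w (suc d) Pd | no ¬Pw =
  let (m , w<m , m≤ , Pm , below) = leastFrom P? (suc w) d (subst P (ℕ.+-suc w d) Pd)
  in m , ℕ.<⇒≤ w<m , subst (m ≤_) (sym (ℕ.+-suc w d)) m≤ , Pm ,
     λ {i} w≤i i<m Pi → case ℕ.m≤n⇒m<n∨m≡n w≤i of λ where
       (inj₁ w<i) → below w<i i<m Pi
       (inj₂ refl) → ¬Pw Pi

-- `uniqueAscent` says that two minima of one cycle agree, for which the orbit has to return.
-- `Contraction` obtains this from the finite permutation β, so it enters here as a hypothesis.
module Complete (k : ℕ) (0<k : 0 < k) (μ : ℕ → ℕ) (D : ChordDiagram (2 * k) μ)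
  (uniqueAscent : ∀ {r} → r < 2 * k → r ≤ rotated (2 * k) μ r → ∀ m →
    fold r (rotated (2 * k) μ) m ≤ rotated (2 * k) μ (fold r (rotated (2 * k) μ) m) →
    fold r (rotated (2 * k) μ) m ≡ r) where

  open ChordDiagram D

  N : ℕ
  N = 2 * k

  γ : ℕ → ℕ
  γ = rotated N μ

  0<N : 0 < N
  0<N = lia 1 (λ k → # 0 :< k ⇒ # 0 :< 2 :* k) k 0<k

  Opener Closer : ℕ → Set
  Opener r = r < μ r
  Closer r = μ r < r

  opener∨closer : ∀ {r} → r < N → Opener r ⊎ Closer r
  opener∨closer {r} r<N with ℕ.<-cmp r (μ r)
  ... | tri< p _ _ = inj₁ p
  ... | tri≈ _ p _ = ⊥-elim (irreflexive r<N (sym p))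
  ... | tri> _ _ p = inj₂ p

  ¬closer⇒opener : ∀ {r} → r < N → ¬ Closer r → Opener r
  ¬closer⇒opener r<N ¬c = [ id , (λ c → ⊥-elim (¬c c)) ] (opener∨closer r<N)

  ¬both : ∀ {r} → Opener r → ¬ Closer r
  ¬both o c = ℕ.<-asym o c

  partner : ∀ {r s} → r < N → μ r ≡ s → μ s ≡ r
  partner r<N refl = involutive r<N

  opener-partner : ∀ {r} → r < N → Opener r → Closer (μ r)
  opener-partner {r} r<N o = subst (_< μ r) (sym (involutive r<N)) o

  closer-partner : ∀ {r} → r < N → Closer r → Opener (μ r)
  closer-partner {r} r<N o = subst (μ r <_) (sym (involutive r<N)) o

  -- The point x = o - 1 is an ascent of γ with γ x = M, so the orbit of x stays above x and has no
  -- other ascent.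
  next : ∀ {o M} → 0 < o → o < N → o < M → μ o ≡ M → suc M < N →
         μ (suc M) ≤ M × (suc (μ (suc M)) ≡ o ⊎ (o < μ (suc M) × Closer (suc (μ (suc M)))))
  next {suc x} {M} _ o<N o<M refl M<N = e≤M , (case ℕ.m≤n⇒m<n∨m≡n x≤e of λ where
      (inj₂ x≡e) → inj₁ (cong suc (sym x≡e))
      (inj₁ x<e) → inj₂ (ℕ.≤∧≢⇒< x<e (λ o≡e → ℕ.1+n≢n (trans (sym (partner M<N (sym o≡e))) refl)) ,
        s≤s (ℕ.<⇒≤ (ℕ.≰⇒> λ e≤ → ℕ.<⇒≢ x<e (sym (trans (sym γ²x) (unique₂ e≤)))))))
    where
    e = μ (suc M)
    x<N = ℕ.<-trans (ℕ.n<1+n x) o<N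
    γx : γ x ≡ M
    γx = rotated-suc N μ o<N
    γM : γ M ≡ e
    γM = rotated-suc N μ M<N
    γ²x : γ (γ x) ≡ e
    γ²x = trans (cong γ γx) γM
    x<M : x < M
    x<M = ℕ.<-trans (ℕ.n<1+n x) o<M
    x≤γx : x ≤ γ x
    x≤γx = subst (x ≤_) (sym γx) (ℕ.<⇒≤ x<M)
    x≤e : x ≤ e
    x≤e = subst (x ≤_) γ²x (ascentMin x<N x≤γx 2)
    e≤M : e ≤ M
    e≤M = ℕ.≮⇒≥ λ M<e → ℕ.<⇒≢ x<M (sym (trans (sym γx)
      (uniqueAscent x<N x≤γx 1 (subst₂ _≤_ (sym γx) (sym γ²x) (ℕ.<⇒≤ M<e)))))
    unique₂ : e ≤ μ (suc e) → γ (γ x) ≡ x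
    unique₂ e≤ = uniqueAscent x<N x≤γx 2
      (subst₂ _≤_ (sym γ²x) (sym (trans (cong γ γ²x) (rotated-suc N μ (ℕ.≤-<-trans (s≤s e≤M) M<N)))) e≤)

  last-closer : Closer (pred N)
  last-closer = case opener∨closer {pred N} (ℕ.≤-reflexive N≡) of λ where
      (inj₂ c) → c
      (inj₁ o) → ⊥-elim (ℕ.<⇒≱ (bounded (ℕ.≤-reflexive N≡)) (subst (_≤ μ (pred N)) N≡ o))
    where
    N≡ : suc (pred N) ≡ N
    N≡ = ℕ.suc-pred N {{>-nonZero 0<N}}

  module FirstCloser (t : ℕ) (t<N : t < N) (t-closer : Closer t)
                     (openers : ∀ {i} → i < t → Opener i) where

    c : ℕ
    c = μ 0

    c<N : c < N
    c<N = bounded 0<N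

    t≤-closer : ∀ {r} → Closer r → t ≤ r
    t≤-closer cl = ℕ.≮⇒≥ λ r<t → ¬both (openers r<t) cl

    0<t : 0 < t
    0<t = ℕ.≤-<-trans z≤n t-closer

    t≤c : t ≤ c
    t≤c = t≤-closer (opener-partner 0<N (openers 0<t))

    -- This is `next` for the chord closing at p. The rule looks at the point before the opening
    -- one, so the chord from 0 to c is excluded.
    closers-step : ∀ {p} → suc p < N → Closer p → p ≢ c → Closer (suc p)
    closers-step {p} p<N cl p≢c = s≤s (proj₁ (next o>0 (ℕ.<-trans cl p<N′) cl (involutive p<N′) p<N))
      where
      p<N′ = ℕ.<-trans (ℕ.n<1+n p) p<N
      o>0 : 0 < μ p
      o>0 = ℕ.n≢0⇒n>0 λ μp≡0 → p≢c (sym (partner p<N′ μp≡0))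

    closers : ∀ d → t + d ≤ c → Closer (t + d)
    closers zero _ = subst Closer (sym (ℕ.+-identityʳ t)) t-closer
    closers (suc d) t+d≤c = subst Closer (sym (ℕ.+-suc t d))
      (closers-step (ℕ.≤-<-trans t+d<c c<N) (closers d (ℕ.<⇒≤ t+d<c)) (ℕ.<⇒≢ t+d<c))
      where
      t+d<c : t + d < c
      t+d<c = subst (_≤ c) (ℕ.+-suc t d) t+d≤c

    -- Induction inwards from the chord joining 0 and c. The points q and q + 1 = μ x both close,
    -- and by `next` the chord at q opens at x + 1 or before x; but the points before x already have
    -- their partners beyond q.
    I-aux : ∀ x → t + x ≤ c → ∀ {y} → y ≤ x → y + μ y ≡ c
    I-aux zero _ z≤n = refl
    I-aux (suc x) t+x≤c {y} y≤ with ℕ.m≤n⇒m<n∨m≡n y≤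
    ... | inj₁ (s≤s y≤x) = I-aux x (ℕ.≤-trans (ℕ.+-monoʳ-≤ t (ℕ.n≤1+n x)) t+x≤c) y≤x
    ... | inj₂ refl = result
      where
      IH : ∀ {y} → y ≤ x → y + μ y ≡ c
      IH = I-aux x (ℕ.≤-trans (ℕ.+-monoʳ-≤ t (ℕ.n≤1+n x)) t+x≤c)
      q = c ∸ suc x
      q+ : suc x + q ≡ c
      q+ = ℕ.m+[n∸m]≡n (ℕ.≤-trans (ℕ.m≤n+m (suc x) t) t+x≤c)
      t≤q : t ≤ q
      t≤q = lia 4 (λ t x q c → t :+ :suc x :≤ c ⇒ :suc x :+ q :≡ c ⇒ t :≤ q) t x q c t+x≤c q+
      q<c : q < c
      q<c = lia 3 (λ x q c → :suc x :+ q :≡ c ⇒ q :< c) x q c q+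
      q<N = ℕ.<-trans q<c c<N
      q-closer : Closer q
      q-closer = subst Closer (ℕ.m+[n∸m]≡n t≤q) (closers (q ∸ t) (subst (_≤ c) (sym (ℕ.m+[n∸m]≡n t≤q)) (ℕ.<⇒≤ q<c)))
      o = μ q
      o>0 : 0 < o
      o>0 = ℕ.n≢0⇒n>0 λ o≡0 → ℕ.<⇒≢ q<c (sym (partner q<N o≡0))
      sq<N : suc q < N
      sq<N = ℕ.≤-<-trans q<c c<N
      μsq : μ (suc q) ≡ x
      μsq = partner (ℕ.<-trans (lia 4 (λ t x q c → t :≤ q ⇒ # 0 :< t ⇒ :suc x :+ q :≡ c ⇒ x :< c) t x q c t≤q 0<t q+) c<N)
              (lia 4 (λ x y q c → x :+ y :≡ c ⇒ :suc x :+ q :≡ c ⇒ y :≡ :suc q) x (μ x) q c (IH ℕ.≤-refl) q+)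
      result : suc x + μ (suc x) ≡ c
      result = case proj₂ (next o>0 (ℕ.<-trans q-closer q<N) q-closer (involutive q<N) sq<N) of λ where
          (inj₁ e) → trans (cong (suc x +_) (trans (cong μ (trans (cong suc (sym μsq)) e)) (involutive q<N))) q+
          (inj₂ (o<e , _)) → let o<x = subst (o <_) μsq o<e in ⊥-elim
              (lia 5 (λ o x q c m → o :< x ⇒ :suc x :+ q :≡ c ⇒ o :+ m :≡ c ⇒ m :≡ q ⇒ :⊥)
                o x q c (μ o) o<x q+ (IH (ℕ.<⇒≤ o<x)) (involutive q<N))

    a : ℕ
    a = c ∸ t

    t+a : t + a ≡ c
    t+a = ℕ.m+[n∸m]≡n t≤c

    t+a<N : t + a < N
    t+a<N = subst (_< N) (sym t+a) c<N

    I-sum : ∀ {r} → r ≤ a → r + μ r ≡ t + a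
    I-sum r≤a = trans (I-aux a (ℕ.≤-reflexive t+a) r≤a) (sym t+a)

    a<N : a < N
    a<N = ℕ.≤-<-trans (ℕ.m≤n+m a t) t+a<N

    μa : μ a ≡ t
    μa = lia 3 (λ a t s → a :+ s :≡ t :+ a ⇒ s :≡ t) a t (μ a) (I-sum ℕ.≤-refl)

    μt : μ t ≡ a
    μt = partner a<N μa

    -- The points a and t are partners, so `reduced` forbids them to be neighbours. The opening
    -- point a + 1 in between makes B nonempty.
    a<t : suc a < t
    a<t = ℕ.≤∧≢⇒< (subst (_< t) μt t-closer) λ sa≡t →
      reduced a<N (trans (rotated-suc N μ (subst (_< N) (sym sa≡t) t<N)) (trans (cong μ sa≡t) μt))

    I′-sum : ∀ {r} → t ≤ r → r ≤ t + a → r + μ r ≡ t + a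
    I′-sum {r} t≤r r≤ = trans (cong (r +_) (partner x<N μx)) (trans (ℕ.+-comm r x) x+r)
      where
      x = t + a ∸ r
      x+r : x + r ≡ t + a
      x+r = ℕ.m∸n+n≡m r≤
      x≤a : x ≤ a
      x≤a = lia 4 (λ x r t a → x :+ r :≡ t :+ a ⇒ t :≤ r ⇒ x :≤ a) x r t a x+r t≤r
      x<N = ℕ.≤-<-trans x≤a a<N
      μx : μ x ≡ r
      μx = ℕ.+-cancelˡ-≡ x _ _ (trans (I-sum x≤a) (sym x+r))

    w : ℕ
    w = suc (t + a)

    -- The closing points t, ..., t + a are all taken by I.
    a<opener-partner : ∀ {e} → a < e → e < N → Opener e → t + a < μ e
    a<opener-partner {e} a<e e<N o = ℕ.≰⇒> λ μe≤ →
      lia 5 (λ t a e m n → m :+ n :≡ t :+ a ⇒ n :≡ e ⇒ a :< e ⇒ t :≤ m ⇒ :⊥) t a e (μ e) (μ (μ e))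
        (I′-sum t≤μe μe≤) (involutive e<N) a<e t≤μe
      where t≤μe = t≤-closer (opener-partner e<N o)

    sa<N : suc a < N
    sa<N = ℕ.<-trans a<t t<N

    w≤ : w ≤ μ (suc a)
    w≤ = a<opener-partner ℕ.≤-refl sa<N (openers a<t)

    -- The points w, ..., h - 1 will be the opening points of J, and h the first closing point of B.
    module SecondCloser (h : ℕ) (w≤h : w ≤ h) (h≤ : h ≤ μ (suc a)) (h-closer : Closer h)
                        (openers₂ : ∀ {i} → w ≤ i → i < h → Opener i) where

      h<N : h < N
      h<N = ℕ.≤-<-trans h≤ (bounded sa<N)

      -- `closers-step` stops only at c = t + a, which lies before h.
      closers₂-aux : ∀ d → h + d < N → Closer (h + d)
      closers₂-aux zero _ = subst Closer (sym (ℕ.+-identityʳ h)) h-closer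
      closers₂-aux (suc d) h+d<N = subst Closer (sym (ℕ.+-suc h d))
        (closers-step h+d<N′ (closers₂-aux d (ℕ.<-trans (ℕ.n<1+n _) h+d<N′))
          λ eq → lia 5 (λ h d c t a → h :+ d :≡ c ⇒ t :+ a :≡ c ⇒ :suc (t :+ a) :≤ h ⇒ :⊥) h d c t a eq t+a w≤h)
        where h+d<N′ = subst (_< N) (ℕ.+-suc h d) h+d<N

      closers₂ : ∀ {r} → h ≤ r → r < N → Closer r
      closers₂ {r} h≤r r<N = subst Closer (ℕ.m+[n∸m]≡n h≤r)
        (closers₂-aux (r ∸ h) (subst (_< N) (sym (ℕ.m+[n∸m]≡n h≤r)) r<N))

      opener-cases : ∀ {r} → r < N → Opener r → r < t ⊎ (w ≤ r × r < h)
      opener-cases {r} r<N o with r <? t | r ≤? t + a | r <? h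
      ... | yes p | _ | _ = inj₁ p
      ... | no p | yes q | _ = ⊥-elim (lia 4 (λ r s t a → r :< s ⇒ t :≤ r ⇒ a :< t ⇒ r :+ s :≡ t :+ a ⇒ :⊥) r (μ r) t a o (ℕ.≮⇒≥ p) (ℕ.<-trans (ℕ.n<1+n a) a<t) (I′-sum (ℕ.≮⇒≥ p) q))
      ... | no p | no q | yes u = inj₂ (ℕ.≰⇒> q , u)
      ... | no p | no q | no u = ⊥-elim (¬both o (closers₂ (ℕ.≮⇒≥ u) r<N))

      a<opener-partner₂ : ∀ {e} → a < e → e < N → Opener e → h ≤ μ e
      a<opener-partner₂ {e} a<e e<N o = ℕ.≮⇒≥ λ μe<h →
        ¬both (openers₂ (a<opener-partner a<e e<N o) μe<h) (opener-partner e<N o)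

      next₂ : ∀ {p} → h ≤ p → suc p < N → μ (suc p) ≤ p ×
              (suc (μ (suc p)) ≡ μ p ⊎ (μ p < μ (suc p) × Closer (suc (μ (suc p)))))
      next₂ {p} h≤p p<N = next (ℕ.n≢0⇒n>0 λ μp≡0 → p≢c (sym (partner p<N′ μp≡0)))
                            (ℕ.<-trans cl p<N′) cl (involutive p<N′) p<N
        where
        p<N′ = ℕ.<-trans (ℕ.n<1+n p) p<N
        cl = closers₂ h≤p p<N′
        p≢c : p ≢ c
        p≢c eq = lia 5 (λ h p c t a → p :≡ c ⇒ t :+ a :≡ c ⇒ :suc (t :+ a) :≤ h ⇒ h :≤ p ⇒ :⊥) h p c t a eq t+a w≤h h≤p

      b : ℕ
      b = μ h

      b<N : b < N
      b<N = ℕ.<-trans h-closer h<N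

      μb : μ b ≡ h
      μb = involutive h<N

      -- From one closing point to the following one `next` moves the opening end up, or down by
      -- one; since no chord opens between t and w, it can never leave J. For `b<t` this is absurd
      -- at the partner of a + 1.
      above-w : w ≤ b → ∀ d → h + d < N → w ≤ μ (h + d)
      above-w w≤b zero _ = subst (λ x → w ≤ μ x) (sym (ℕ.+-identityʳ h)) w≤b
      above-w w≤b (suc d) h+d<N = subst (λ x → w ≤ μ x) (sym (ℕ.+-suc h d)) (step (proj₂ (next₂ (ℕ.m≤m+n h d) h+d<N′)))
        where
        h+d<N′ = subst (_< N) (ℕ.+-suc h d) h+d<N
        IH = above-w w≤b d (ℕ.<-trans (ℕ.n<1+n _) h+d<N′)
        e = μ (suc (h + d))
        e-opener : Opener e
        e-opener = closer-partner h+d<N′ (closers₂ (ℕ.≤-trans (ℕ.m≤m+n h d) (ℕ.n≤1+n _)) h+d<N′)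
        step : suc e ≡ μ (h + d) ⊎ (μ (h + d) < e × Closer (suc e)) → w ≤ e
        step (inj₂ (lt , _)) = ℕ.≤-trans IH (ℕ.<⇒≤ lt)
        step (inj₁ eq) = case opener-cases (bounded h+d<N′) e-opener of λ where
          (inj₂ (p , _)) → p
          (inj₁ p) → ⊥-elim (lia 4 (λ t a e m → :suc (t :+ a) :≤ m ⇒ :suc e :≡ m ⇒ e :< t ⇒ :⊥) t a e (μ (h + d)) IH eq p)

      b<t : b < t
      b<t = case opener-cases b<N (closer-partner h<N h-closer) of λ where
          (inj₁ p) → p
          (inj₂ (w≤b , _)) → ⊥-elim (lia 3 (λ t a m → :suc (t :+ a) :≤ m ⇒ m :≡ :suc a ⇒ # 0 :< t ⇒ :⊥) t a (μ M)
            (subst (λ x → w ≤ μ x) h+d (above-w w≤b (M ∸ h) (subst (_< N) (sym h+d) (bounded sa<N))))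
            (involutive sa<N) 0<t)
        where
        M = μ (suc a)
        h+d : h + (M ∸ h) ≡ M
        h+d = ℕ.m+[n∸m]≡n h≤

      a<b : a < b
      a<b = ℕ.≰⇒> λ b≤a → lia 5 (λ t a b h m → b :+ m :≡ t :+ a ⇒ m :≡ h ⇒ :suc (t :+ a) :≤ h ⇒ :⊥) t a b h (μ b)
              (I-sum b≤a) μb w≤h

      -- Neighbouring opening points carry neighbouring chords. As h < μ e, the point q before `μ e`
      -- closes as well, and by `next` at q either its chord opens at e + 1 or e + 1 closes a chord;
      -- the latter is excluded. The sum e + μ e thus changes at most where μ e = h.
      descend : ∀ d {e} → a < e → (∀ {i} → e ≤ i → i < e + d → i < N × Opener i × Opener (suc i) × μ i ≢ h) →
                e + μ e ≡ (e + d) + μ (e + d)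
      descend zero {e} _ _ = cong (λ x → x + μ x) (sym (ℕ.+-identityʳ e))
      descend (suc d) {e} a<e H = trans one (trans (descend d (ℕ.<-trans a<e (ℕ.n<1+n e))
            λ {i} e≤i i<e → H (ℕ.<⇒≤ e≤i) (subst (i <_) (sym (ℕ.+-suc e d)) i<e))
          (cong (λ x → x + μ x) (sym (ℕ.+-suc e d))))
        where
        He = H ℕ.≤-refl (ℕ.m<m+n e z<s)
        e<N = proj₁ He
        h<μe : h < μ e
        h<μe = ℕ.≤∧≢⇒< (a<opener-partner₂ a<e e<N (proj₁ (proj₂ He))) (λ eq → proj₂ (proj₂ (proj₂ He)) (sym eq))
        q = pred (μ e)
        sq : suc q ≡ μ e
        sq = ℕ.suc-pred (μ e) {{>-nonZero (ℕ.≤-<-trans z≤n h<μe)}}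
        sq<N : suc q < N
        sq<N = subst (_< N) (sym sq) (bounded e<N)
        q<N = ℕ.<-trans (ℕ.n<1+n q) sq<N
        μsq : μ (suc q) ≡ e
        μsq = trans (cong μ sq) (involutive e<N)
        one : e + μ e ≡ suc e + μ (suc e)
        one = case proj₂ (next₂ {q} (s≤s⁻¹ (subst (suc h ≤_) (sym sq) h<μe)) sq<N) of λ where
            (inj₁ eq) → lia 4 (λ e m q n → :suc q :≡ m ⇒ n :≡ q ⇒ e :+ m :≡ :suc e :+ n) e (μ e) q (μ (suc e)) sq
                (trans (cong μ (trans (cong suc (sym μsq)) eq)) (involutive q<N))
            (inj₂ (_ , cl)) → ⊥-elim (¬both (proj₁ (proj₂ (proj₂ He))) (subst (λ x → Closer (suc x)) μsq cl))

      B-sum : ∀ {r} → a < r → r ≤ b → r + μ r ≡ h + b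
      B-sum {r} a<r r≤b = trans (descend (b ∸ r) a<r H)
          (trans (cong (λ x → x + μ x) r+d) (trans (cong (b +_) μb) (ℕ.+-comm b h)))
        where
        r+d : r + (b ∸ r) ≡ b
        r+d = ℕ.m+[n∸m]≡n r≤b
        H : ∀ {i} → r ≤ i → i < r + (b ∸ r) → i < N × Opener i × Opener (suc i) × μ i ≢ h
        H {i} r≤i i<′ = i<N , openers (ℕ.<-trans i<b b<t) , openers (ℕ.≤-<-trans i<b b<t) ,
            λ μi≡h → ℕ.<⇒≢ i<b (sym (partner i<N μi≡h))
          where
          i<b = subst (i <_) r+d i<′
          i<N = ℕ.<-trans i<b b<N

      C-step : ∀ {r s} → b < r → r ≤ s → s < t → r + μ r ≡ s + μ s
      C-step {r} {s} b<r r≤s s<t = trans (descend (s ∸ r) (ℕ.<-trans a<b b<r) H) (cong (λ x → x + μ x) r+d)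
        where
        r+d : r + (s ∸ r) ≡ s
        r+d = ℕ.m+[n∸m]≡n r≤s
        H : ∀ {i} → r ≤ i → i < r + (s ∸ r) → i < N × Opener i × Opener (suc i) × μ i ≢ h
        H {i} r≤i i<′ = i<N , openers (ℕ.<-trans i<s s<t) , openers (ℕ.≤-<-trans i<s s<t) ,
            λ μi≡h → ℕ.<⇒≢ (ℕ.<-≤-trans b<r r≤i) (partner i<N μi≡h)
          where
          i<s = subst (i <_) r+d i<′
          i<N = ℕ.<-trans (ℕ.<-trans i<s s<t) t<N

      J-step : ∀ {r s} → w ≤ r → r ≤ s → s < h → r + μ r ≡ s + μ s
      J-step {r} {s} w≤r r≤s s<h = trans (descend (s ∸ r) (ℕ.<-≤-trans (s≤s (ℕ.m≤n+m a t)) w≤r) H) (cong (λ x → x + μ x) r+d)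
        where
        r+d : r + (s ∸ r) ≡ s
        r+d = ℕ.m+[n∸m]≡n r≤s
        H : ∀ {i} → r ≤ i → i < r + (s ∸ r) → i < N × Opener i × Opener (suc i) × μ i ≢ h
        H {i} r≤i i<′ = i<N , openers₂ w≤i (ℕ.<-trans i<s s<h) , openers₂ (ℕ.≤-trans w≤i (ℕ.n≤1+n i)) (ℕ.≤-<-trans i<s s<h) ,
            λ μi≡h → lia 4 (λ b t a i → b :≡ i ⇒ b :< t ⇒ :suc (t :+ a) :≤ i ⇒ :⊥) b t a i (partner i<N μi≡h) b<t w≤i
          where
          w≤i = ℕ.≤-trans w≤r r≤i
          i<s = subst (i <_) r+d i<′
          i<N = ℕ.<-trans (ℕ.<-trans i<s s<h) h<N

      ending : ∀ {e} → e < N → Opener e → Closer (suc e) → suc e ≡ t ⊎ (suc e ≡ h × w ≤ e)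
      ending {e} e<N o cl with opener-cases e<N o
      ... | inj₁ e<t = inj₁ (ℕ.≤-antisym e<t (t≤-closer cl))
      ... | inj₂ (w≤e , e<h) = inj₂ (ℕ.≤-antisym e<h (ℕ.≮⇒≥ λ se<h →
              ¬both (openers₂ (ℕ.≤-trans w≤e (ℕ.n≤1+n e)) se<h) cl) , w≤e)

      -- The chord closing right after that of l is its outer neighbour, or it opens at the end of
      -- one of the two intervals of opening points.
      after : ∀ {l} → a < l → l < N → Opener l → suc (μ l) < N →
              ∃[ e ] μ e ≡ suc (μ l) × (suc e ≡ l ⊎ (l < e × (suc e ≡ t ⊎ (suc e ≡ h × w ≤ e))))
      after {l} a<l l<N o M<N = μ (suc (μ l)) , involutive M<N , (case proj₂ next′ of λ where
          (inj₁ eq) → inj₁ (trans eq (involutive l<N))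
          (inj₂ (lt , cl)) → inj₂ (subst (_< e) (involutive l<N) lt , ending (bounded M<N) e-opener cl))
        where
        e = μ (suc (μ l))
        h≤M = a<opener-partner₂ a<l l<N o
        next′ = next₂ h≤M M<N
        e-opener = closer-partner M<N (closers₂ (ℕ.≤-trans h≤M (ℕ.n≤1+n _)) M<N)

      reflect : ∀ {r x s} → x < N → x + r ≡ s → x + μ x ≡ s → μ r ≡ x
      reflect {x = x} x<N e e′ = partner x<N (ℕ.+-cancelˡ-≡ x _ _ (trans e′ (sym e)))

      -- A point after `μ w` would have the partner w - 1, t - 1 or h - 1. The first closes a chord
      -- of I, the second lies before w, and the chord of h - 1 closes before `μ w` by `J-step`.
      J-end : w < h → suc (μ w) ≡ N
      J-end w<h = case ℕ.m≤n⇒m<n∨m≡n (bounded w<N) of λ where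
          (inj₂ eq) → eq
          (inj₁ M<N) → ⊥-elim (case after (s≤s (ℕ.m≤n+m a t)) w<N (openers₂ ℕ.≤-refl w<h) M<N of λ where
            (e , μe , inj₁ eq) → lia 5 (λ t a e m n → :suc e :≡ :suc (t :+ a) ⇒ m :≡ :suc n ⇒ e :+ m :≡ t :+ a ⇒ :⊥)
              t a e (μ e) (μ w) eq μe (I′-sum (subst (t ≤_) (sym (ℕ.suc-injective eq)) (ℕ.m≤m+n t a)) (ℕ.≤-reflexive (ℕ.suc-injective eq)))
            (e , μe , inj₂ (w<e , inj₁ eq)) → lia 3 (λ t a e → :suc e :≡ t ⇒ :suc (t :+ a) :< e ⇒ :⊥) t a e eq w<e
            (e , μe , inj₂ (w<e , inj₂ (eq , w≤e))) → lia 4 (λ w e m n → w :+ n :≡ e :+ m ⇒ m :≡ :suc n ⇒ w :< e ⇒ :⊥)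
              w e (μ e) (μ w) (J-step ℕ.≤-refl w≤e (ℕ.≤-reflexive eq)) μe w<e)
        where w<N = ℕ.<-trans w<h h<N

      J-sum : ∀ {r} → w ≤ r → r < h → r + μ r ≡ 2 * k + t + a
      J-sum {r} w≤r r<h = lia 6 (λ k t a m r s → :suc m :≡ 2 :* k ⇒ :suc (t :+ a) :+ m :≡ r :+ s ⇒ r :+ s :≡ 2 :* k :+ t :+ a)
        k t a (μ w) r (μ r) (J-end (ℕ.≤-<-trans w≤r r<h)) (J-step ℕ.≤-refl w≤r r<h)

      -- For nonempty J the hypothesis is r ≥ μ (h - 1), written without subtraction.
      J-cover : ∀ {r} → r < N → 2 * k + w ≤ r + h → r + μ r ≡ 2 * k + t + a × w ≤ μ r
      J-cover {r} r<N le = trans (cong (r +_) μr) (trans (ℕ.+-comm r x) x+r) , subst (w ≤_) (sym μr) w≤x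
        where
        x = 2 * k + t + a ∸ r
        x+r : x + r ≡ 2 * k + t + a
        x+r = ℕ.m∸n+n≡m (lia 4 (λ k t a r → r :< 2 :* k ⇒ r :≤ 2 :* k :+ t :+ a) k t a r r<N)
        w≤x : w ≤ x
        w≤x = lia 5 (λ k t a r x → x :+ r :≡ 2 :* k :+ t :+ a ⇒ r :< 2 :* k ⇒ :suc (t :+ a) :≤ x) k t a r x x+r r<N
        x<h : x < h
        x<h = lia 6 (λ k t a r x h → x :+ r :≡ 2 :* k :+ t :+ a ⇒ 2 :* k :+ :suc (t :+ a) :≤ r :+ h ⇒ x :< h) k t a r x h x+r le
        μr : μ r ≡ x
        μr = reflect (ℕ.<-trans x<h h<N) x+r (J-sum w≤x x<h)

      M : ℕ
      M = μ (suc a)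

      M-sum : suc a + M ≡ h + b
      M-sum = B-sum ℕ.≤-refl a<b

      B-cover : ∀ {r} → h ≤ r → r ≤ M → r + μ r ≡ h + b × a < μ r × μ r ≤ b
      B-cover {r} h≤r r≤M = trans (cong (r +_) μr) (trans (ℕ.+-comm r x) x+r) ,
          subst (a <_) (sym μr) a<x , subst (_≤ b) (sym μr) x≤b
        where
        x = h + b ∸ r
        x+r : x + r ≡ h + b
        x+r = ℕ.m∸n+n≡m (lia 5 (λ h b a m r → :suc a :+ m :≡ h :+ b ⇒ r :≤ m ⇒ r :≤ h :+ b) h b a M r M-sum r≤M)
        a<x : a < x
        a<x = lia 6 (λ h b a m r x → :suc a :+ m :≡ h :+ b ⇒ r :≤ m ⇒ x :+ r :≡ h :+ b ⇒ a :< x) h b a M r x M-sum r≤M x+r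
        x≤b : x ≤ b
        x≤b = lia 4 (λ h b r x → x :+ r :≡ h :+ b ⇒ h :≤ r ⇒ x :≤ b) h b r x x+r h≤r
        μr : μ r ≡ x
        μr = reflect (ℕ.≤-<-trans x≤b b<N) x+r (B-sum a<x x≤b)

      t≤h : t ≤ h
      t≤h = lia 3 (λ t a h → :suc (t :+ a) :≤ h ⇒ t :≤ h) t a h w≤h

      h≤M : h ≤ M
      h≤M = h≤

      -- By `after`, the partner of M + 1 is a, t - 1 or h - 1. But a is joined to t ≤ M, and if the
      -- partner were h - 1, all points after M would close chords of J, leaving none for v.
      C-start : ∀ {v} → suc v ≡ t → b < v → μ v ≡ suc M
      C-start {v} sv b<v = case after ℕ.≤-refl sa<N (openers a<t) sM<N of λ where
          (e , μe , inj₁ eq) → ⊥-elim (lia 5 (λ t h m n a → m :≡ :suc n ⇒ m :≡ t ⇒ t :≤ h ⇒ h :≤ n ⇒ :⊥) t h (μ e) M a μe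
            (trans (cong μ (ℕ.suc-injective eq)) μa) t≤h h≤M)
          (e , μe , inj₂ (_ , inj₁ eq)) → trans (cong μ (ℕ.suc-injective (trans sv (sym eq)))) μe
          (e , μe , inj₂ (_ , inj₂ (eq , w≤e))) → ⊥-elim (ℕ.<⇒≱ v<t
            (ℕ.≤-trans (ℕ.≤-trans (ℕ.m≤m+n t a) (ℕ.n≤1+n _)) (subst (w ≤_) (involutive v<N)
              (proj₂ (J-cover (bounded v<N) (lia 8 (λ k t a e m n h q → e :+ m :≡ 2 :* k :+ t :+ a ⇒ m :≡ :suc n ⇒ :suc e :≡ h ⇒ n :< q ⇒
                2 :* k :+ :suc (t :+ a) :≤ q :+ h) k t a e (μ e) M h (μ v) (J-sum w≤e (ℕ.≤-reflexive eq)) μe eq M<μv))))))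
        where
        v<t : v < t
        v<t = ℕ.≤-reflexive sv
        v<N = ℕ.<-trans v<t t<N
        h≤μv = a<opener-partner₂ (ℕ.<-trans a<b b<v) v<N (openers v<t)
        M<μv : M < μ v
        M<μv = ℕ.≰⇒> λ μv≤M → ℕ.<⇒≱ b<v (subst (_≤ b) (involutive v<N) (proj₂ (proj₂ (B-cover h≤μv μv≤M))))
        sM<N : suc M < N
        sM<N = ℕ.≤-<-trans M<μv (bounded v<N)

      C-sum : ∀ {r} → b < r → r < t → r + μ r ≡ t + M
      C-sum {r} b<r r<t = trans (C-step b<r (s≤s⁻¹ (subst (suc r ≤_) (sym sv) r<t)) (ℕ.≤-reflexive sv))
          (trans (cong (v +_) (C-start sv b<v)) (trans (ℕ.+-suc v M) (cong (_+ M) sv)))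
        where
        v = pred t
        sv : suc v ≡ t
        sv = ℕ.suc-pred t {{>-nonZero 0<t}}
        b<v : b < v
        b<v = lia 4 (λ b r t v → b :< r ⇒ r :< t ⇒ :suc v :≡ t ⇒ b :< v) b r t v b<r r<t sv

      C-cover : ∀ {r} → suc b < t → M < r → r ≤ μ (suc b) → r + μ r ≡ t + M × b < μ r × μ r < t
      C-cover {r} b<t′ M<r r≤ = trans (cong (r +_) μr) (trans (ℕ.+-comm r x) x+r) ,
          subst (b <_) (sym μr) b<x , subst (_< t) (sym μr) x<t
        where
        m-sum = C-sum ℕ.≤-refl b<t′
        x = t + M ∸ r
        x+r : x + r ≡ t + M
        x+r = ℕ.m∸n+n≡m (lia 5 (λ t m b n r → :suc b :+ n :≡ t :+ m ⇒ r :≤ n ⇒ r :≤ t :+ m) t M b (μ (suc b)) r m-sum r≤)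
        b<x : b < x
        b<x = lia 6 (λ t m b n r x → :suc b :+ n :≡ t :+ m ⇒ r :≤ n ⇒ x :+ r :≡ t :+ m ⇒ b :< x) t M b (μ (suc b)) r x m-sum r≤ x+r
        x<t : x < t
        x<t = lia 4 (λ t m r x → x :+ r :≡ t :+ m ⇒ m :< r ⇒ x :< t) t M r x x+r M<r
        μr : μ r ≡ x
        μr = reflect (ℕ.<-trans x<t t<N) x+r (C-sum b<x x<t)

      -- The last closing point before those of J belongs to C, or to B when C is empty.
      record LastBeforeJ : Set where
        field
          l      : ℕ
          a<l    : a < l
          l<t    : l < t
          l-sum  : suc (μ l) + suc a ≡ h + t
          cover  : ∀ {r} → h ≤ r → r ≤ μ l → μ r < t
          below  : ∀ {e} → μ e ≡ suc (μ l) → suc e ≢ l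
          above  : ∀ {e} → μ e ≡ suc (μ l) → l < e → suc e ≢ t

      -- The outermost chord of a class closes last, so l is the first point of C, or of B when t =
      -- b + 1.
      lastBeforeJ : LastBeforeJ
      lastBeforeJ = case ℕ.m≤n⇒m<n∨m≡n b<t of λ where
        (inj₁ b<t′) → record
          { l = suc b ; a<l = ℕ.<-trans a<b (ℕ.n<1+n b) ; l<t = b<t′
          ; l-sum = lia 6 (λ t m b n a h → :suc b :+ n :≡ t :+ m ⇒ :suc a :+ m :≡ h :+ b ⇒ :suc n :+ :suc a :≡ h :+ t)
              t M b (μ (suc b)) a h (C-sum ℕ.≤-refl b<t′) M-sum
          ; cover = λ {r} h≤r r≤ → case r ≤? M of λ where
              (yes r≤M) → ℕ.≤-<-trans (proj₂ (proj₂ (B-cover h≤r r≤M))) b<t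
              (no r≰M) → proj₂ (proj₂ (C-cover b<t′ (ℕ.≰⇒> r≰M) r≤))
          ; below = λ {e} μe eq → lia 3 (λ m n h → m :≡ :suc n ⇒ m :≡ h ⇒ h :≤ n ⇒ :⊥) (μ e) (μ (suc b)) h μe
              (trans (cong μ (ℕ.suc-injective eq)) μb)
              (a<opener-partner₂ (ℕ.<-trans a<b (ℕ.n<1+n b)) (ℕ.<-trans b<t′ t<N) (openers b<t′))
          ; above = λ {e} μe l<e eq → lia 4 (λ b e m n → :suc b :+ n :≡ e :+ m ⇒ m :≡ :suc n ⇒ :suc b :< e ⇒ :⊥) b e (μ e) (μ (suc b))
              (C-step ℕ.≤-refl (ℕ.<⇒≤ l<e) (ℕ.≤-reflexive eq)) μe l<e }
        (inj₂ sb≡t) → record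
          { l = suc a ; a<l = ℕ.≤-refl ; l<t = a<t
          ; l-sum = lia 5 (λ t m b a h → :suc b :≡ t ⇒ :suc a :+ m :≡ h :+ b ⇒ :suc m :+ :suc a :≡ h :+ t)
              t M b a h sb≡t M-sum
          ; cover = λ h≤r r≤ → ℕ.≤-<-trans (proj₂ (proj₂ (B-cover h≤r r≤))) b<t
          ; below = λ {e} μe eq → lia 4 (λ m n t h → m :≡ :suc n ⇒ m :≡ t ⇒ t :≤ h ⇒ h :≤ n ⇒ :⊥) (μ e) M t h μe
              (trans (cong μ (ℕ.suc-injective eq)) μa) t≤h h≤M
          ; above = λ {e} μe l<e eq → lia 3 (λ m n h → m :≡ :suc n ⇒ m :≡ h ⇒ h :≤ n ⇒ :⊥) (μ e) M h μe
              (trans (cong μ (ℕ.suc-injective (trans eq (sym sb≡t)))) μb) h≤M }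

      -- After `μ l` as many points remain as J has opening points, namely h - w.
      J-start : (L : LastBeforeJ) → suc (μ (LastBeforeJ.l L)) + h ≡ 2 * k + w
      J-start L = case ℕ.m≤n⇒m<n∨m≡n (bounded l<N) of λ where
          (inj₁ m<N) → case after a<l l<N (openers l<t) m<N of λ where
            (e , μe , inj₁ eq) → ⊥-elim (below μe eq)
            (e , μe , inj₂ (l<e , inj₁ eq)) → ⊥-elim (above μe l<e eq)
            (e , μe , inj₂ (l<e , inj₂ (eq , w≤e))) →
              lia 7 (λ k t a e m n h → e :+ m :≡ 2 :* k :+ t :+ a ⇒ m :≡ :suc n ⇒ :suc e :≡ h ⇒ :suc n :+ h :≡ 2 :* k :+ :suc (t :+ a))
                k t a e (μ e) (μ l) h (J-sum w≤e (ℕ.≤-reflexive eq)) μe eq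
          (inj₂ m≡N) → cong₂ _+_ m≡N (case ℕ.m≤n⇒m<n∨m≡n w≤h of λ where
            (inj₂ w≡h) → sym w≡h
            (inj₁ w<h) → ⊥-elim (J-empty m≡N w<h))
        where
        open LastBeforeJ L
        l<N = ℕ.<-trans l<t t<N
        J-empty : suc (μ l) ≡ N → w < h → ⊥
        J-empty m≡N w<h = lia 3 (λ w t a → :suc (t :+ a) :< t ⇒ :⊥) w t a (subst (_< t) (involutive w<N)
            (cover (a<opener-partner₂ (s≤s (ℕ.m≤n+m a t)) w<N (openers₂ ℕ.≤-refl w<h))
              (s≤s⁻¹ (subst (μ w <_) (sym m≡N) (bounded w<N)))))
          where w<N = ℕ.<-trans w<h h<N

      -- Half of the points open chords, that is t + (h - w) = k. The two equations for `μ l + 1`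
      -- give this without a count.
      h-value : LastBeforeJ → h ≡ suc (k + a)
      h-value L = lia 5 (λ k t a m h → :suc m :+ :suc a :≡ h :+ t ⇒ :suc m :+ h :≡ 2 :* k :+ :suc (t :+ a) ⇒ h :≡ :suc (k :+ a))
             k t a (μ l) h l-sum (J-start L)
        where open LastBeforeJ L

      h≡ : h ≡ suc (k + a)
      h≡ = h-value lastBeforeJ

      M≡ : M ≡ k + b
      M≡ = lia 5 (λ k a b m h → :suc a :+ m :≡ h :+ b ⇒ h :≡ :suc (k :+ a) ⇒ m :≡ k :+ b) k a b M h M-sum h≡

      t≤k : t ≤ k
      t≤k = lia 4 (λ k t a h → :suc (t :+ a) :≤ h ⇒ h :≡ :suc (k :+ a) ⇒ t :≤ k) k t a h w≤h h≡

      private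
        B-sum≡ : h + b ≡ suc (k + a + b)
        B-sum≡ = cong (_+ b) h≡
        C-sum≡ : t + M ≡ k + b + t
        C-sum≡ = trans (cong (t +_) M≡) (ℕ.+-comm t (k + b))

      shape : Shape k a b t μ
      shape = record
        { onI = I-sum
        ; onB = λ p q → trans (B-sum p q) B-sum≡
        ; onC = λ p q → trans (C-sum p q) C-sum≡
        ; onI′ = I′-sum
        ; onJ = λ {r} p q → J-sum p (subst (r <_) (sym h≡) (s≤s q))
        ; onB′ = λ {r} p q → trans (proj₁ (B-cover (subst (_≤ r) (sym h≡) p) (subst (r ≤_) (sym M≡) q))) B-sum≡
        ; onC′ = λ {r} p q →
            let b<t′ = lia 4 (λ k b t r → k :+ b :< r ⇒ r :< k :+ t ⇒ :suc b :< t) k b t r p q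
            in trans (proj₁ (C-cover b<t′ (subst (_< r) (sym M≡) p)
                 (lia 6 (λ k b t r m n → r :< k :+ t ⇒ :suc b :+ n :≡ t :+ m ⇒ m :≡ k :+ b ⇒ r :≤ n)
                   k b t r M (μ (suc b)) q (C-sum ℕ.≤-refl b<t′) M≡))) C-sum≡
        ; onJ′ = λ {r} p q → proj₁ (J-cover q
            (lia 5 (λ k t a r h → k :+ t :≤ r ⇒ h :≡ :suc (k :+ a) ⇒ 2 :* k :+ :suc (t :+ a) :≤ r :+ h) k t a r h p h≡))
        }

      parameters : ∃[ a ] ∃[ b ] ∃[ t ] a < b × b < t × t ≤ k × Shape k a b t μ
      parameters = a , b , t , a<b , b<t , t≤k , shape

    parameters : ∃[ a ] ∃[ b ] ∃[ t ] a < b × b < t × t ≤ k × Shape k a b t μ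
    parameters =
      let (h , w≤h , h≤ , h-closer , h-least) = leastFrom (λ i → μ i <? i) w (μ (suc a) ∸ w)
            (subst Closer (sym w+d) (opener-partner sa<N (openers a<t)))
          h≤′ = subst (h ≤_) w+d h≤
      in SecondCloser.parameters h w≤h h≤′ h-closer
           (λ {i} w≤i i<h → ¬closer⇒opener {i} (ℕ.<-trans i<h (ℕ.≤-<-trans h≤′ (bounded sa<N))) (h-least w≤i i<h))
      where
      w+d : w + (μ (suc a) ∸ w) ≡ μ (suc a)
      w+d = ℕ.m+[n∸m]≡n w≤

  parameters : ∃[ a ] ∃[ b ] ∃[ t ] a < b × b < t × t ≤ k × Shape k a b t μ
  parameters =
    let (t , _ , t≤ , t-closer , t-least) = leastFrom (λ i → μ i <? i) 0 (pred N) last-closer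
        t<N = ℕ.≤-<-trans t≤ (ℕ.≤-reflexive (ℕ.suc-pred N {{>-nonZero 0<N}}))
    in FirstCloser.parameters t t<N t-closer (λ {i} i<t → ¬closer⇒opener {i} (ℕ.<-trans i<t t<N) (t-least z≤n i<t))

-- Cardinalities, orbits and shifts

card-≤ : ∀ {A : Set} {xs ys : List A} → Unique xs → (∀ {x} → x ∈ xs → x ∈ ys) → length xs ≤ length ys
card-≤ {xs = []} _ _ = z≤n
card-≤ {xs = x ∷ xs} (x∉xs ∷ unique) sub with ∈-∃++ (sub (here refl))
... | us , vs , refl = subst (suc (length xs) ≤_) (sym length-us++x∷vs) (s≤s (card-≤ unique sub′))
  where
  length-us++x∷vs : length (us ++ x ∷ vs) ≡ suc (length (us ++ vs))
  length-us++x∷vs = trans (length-++ us) (trans (ℕ.+-suc (length us) (length vs)) (cong suc (sym (length-++ us))))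
  sub′ : ∀ {y} → y ∈ xs → y ∈ us ++ vs
  sub′ {y} y∈xs with ∈-++⁻ us (sub (there y∈xs))
  ... | inj₁ y∈us = ∈-++⁺ˡ y∈us
  ... | inj₂ (here refl) = ⊥-elim (All.lookup x∉xs y∈xs refl)
  ... | inj₂ (there y∈vs) = ∈-++⁺ʳ us y∈vs

card-≡ : ∀ {A : Set} {xs ys : List A} → Unique xs → Unique ys →
         (∀ {x} → x ∈ xs → x ∈ ys) → (∀ {x} → x ∈ ys → x ∈ xs) → length xs ≡ length ys
card-≡ u v p q = ℕ.≤-antisym (card-≤ u p) (card-≤ v q)

-- A missing element could be added to xs, giving a duplicate-free sublist of ys that is longer than
-- ys.
card-⊇ : ∀ {n} {xs ys : List (Fin n)} → Unique xs → (∀ {x} → x ∈ xs → x ∈ ys) → length ys ≤ length xs →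
         ∀ {y} → y ∈ ys → y ∈ xs
card-⊇ {xs = xs} unique sub le {y} y∈ys with member? _≟ᶠ_ y xs
... | yes y∈xs = y∈xs
... | no y∉xs = ⊥-elim (ℕ.<⇒≱ (card-≤ (All.tabulate (λ x∈xs → λ { refl → y∉xs x∈xs }) ∷ unique)
                  (λ { (here refl) → y∈ys ; (there p) → sub p })) le)

map-unique : ∀ {A B : Set} {f : A → B} {xs} → Unique xs →
             (∀ {x y} → x ∈ xs → y ∈ xs → f x ≡ f y → x ≡ y) → Unique (map f xs)
map-unique [] inj = []
map-unique {f = f} {x ∷ xs} (x∉xs ∷ unique) inj =
  All.tabulate (λ y∈ e → case ∈-map⁻ f y∈ of λ where
    (x′ , x′∈ , refl) → All.lookup x∉xs x′∈ (inj (here refl) (there x′∈) e)) ∷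
  map-unique unique (λ p q → inj (there p) (there q))

hasCard-unique : ∀ {A : Set} {P : A → Set} {m m′} → HasCard P m → HasCard P m′ → m ≡ m′
hasCard-unique (L , u , L⇔ , refl) (L′ , u′ , L′⇔ , refl) =
  card-≡ u u′ (λ {x} p → Equivalence.from (L′⇔ x) (Equivalence.to (L⇔ x) p))
              (λ {x} p → Equivalence.from (L⇔ x) (Equivalence.to (L′⇔ x) p))

fins : ∀ {n} → (Fin n → Bool) → List (Fin n)
fins p = filterᵇ p (allFin _)

fins-unique : ∀ {n} (p : Fin n → Bool) → Unique (fins p)
fins-unique p = Unique.filter⁺ (T? ∘ p) (Unique.allFin⁺ _)

∈-fins⁺ : ∀ {n} (p : Fin n → Bool) {x} → T (p x) → x ∈ fins p
∈-fins⁺ p {x} = ∈-filter⁺ (T? ∘ p) (∈-allFin x)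

∈-fins⁻ : ∀ {n} (p : Fin n → Bool) {x} → x ∈ fins p → T (p x)
∈-fins⁻ p x∈ = proj₂ (∈-filter⁻ (T? ∘ p) {xs = allFin _} x∈)

indicator : Bool → ℕ
indicator b = if b then 1 else 0

indicator-true : ∀ {b} → T b → indicator b ≡ 1
indicator-true {true} _ = refl

indicator-false : ∀ {b} → ¬ T b → indicator b ≡ 0
indicator-false {true} ¬t = ⊥-elim (¬t _)
indicator-false {false} _ = refl

length-filterᵇ-∷ : ∀ {A : Set} (p : A → Bool) x xs →
                   length (filterᵇ p (x ∷ xs)) ≡ indicator (p x) + length (filterᵇ p xs)
length-filterᵇ-∷ p x xs with p x
... | true = refl
... | false = refl

filterᵇ-balance : ∀ {A : Set} (p q r : A → Bool) →
  (∀ x → indicator (p x) + indicator (q x) ≡ 1 + indicator (r x)) →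
  ∀ xs → length (filterᵇ p xs) + length (filterᵇ q xs) ≡ length xs + length (filterᵇ r xs)
filterᵇ-balance p q r H [] = refl
filterᵇ-balance p q r H (x ∷ xs)
  rewrite length-filterᵇ-∷ p x xs | length-filterᵇ-∷ q x xs | length-filterᵇ-∷ r x xs =
  lia 7 (λ a b c P Q R L → a :+ b :≡ # 1 :+ c ⇒ P :+ Q :≡ L :+ R ⇒ (a :+ P) :+ (b :+ Q) :≡ :suc L :+ (c :+ R))
    (indicator (p x)) (indicator (q x)) (indicator (r x)) (length (filterᵇ p xs)) (length (filterᵇ q xs))
    (length (filterᵇ r xs)) (length xs) (H x) (filterᵇ-balance p q r H xs)

allᵇ⁺ : ∀ {A : Set} (p : A → Bool) xs → (∀ {x} → x ∈ xs → T (p x)) → T (allᵇ p xs)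
allᵇ⁺ p [] H = _
allᵇ⁺ p (x ∷ xs) H = Equivalence.from T-∧ (H (here refl) , allᵇ⁺ p xs (H ∘ there))

allᵇ⁻ : ∀ {A : Set} (p : A → Bool) xs → T (allᵇ p xs) → ∀ {x} → x ∈ xs → T (p x)
allᵇ⁻ p _ t (here refl) = proj₁ (Equivalence.to T-∧ t)
allᵇ⁻ p (x ∷ xs) t (there x∈) = allᵇ⁻ p xs (proj₂ (Equivalence.to (T-∧ {p x}) t)) x∈

-- Stated for `tabulate g` so that the induction can shift `g`; `allFin` is the case `g = id`.
firstOr-spec : ∀ {A : Set} {n} (p : A → Bool) d (g : Fin n → A) → let r = firstOr d (filterᵇ p (tabulate g)) in
  (∃[ i ] r ≡ g i × T (p (g i)) × (∀ j → T (p (g j)) → toℕ i ≤ toℕ j)) ⊎ (r ≡ d × (∀ j → ¬ T (p (g j))))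
firstOr-spec {n = zero} p d g = inj₂ (refl , λ ())
firstOr-spec {n = suc n} p d g with p (g zero) in eq
... | true = inj₁ (zero , refl , subst T (sym eq) _ , λ _ _ → z≤n)
... | false with firstOr-spec p d (g ∘ suc)
...   | inj₁ (i , e , t , least) = inj₁ (suc i , e , t ,
          λ { zero t₀ → ⊥-elim (subst T eq t₀) ; (suc j) tⱼ → s≤s (least j tⱼ) })
...   | inj₂ (e , none) = inj₂ (e , λ { zero t₀ → subst T eq t₀ ; (suc j) → none j })

-- Cycles of injective maps on a finite set

module _ {n : ℕ} where

  iter-suc : ∀ (α : Fin n → Fin n) m x → iter α m (α x) ≡ iter α (suc m) x
  iter-suc α zero x = refl
  iter-suc α (suc m) x = cong α (iter-suc α m x)

  iter-+ : ∀ (α : Fin n → Fin n) m m′ x → iter α (m + m′) x ≡ iter α m (iter α m′ x)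
  iter-+ α zero m′ x = refl
  iter-+ α (suc m) m′ x = cong α (iter-+ α m m′ x)

  iter-cancel : ∀ {α : Fin n → Fin n} → (∀ {x y} → α x ≡ α y → x ≡ y) →
                ∀ m {x y} → iter α m x ≡ iter α m y → x ≡ y
  iter-cancel inj zero e = e
  iter-cancel inj (suc m) e = iter-cancel inj m (inj e)

  period : ∀ {α : Fin n → Fin n} → (∀ {x y} → α x ≡ α y → x ≡ y) →
           ∀ x → ∃[ p ] p < n × iter α (suc p) x ≡ x
  period {α} inj x with Fin.pigeonhole (ℕ.n<1+n n) (λ i → iter α (toℕ i) x)
  ... | i , j , i<j , e = p ,
      ℕ.≤-trans (subst (suc p ≤_) i+p (ℕ.m≤n+m (suc p) (toℕ i))) (s≤s⁻¹ (Fin.toℕ<n j)) ,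
      iter-cancel inj (toℕ i) (trans (sym (iter-+ α (toℕ i) (suc p) x)) (trans (cong (λ m → iter α m x) i+p) (sym e)))
    where
    p = toℕ j ∸ suc (toℕ i)
    i+p : toℕ i + suc p ≡ toℕ j
    i+p = trans (ℕ.+-suc (toℕ i) p) (ℕ.m+[n∸m]≡n i<j)

  isCycleMin⁺ : ∀ (α : Fin n → Fin n) {x} → (∀ m → toℕ x ≤ toℕ (iter α m x)) → T (isCycleMin α x)
  isCycleMin⁺ α H = allᵇ⁺ _ (upTo (suc n)) λ {m} _ → ℕ.≤⇒≤ᵇ (H m)

  isCycleMin⁻ : ∀ {α : Fin n → Fin n} {x} → T (isCycleMin α x) → ∀ {m} → m ≤ n → toℕ x ≤ toℕ (iter α m x)
  isCycleMin⁻ t m≤n = ℕ.≤ᵇ⇒≤ _ _ (allᵇ⁻ _ (upTo (suc n)) t (∈-upTo⁺ (s≤s m≤n)))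

  -- The test inspects the iterates up to n; later ones are reduced by the period p + 1 ≤ n.
  isCycleMin⁻∞ : ∀ {α : Fin n → Fin n} → (∀ {x y} → α x ≡ α y → x ≡ y) →
                 ∀ {x} → T (isCycleMin α x) → ∀ m → toℕ x ≤ toℕ (iter α m x)
  isCycleMin⁻∞ {α} inj {x} t m = go m m ℕ.≤-refl
    where
    go : ∀ fuel m → m ≤ fuel → toℕ x ≤ toℕ (iter α m x)
    go fuel m m≤ with m ≤? n
    ... | yes m≤n = isCycleMin⁻ t m≤n
    go zero zero z≤n | no m≰n = ⊥-elim (m≰n z≤n)
    go (suc fuel) m m≤ | no m≰n with period inj x
    ... | p , p<n , e = subst (λ y → toℕ x ≤ toℕ y)
            (trans (cong (iter α (m ∸ suc p)) (sym e)) (trans (sym (iter-+ α (m ∸ suc p) (suc p) x)) (cong (λ k → iter α k x) m∸p)))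
            (go fuel (m ∸ suc p) (ℕ.≤-trans (ℕ.∸-monoˡ-≤ {m} (suc p) m≤) (ℕ.m∸n≤m fuel p)))
      where
      m∸p : m ∸ suc p + suc p ≡ m
      m∸p = ℕ.m∸n+n≡m (ℕ.≤-trans p<n (ℕ.<⇒≤ (ℕ.≰⇒> m≰n)))

  findPre-correct : ∀ (α : Fin n → Fin n) {j x xs} → x ∈ xs → α x ≡ j → α (findPre α j xs) ≡ j
  findPre-correct α {j} {x} {y ∷ ys} x∈ e with α y ≟ᶠ j
  ... | yes e′ = e′
  findPre-correct α (here refl) e | no ne = ⊥-elim (ne e)
  findPre-correct α (there x∈) e | no _ = findPre-correct α x∈ e

  -- The cycle of j supplies a preimage, its last point before returning to j, so the search never
  -- ends in its default.
  inv-correct : ∀ {α : Fin n → Fin n} → (∀ {x y} → α x ≡ α y → x ≡ y) → ∀ j → α (inv α j) ≡ j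
  inv-correct {α} inj j with period inj j
  ... | p , _ , e = findPre-correct α (∈-allFin (iter α p j)) e

-- The long cycle ζ and cyclic shifts

module _ {n : ℕ} where

  toℕ-shift : ∀ (i : Fin (suc n)) t → toℕ (shift i t) ≡ (toℕ i + t) % suc n
  toℕ-shift i t = Fin.toℕ-fromℕ< _

  shift-zero : ∀ (i : Fin (suc n)) → shift i 0 ≡ i
  shift-zero i = Fin.toℕ-injective (trans (toℕ-shift i 0) (trans (cong (_% suc n) (ℕ.+-identityʳ (toℕ i))) (m<n⇒m%n≡m (Fin.toℕ<n i))))

  shift-suc : ∀ (i : Fin (suc n)) t → zeta (shift i t) ≡ shift i (suc t)
  shift-suc i t = Fin.toℕ-injective (trans (toℕ-shift (shift i t) 1) (trans (cong (λ m → (m + 1) % suc n) (toℕ-shift i t))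
    (trans (%-distribˡ-+ ((toℕ i + t) % suc n) 1 (suc n)) (trans (cong (λ m → (m + 1 % suc n) % suc n) (m%n%n≡m%n (toℕ i + t) (suc n)))
      (trans (sym (%-distribˡ-+ (toℕ i + t) 1 (suc n))) (trans (cong (_% suc n) (trans (ℕ.+-assoc (toℕ i) t 1) (cong (toℕ i +_) (ℕ.+-comm t 1))))
        (sym (toℕ-shift i (suc t)))))))))

  shift-period : ∀ (i : Fin (suc n)) → shift i (suc n) ≡ i
  shift-period i = Fin.toℕ-injective (trans (toℕ-shift i (suc n)) (trans ([m+n]%n≡m%n (toℕ i) (suc n)) (m<n⇒m%n≡m (Fin.toℕ<n i))))

  zeta-< : ∀ {i : Fin (suc n)} → suc (toℕ i) < suc n → toℕ (zeta i) ≡ suc (toℕ i)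
  zeta-< {i} lt = trans (toℕ-shift i 1) (trans (cong (_% suc n) (ℕ.+-comm (toℕ i) 1)) (m<n⇒m%n≡m lt))

  zeta-last : ∀ {i : Fin (suc n)} → suc (toℕ i) ≡ suc n → zeta i ≡ zero
  zeta-last {i} eq = Fin.toℕ-injective (trans (toℕ-shift i 1) (trans (cong (_% suc n) (trans (ℕ.+-comm (toℕ i) 1) eq)) (n%n≡0 (suc n))))

  zeta-cases : ∀ (i : Fin (suc n)) →
    (suc (toℕ i) < suc n × toℕ (zeta i) ≡ suc (toℕ i)) ⊎ (suc (toℕ i) ≡ suc n × zeta i ≡ zero)
  zeta-cases i with ℕ.m≤n⇒m<n∨m≡n (Fin.toℕ<n i)
  ... | inj₁ lt = inj₁ (lt , zeta-< lt)
  ... | inj₂ eq = inj₂ (eq , zeta-last eq)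

  zeta-injective : ∀ {i j : Fin (suc n)} → zeta i ≡ zeta j → i ≡ j
  zeta-injective {i} {j} e with zeta-cases i | zeta-cases j
  ... | inj₁ (_ , p) | inj₁ (_ , q) = Fin.toℕ-injective (ℕ.suc-injective (trans (sym p) (trans (cong toℕ e) q)))
  ... | inj₂ (p , _) | inj₂ (q , _) = Fin.toℕ-injective (ℕ.suc-injective (trans p (sym q)))
  ... | inj₁ (_ , p) | inj₂ (_ , q) = ⊥-elim (ℕ.1+n≢0 (trans (sym p) (cong toℕ (trans e q))))
  ... | inj₂ (_ , p) | inj₁ (_ , q) = ⊥-elim (ℕ.1+n≢0 (trans (sym q) (cong toℕ (trans (sym e) p))))

-- The permutation of a partition

module Partition {n : ℕ} (f : Vec (Fin (suc n)) (suc n)) (isPartition : IsPartition (suc n) f) where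

  F : Fin (suc n) → Fin (suc n)
  F = lookup f

  α β : Fin (suc n) → Fin (suc n)
  α = partPerm f
  β = inv α ∘ zeta

  F-≤ : ∀ x → toℕ (F x) ≤ toℕ x
  F-≤ x = proj₁ (isPartition x)

  F-idem : ∀ x → F (F x) ≡ F x
  F-idem x = proj₂ (isPartition x)

  private
    laterInBlock : Fin (suc n) → Fin (suc n) → Bool
    laterInBlock x y = (toℕ x <ᵇ toℕ y) ∧ does (F y ≟ᶠ F x)

    later⁺ : ∀ {x y} → toℕ x < toℕ y → F y ≡ F x → T (laterInBlock x y)
    later⁺ {x} {y} lt e with F y ≟ᶠ F x
    ... | yes _ = Equivalence.from T-∧ (ℕ.<⇒<ᵇ lt , _)
    ... | no ne = ⊥-elim (ne e)

    later⁻ : ∀ {x y} → T (laterInBlock x y) → toℕ x < toℕ y × F y ≡ F x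
    later⁻ {x} {y} t with F y ≟ᶠ F x
    ... | yes e = ℕ.<ᵇ⇒< _ _ (proj₁ (Equivalence.to T-∧ t)) , e
    ... | no _ = ⊥-elim (proj₂ (Equivalence.to (T-∧ {toℕ x <ᵇ toℕ y}) t))

  Successor Wraps : Fin (suc n) → Set
  Successor x = toℕ x < toℕ (α x) × F (α x) ≡ F x ×
                (∀ y → toℕ x < toℕ y → F y ≡ F x → toℕ (α x) ≤ toℕ y)
  Wraps x = α x ≡ F x × (∀ y → F y ≡ F x → toℕ y ≤ toℕ x)

  α-spec : ∀ x → Successor x ⊎ Wraps x
  α-spec x with firstOr-spec (laterInBlock x) (F x) id
  ... | inj₁ (i , e , t , least) = inj₁ (subst S (sym e)
          (proj₁ (later⁻ t) , proj₂ (later⁻ t) , λ y lt eq → least y (later⁺ lt eq)))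
    where
    S : Fin (suc n) → Set
    S w = toℕ x < toℕ w × F w ≡ F x × (∀ y → toℕ x < toℕ y → F y ≡ F x → toℕ w ≤ toℕ y)
  ... | inj₂ (e , none) = inj₂ (e , λ y eq → ℕ.≮⇒≥ λ lt → none y (later⁺ lt eq))

  α-block : ∀ x → F (α x) ≡ F x
  α-block x with α-spec x
  ... | inj₁ (_ , e , _) = e
  ... | inj₂ (e , _) = trans (cong F e) (F-idem x)

  iter-block : ∀ m x → F (iter α m x) ≡ F x
  iter-block zero x = refl
  iter-block (suc m) x = trans (α-block (iter α m x)) (iter-block m x)

  F-least : ∀ {x y} → F y ≡ F x → toℕ (F x) ≤ toℕ y
  F-least {x} {y} e = subst (λ w → toℕ w ≤ toℕ y) e (F-≤ y)

  α-between : ∀ {y w} → toℕ y < toℕ w → F w ≡ F y →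
              (∀ {q} → toℕ y < toℕ q → toℕ q < toℕ w → F q ≢ F y) → α y ≡ w
  α-between {y} {w} y<w e none with α-spec y
  ... | inj₁ (lt , e′ , least) = Fin.toℕ-injective (ℕ.≤-antisym (least w y<w e) (ℕ.≮⇒≥ λ αy<w → none lt αy<w e′))
  ... | inj₂ (_ , max) = ⊥-elim (ℕ.<⇒≱ y<w (max w e))

  α-wrap : ∀ {y w} → F w ≡ F y → (∀ {q} → toℕ y < toℕ q → F q ≢ F y) →
           (∀ {q} → toℕ q < toℕ w → F q ≢ F y) → α y ≡ w
  α-wrap {y} {w} e above below with α-spec y
  ... | inj₁ (lt , e′ , _) = ⊥-elim (above lt e′)
  ... | inj₂ (e′ , _) = trans e′ (Fin.toℕ-injective (ℕ.≤-antisym (F-least e) (ℕ.≮⇒≥ λ lt → below lt (F-idem y))))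

  α-increasing : ∀ {x y} → toℕ x < toℕ y → α x ≢ α y
  α-increasing {x} {y} x<y e = case α-spec x , α-spec y of λ where
      (inj₂ (_ , max) , _) → ℕ.<⇒≱ x<y (max y (sym Fx≡Fy))
      (inj₁ (_ , _ , least) , inj₁ (y<αy , _)) → ℕ.<⇒≱ y<αy (subst (λ w → toℕ w ≤ toℕ y) e (least y x<y (sym Fx≡Fy)))
      (inj₁ (x<αx , _) , inj₂ (αy≡ , _)) → ℕ.<⇒≱ x<αx (subst (λ w → toℕ w ≤ toℕ x) (trans Fx≡Fy (trans (sym αy≡) (sym e))) (F-≤ x))
    where
    Fx≡Fy : F x ≡ F y
    Fx≡Fy = trans (sym (α-block x)) (trans (cong F e) (α-block y))

  α-injective : ∀ {x y} → α x ≡ α y → x ≡ y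
  α-injective {x} {y} e with ℕ.<-cmp (toℕ x) (toℕ y)
  ... | tri≈ _ eq _ = Fin.toℕ-injective eq
  ... | tri< lt _ _ = ⊥-elim (α-increasing lt e)
  ... | tri> _ _ gt = ⊥-elim (α-increasing gt (sym e))

  αβ : ∀ x → α (β x) ≡ zeta x
  αβ x = inv-correct α-injective (zeta x)

  β-unique : ∀ {x y} → α y ≡ zeta x → β x ≡ y
  β-unique {x} e = α-injective (trans (αβ x) (sym e))

  β-injective : ∀ {x y} → β x ≡ β y → x ≡ y
  β-injective {x} {y} e = zeta-injective (trans (sym (αβ x)) (trans (cong α e) (αβ y)))

  isMin : Fin (suc n) → Bool
  isMin x = does (F x ≟ᶠ x)

  isMin⁺ : ∀ {x} → F x ≡ x → T (isMin x)
  isMin⁺ {x} e with F x ≟ᶠ x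
  ... | yes _ = _
  ... | no ne = ne e

  isMin⁻ : ∀ {x} → T (isMin x) → F x ≡ x
  isMin⁻ {x} t with F x ≟ᶠ x
  ... | yes e = e

  -- α increases until it returns to the block minimum. The bound on m keeps the iterate within the
  -- range inspected by `isCycleMin`.
  reach-min : ∀ fuel x → suc n ≤ toℕ x + fuel → ∃[ m ] m ≤ fuel × iter α m x ≡ F x
  reach-min zero x le = ⊥-elim (ℕ.<⇒≱ (Fin.toℕ<n x) (subst (suc n ≤_) (ℕ.+-identityʳ (toℕ x)) le))
  reach-min (suc fuel) x le with α-spec x
  ... | inj₂ (e , _) = 1 , s≤s z≤n , e
  ... | inj₁ (lt , e , _) with reach-min fuel (α x) (ℕ.≤-trans (subst (suc n ≤_) (ℕ.+-suc (toℕ x) fuel) le) (ℕ.+-monoˡ-≤ fuel lt))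
  ...   | m , m≤ , e′ = suc m , s≤s m≤ , trans (sym (iter-suc α m x)) (trans e′ e)

  z-α : z α ≡ blocks f
  z-α = card-≡ (fins-unique (isCycleMin α)) (fins-unique isMin) (λ {x} x∈ → ∈-fins⁺ isMin (isMin⁺ (to x (∈-fins⁻ (isCycleMin α) x∈))))
          (λ {x} x∈ → ∈-fins⁺ (isCycleMin α) (isCycleMin⁺ α λ m → subst (λ w → toℕ w ≤ toℕ (iter α m x)) (isMin⁻ {x} (∈-fins⁻ isMin x∈))
            (F-least (iter-block m x))))
    where
    to : ∀ x → T (isCycleMin α x) → F x ≡ x
    to x t with reach-min (suc n) x (ℕ.m≤n+m (suc n) (toℕ x))
    ... | m , m≤ , e = Fin.toℕ-injective (ℕ.≤-antisym (F-≤ x) (subst (λ w → toℕ x ≤ toℕ w) e (isCycleMin⁻ t m≤)))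

  -- `β x` is the cyclic predecessor of ζ x in its block. It lies before ζ x, hence not after x,
  -- unless ζ x is the block minimum. The last point cannot be exceeded, so it is treated apart.
  ascent⇔min : ∀ x → (toℕ x < toℕ (β x) → suc (toℕ x) < suc n × F (zeta x) ≡ zeta x) ×
                     (suc (toℕ x) < suc n → F (zeta x) ≡ zeta x → toℕ x < toℕ (β x))
  ascent⇔min x with α-spec (β x) | zeta-cases x
  ... | inj₁ (lt , _ , _) | inj₂ (_ , ζ≡) = ⊥-elim (ℕ.<⇒≱ lt (subst (λ w → toℕ w ≤ toℕ (β x)) (trans (sym ζ≡) (sym (αβ x))) z≤n))
  ... | inj₁ (lt , e , _) | inj₁ (_ , ζ≡) =
          (λ x<βx → ⊥-elim (ℕ.<⇒≱ x<βx (s≤s⁻¹ (subst (toℕ (β x) <_) (trans (cong toℕ (αβ x)) ζ≡) lt)))) ,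
          (λ _ min → ⊥-elim (ℕ.<⇒≱ lt (subst (λ w → toℕ w ≤ toℕ (β x))
            (trans (sym e) (trans (cong F (αβ x)) (trans min (sym (αβ x))))) (F-≤ (β x)))))
  ... | inj₂ (e , max) | inj₁ (lt , ζ≡) =
          (λ _ → lt , min) , (λ _ _ → ℕ.≤-trans (ℕ.≤-reflexive (sym ζ≡))
            (subst (λ w → toℕ w ≤ toℕ (β x)) (trans (sym e) (αβ x)) (F-≤ (β x))))
    where
    min : F (zeta x) ≡ zeta x
    min = subst (λ w → F w ≡ w) (trans (sym e) (αβ x)) (F-idem (β x))
  ... | inj₂ _ | inj₂ (eq , _) =
          (λ x<βx → ⊥-elim (ℕ.<⇒≱ (Fin.toℕ<n (β x)) (subst (_≤ toℕ (β x)) eq x<βx))) ,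
          (λ lt → ⊥-elim (ℕ.<⇒≢ lt eq))

  isAscent isWeakAscent isRunEnd : Fin (suc n) → Bool
  isAscent x = toℕ x <ᵇ toℕ (β x)
  isWeakAscent x = toℕ x ≤ᵇ toℕ (β x)
  isRunEnd x = not (does (α x ≟ᶠ zeta x))

  isRunEnd⁺ : ∀ {x} → α x ≢ zeta x → T (isRunEnd x)
  isRunEnd⁺ {x} ne with α x ≟ᶠ zeta x
  ... | yes e = ne e
  ... | no _ = _

  isRunEnd⁻ : ∀ {x} → T (isRunEnd x) → α x ≢ zeta x
  isRunEnd⁻ {x} t e with α x ≟ᶠ zeta x
  ... | no ne = ne e

  ¬isRunEnd : ∀ {x} → ¬ T (isRunEnd x) → α x ≡ zeta x
  ¬isRunEnd {x} t with α x ≟ᶠ zeta x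
  ... | yes e = e
  ... | no _ = ⊥-elim (t _)

  -- ζ maps the ascents onto the block minima other than `zero`, which accounts for the extra one.
  ascents-count : suc (length (fins isAscent)) ≡ blocks f
  ascents-count = trans (cong suc (sym (length-map zeta (fins isAscent))))
    (card-≡ unique (fins-unique isMin) to from)
    where
    ascent : ∀ {x} → x ∈ fins isAscent → suc (toℕ x) < suc n × F (zeta x) ≡ zeta x
    ascent {x} x∈ = proj₁ (ascent⇔min x) (ℕ.<ᵇ⇒< _ _ (∈-fins⁻ isAscent {x} x∈))
    unique : Unique (zero ∷ map zeta (fins isAscent))
    unique = All.tabulate (λ {y} y∈ 0≡y → case ∈-map⁻ zeta y∈ of λ where
        (x , x∈ , refl) → ℕ.1+n≢0 (trans (sym (zeta-< {i = x} (proj₁ (ascent x∈)))) (cong toℕ (sym 0≡y))))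
      ∷ Unique.map⁺ zeta-injective (fins-unique isAscent)
    to : ∀ {y} → y ∈ zero ∷ map zeta (fins isAscent) → y ∈ fins isMin
    to (here refl) = ∈-fins⁺ isMin (isMin⁺ (Fin.toℕ-injective (ℕ.n≤0⇒n≡0 (F-≤ zero))))
    to (there y∈) with ∈-map⁻ zeta y∈
    ... | x , x∈ , refl = ∈-fins⁺ isMin (isMin⁺ (proj₂ (ascent x∈)))
    from : ∀ {y} → y ∈ fins isMin → y ∈ zero ∷ map zeta (fins isAscent)
    from {zero} _ = here refl
    from {suc y} y∈ = there (subst (_∈ map zeta (fins isAscent)) ζx≡
        (∈-map⁺ zeta (∈-fins⁺ isAscent (ℕ.<⇒<ᵇ (proj₂ (ascent⇔min (inject₁ y)) lt (subst (λ w → F w ≡ w) (sym ζx≡) (isMin⁻ {suc y} (∈-fins⁻ isMin y∈))))))))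
      where
      lt : suc (toℕ (inject₁ y)) < suc n
      lt = s≤s (subst (_< n) (sym (Fin.toℕ-inject₁ y)) (Fin.toℕ<n y))
      ζx≡ : zeta (inject₁ y) ≡ suc y
      ζx≡ = Fin.toℕ-injective (trans (zeta-< lt) (cong suc (Fin.toℕ-inject₁ y)))

  -- A strict ascent of β is a weak ascent and a run end, a fixed point only the former, a descent
  -- only the latter.
  balance : length (fins isWeakAscent) + length (fins isRunEnd) ≡ suc n + length (fins isAscent)
  balance = trans (filterᵇ-balance isWeakAscent isRunEnd isAscent pointwise (allFin (suc n)))
              (cong (_+ length (fins isAscent)) (length-tabulate id))
    where
    pointwise : ∀ x → indicator (isWeakAscent x) + indicator (isRunEnd x) ≡ 1 + indicator (isAscent x)
    pointwise x with ℕ.<-cmp (toℕ x) (toℕ (β x))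
    ... | tri< lt ne _ = trans (cong₂ _+_ (indicator-true (ℕ.≤⇒≤ᵇ (ℕ.<⇒≤ lt)))
              (indicator-true (isRunEnd⁺ λ e → ne (cong toℕ (sym (β-unique {x} e))))))
            (cong suc (sym (indicator-true (ℕ.<⇒<ᵇ lt))))
    ... | tri≈ ¬lt eq _ = trans (cong₂ _+_ (indicator-true (ℕ.≤⇒≤ᵇ (ℕ.≤-reflexive eq)))
              (indicator-false λ t → isRunEnd⁻ t (subst (λ w → α w ≡ zeta x) (sym (Fin.toℕ-injective eq)) (αβ x))))
            (cong suc (sym (indicator-false λ t → ¬lt (ℕ.<ᵇ⇒< _ _ t))))
    ... | tri> ¬lt ne gt = trans (cong₂ _+_ (indicator-false λ t → ℕ.<⇒≱ gt (ℕ.≤ᵇ⇒≤ _ _ t))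
              (indicator-true (isRunEnd⁺ λ e → ne (cong toℕ (sym (β-unique {x} e))))))
            (cong suc (sym (indicator-false λ t → ¬lt (ℕ.<ᵇ⇒< _ _ t))))

  cycleMin⇒weakAscent : ∀ {x} → x ∈ fins (isCycleMin β) → x ∈ fins isWeakAscent
  cycleMin⇒weakAscent {x} x∈ =
    ∈-fins⁺ isWeakAscent {x} (ℕ.≤⇒≤ᵇ (isCycleMin⁻ {α = β} {x} (∈-fins⁻ (isCycleMin β) x∈) {1} (s≤s z≤n)))

  genus1⇒ : HasGenus (suc n) α 1 → 2 * blocks f ≤ length (fins isRunEnd) →
            length (fins isRunEnd) ≡ 2 * blocks f × (∀ x → toℕ x ≤ toℕ (β x) → T (isCycleMin β x))
  genus1⇒ g le = ends≡ , λ x x≤ → ∈-fins⁻ (isCycleMin β) (card-⊇ (fins-unique (isCycleMin β)) cycleMin⇒weakAscent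
      (weak≤ (length (fins isWeakAscent)) (length (fins isRunEnd)) (z α) (z β) (length (fins isAscent)) (blocks f) n le balance z-α ascents-count g)
      (∈-fins⁺ isWeakAscent {x} (ℕ.≤⇒≤ᵇ x≤)))
    where
    weak≤ : ∀ w e a b c k n → 2 * k ≤ e → w + e ≡ suc n + c → a ≡ k → suc c ≡ k → a + b + 2 * 1 ≡ suc n + 1 → w ≤ b
    weak≤ = lia 7 λ w e a b c k n → 2 :* k :≤ e ⇒ w :+ e :≡ :suc n :+ c ⇒ a :≡ k ⇒ :suc c :≡ k ⇒ a :+ b :+ 2 :* # 1 :≡ :suc n :+ # 1 ⇒ w :≤ b
    ends≡ = lia 7 (λ w e a b c k n → 2 :* k :≤ e ⇒ w :+ e :≡ :suc n :+ c ⇒ a :≡ k ⇒ :suc c :≡ k ⇒ a :+ b :+ 2 :* # 1 :≡ :suc n :+ # 1 ⇒ b :≤ w ⇒ e :≡ 2 :* k)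
      (length (fins isWeakAscent)) (length (fins isRunEnd)) (z α) (z β) (length (fins isAscent)) (blocks f) n le balance z-α ascents-count g
      (card-≤ (fins-unique (isCycleMin β)) cycleMin⇒weakAscent)

  genus1⇐ : length (fins isRunEnd) ≡ 2 * blocks f → (∀ x → toℕ x ≤ toℕ (β x) → T (isCycleMin β x)) →
            HasGenus (suc n) α 1
  genus1⇐ ends≡ min = lia 7 (λ w e a b c k n → e :≡ 2 :* k ⇒ w :+ e :≡ :suc n :+ c ⇒ a :≡ k ⇒ :suc c :≡ k ⇒ b :≡ w ⇒ a :+ b :+ 2 :* # 1 :≡ :suc n :+ # 1)
      (length (fins isWeakAscent)) (length (fins isRunEnd)) (z α) (z β) (length (fins isAscent)) (blocks f) n ends≡ balance z-α ascents-count
      (card-≡ (fins-unique (isCycleMin β)) (fins-unique isWeakAscent) cycleMin⇒weakAscent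
        λ {x} x∈ → ∈-fins⁺ (isCycleMin β) {x} (min x (ℕ.≤ᵇ⇒≤ (toℕ x) (toℕ (β x)) (∈-fins⁻ isWeakAscent {x} x∈))))

  -- Two distinct points of each block, indexed by the block minima; they will be the ends of two
  -- runs.
  blockPair-unique : ∀ {e₁ e₂ : Fin (suc n) → Fin (suc n)} → (∀ x → F (e₁ x) ≡ F x) → (∀ x → F (e₂ x) ≡ F x) →
                     (∀ x → e₁ x ≢ e₂ x) → Unique (map e₁ (fins isMin) ++ map e₂ (fins isMin))
  blockPair-unique {e₁} {e₂} E₁ E₂ ne = Unique.++⁺ (map-unique (fins-unique isMin) (inj E₁)) (map-unique (fins-unique isMin) (inj E₂))
    λ (p , q) → case ∈-map⁻ e₁ p , ∈-map⁻ e₂ q of λ where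
      ((x , x∈ , refl) , (y , y∈ , e)) → ne x (trans e (cong e₂ (same-min x∈ y∈ (trans (sym (E₁ x)) (trans (cong F e) (E₂ y))) ) ))
    where
    same-min : ∀ {x y} → x ∈ fins isMin → y ∈ fins isMin → F x ≡ F y → y ≡ x
    same-min {x} {y} x∈ y∈ e = trans (sym (isMin⁻ {y} (∈-fins⁻ isMin y∈))) (trans (sym e) (isMin⁻ {x} (∈-fins⁻ isMin x∈)))
    inj : ∀ {e : Fin (suc n) → Fin (suc n)} → (∀ x → F (e x) ≡ F x) → ∀ {x y} → x ∈ fins isMin → y ∈ fins isMin → e x ≡ e y → x ≡ y
    inj E {x} {y} x∈ y∈ eq = sym (same-min x∈ y∈ (trans (sym (E x)) (trans (cong F eq) (E y))))

  blockPair-length : ∀ (e₁ e₂ : Fin (suc n) → Fin (suc n)) → length (map e₁ (fins isMin) ++ map e₂ (fins isMin)) ≡ 2 * blocks f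
  blockPair-length e₁ e₂ = trans (length-++ (map e₁ (fins isMin))) (cong₂ _+_ (length-map e₁ (fins isMin))
    (trans (length-map e₂ (fins isMin)) (sym (ℕ.+-identityʳ (blocks f)))))

-- From chord diagrams to partitions and back

size : ∀ {n} → Vec Bool n → ℕ
size [] = 0
size (b ∷ v) = indicator b + size v

-- The number of elements of the subset below a position. Positions are natural numbers in order to
-- include n itself, whose rank is the size.
rank : ∀ {n} → Vec Bool n → ℕ → ℕ
rank [] _ = 0
rank (b ∷ v) zero = 0
rank (b ∷ v) (suc x) = indicator b + rank v x

rank-zero : ∀ {n} (v : Vec Bool n) → rank v 0 ≡ 0
rank-zero [] = refl
rank-zero (_ ∷ _) = refl

rank-size : ∀ {n} (v : Vec Bool n) → rank v n ≡ size v
rank-size [] = refl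
rank-size (b ∷ v) = cong (indicator b +_) (rank-size v)

rank-suc : ∀ {n} (v : Vec Bool n) x → rank v (suc (toℕ x)) ≡ rank v (toℕ x) + indicator (lookup v x)
rank-suc (b ∷ v) zero = trans (cong (indicator b +_) (rank-zero v)) (ℕ.+-identityʳ _)
rank-suc (b ∷ v) (suc x) = trans (cong (indicator b +_) (rank-suc v x)) (sym (ℕ.+-assoc (indicator b) _ _))

rank-mono : ∀ {n} (v : Vec Bool n) {x y} → x ≤ y → rank v x ≤ rank v y
rank-mono [] _ = z≤n
rank-mono (b ∷ v) z≤n = z≤n
rank-mono (b ∷ v) (s≤s x≤y) = ℕ.+-monoʳ-≤ (indicator b) (rank-mono v x≤y)

rank-≤size : ∀ {n} (v : Vec Bool n) (x : Fin n) → rank v (toℕ x) ≤ size v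
rank-≤size {n} v x = subst (rank v (toℕ x) ≤_) (rank-size v) (rank-mono v (ℕ.<⇒≤ (Fin.toℕ<n x)))

module _ {n : ℕ} (v : Vec Bool n) where

  rank-suc-∈ : ∀ {x} → T (lookup v x) → rank v (suc (toℕ x)) ≡ suc (rank v (toℕ x))
  rank-suc-∈ {x} t = trans (rank-suc v x) (trans (cong (rank v (toℕ x) +_) (indicator-true t)) (ℕ.+-comm _ 1))

  rank-< : ∀ {x y} → T (lookup v x) → toℕ x < y → rank v (toℕ x) < rank v y
  rank-< {x} {y} t lt = subst (_≤ rank v y) (rank-suc-∈ t) (rank-mono v lt)

  rank-<size : ∀ {x} → T (lookup v x) → rank v (toℕ x) < size v
  rank-<size {x} t = subst (rank v (toℕ x) <_) (rank-size v) (rank-< t (Fin.toℕ<n x))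

  rank-injective : ∀ {x y} → T (lookup v x) → T (lookup v y) → rank v (toℕ x) ≡ rank v (toℕ y) → x ≡ y
  rank-injective {x} {y} tx ty e with ℕ.<-cmp (toℕ x) (toℕ y)
  ... | tri< lt _ _ = ⊥-elim (ℕ.<⇒≢ (rank-< tx lt) e)
  ... | tri≈ _ eq _ = Fin.toℕ-injective eq
  ... | tri> _ _ gt = ⊥-elim (ℕ.<⇒≢ (rank-< ty gt) (sym e))

element : ∀ {n} (v : Vec Bool n) {r} → r < size v → ∃[ x ] T (lookup v x) × rank v (toℕ x) ≡ r
element (true ∷ v) {zero} _ = zero , _ , refl
element (true ∷ v) {suc r} (s≤s r<) with element v r<
... | x , t , e = suc x , t , cong suc e
element (false ∷ v) r< with element v r<
... | x , t , e = suc x , t , e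

size-tabulate : ∀ {n} {A : Set} (p : A → Bool) (g : Fin n → A) →
                size (Vec.tabulate (p ∘ g)) ≡ length (filterᵇ p (tabulate g))
size-tabulate {zero} p g = refl
size-tabulate {suc n} p g = trans (cong (indicator (p (g zero)) +_) (size-tabulate p (g ∘ suc)))
  (sym (length-filterᵇ-∷ p (g zero) (tabulate (g ∘ suc))))

size-fins : ∀ {n} (v : Vec Bool n) → size v ≡ length (fins (lookup v))
size-fins v = trans (cong size (sym (Vec.tabulate∘lookup v))) (size-tabulate (lookup v) id)

wrap-zero : ∀ N → wrap N 0 ≡ 0
wrap-zero N with 0 ≟ N
... | yes _ = refl
... | no _ = refl

wrap-bound : ∀ {N s} → 0 < N → s ≤ N → wrap N s < N
wrap-bound {N} {s} 0<N s≤N with s ≟ N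
... | yes _ = 0<N
... | no ne = ℕ.≤∧≢⇒< s≤N ne

-- The points after the last element of v come cyclically before its first element.
cyclicRank : ∀ {n} → Vec Bool n → Fin n → ℕ
cyclicRank v x = wrap (size v) (rank v (toℕ x))

module _ {n : ℕ} (v : Vec Bool (suc n)) where

  cyclicRank-∈ : ∀ {x} → T (lookup v x) → cyclicRank v x ≡ rank v (toℕ x)
  cyclicRank-∈ t = wrap-< (rank-<size v t)

  cyclicRank-zeta : ∀ x → cyclicRank v (zeta x) ≡ wrap (size v) (rank v (suc (toℕ x)))
  cyclicRank-zeta x with zeta-cases x
  ... | inj₁ (_ , e) = cong (wrap (size v) ∘ rank v) e
  ... | inj₂ (l , e) = trans (cong (cyclicRank v) e) (trans (cong (wrap (size v)) (rank-zero v)) (trans (wrap-zero (size v))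
          (trans (sym (wrap-self (size v))) (cong (wrap (size v)) (trans (sym (rank-size v)) (cong (rank v) (sym l)))))))

  cyclicRank-zeta-∈ : ∀ {x} → T (lookup v x) → cyclicRank v (zeta x) ≡ wrap (size v) (suc (rank v (toℕ x)))
  cyclicRank-zeta-∈ {x} t = trans (cyclicRank-zeta x) (cong (wrap (size v)) (rank-suc-∈ v t))

  cyclicRank-zeta-∉ : ∀ {x} → ¬ T (lookup v x) → cyclicRank v (zeta x) ≡ cyclicRank v x
  cyclicRank-zeta-∉ {x} ¬t = trans (cyclicRank-zeta x) (cong (wrap (size v))
    (trans (rank-suc v x) (trans (cong (rank v (toℕ x) +_) (indicator-false ¬t)) (ℕ.+-identityʳ _))))

  cyclicRank-bound : 0 < size v → ∀ x → cyclicRank v x < size v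
  cyclicRank-bound 0<N x = wrap-bound 0<N (rank-≤size v x)

Joined : (ℕ → ℕ) → ℕ → ℕ → Set
Joined μ r s = s ≡ r ⊎ s ≡ μ r

-- When v is the set of run ends, `cyclicRank v x` is the number of the run through x. Two points
-- share a block if their runs coincide or are joined by a chord.
Realizes : ∀ {n} → Vec (Fin (suc n)) (suc n) → Vec Bool (suc n) → (ℕ → ℕ) → Set
Realizes f v μ = ∀ x y → lookup f x ≡ lookup f y ⇔ Joined μ (cyclicRank v x) (cyclicRank v y)

-- A partition that realizes a chord diagram is reduced of genus one

module Realization {n : ℕ} (f : Vec (Fin (suc n)) (suc n)) (isPartition : IsPartition (suc n) f)
  (v : Vec Bool (suc n)) (μ : ℕ → ℕ) (0<N : 0 < size v) (D : ChordDiagram (size v) μ) (realizes : Realizes f v μ) where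

  open Partition f isPartition
  open ChordDiagram D

  N : ℕ
  N = size v

  rk crk : Fin (suc n) → ℕ
  rk x = rank v (toℕ x)
  crk = cyclicRank v

  V : Fin (suc n) → Set
  V x = T (lookup v x)

  crk<N : ∀ x → crk x < N
  crk<N = cyclicRank-bound v 0<N

  joined⇒ : ∀ {x y} → Joined μ (crk x) (crk y) → F x ≡ F y
  joined⇒ = Equivalence.from (realizes _ _)

  ⇒joined : ∀ {x y} → F x ≡ F y → Joined μ (crk x) (crk y)
  ⇒joined = Equivalence.to (realizes _ _)

  private
    rk<N⇒crk : ∀ {x r} → rk x ≤ r → r < N → crk x ≡ rk x
    rk<N⇒crk le lt = wrap-< (ℕ.≤-<-trans le lt)

  α-outside : ∀ {x} → ¬ V x → α x ≡ zeta x
  α-outside {x} ¬t with zeta-cases x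
  ... | inj₁ (lt , e) = α-between (subst (toℕ x <_) (sym e) ℕ.≤-refl) (joined⇒ (inj₁ (sym (cyclicRank-zeta-∉ v ¬t))))
          λ {q} x<q q<ζ → ⊥-elim (ℕ.<⇒≱ x<q (s≤s⁻¹ (subst (toℕ q <_) e q<ζ)))
  ... | inj₂ (l , e) = α-wrap (joined⇒ (inj₁ (sym (cyclicRank-zeta-∉ v ¬t))))
          (λ {q} x<q → ⊥-elim (ℕ.<⇒≱ (Fin.toℕ<n q) (subst (_≤ toℕ q) l x<q)))
          (λ {q} q<ζ → ⊥-elim (ℕ.n≮0 (subst (λ w → toℕ q < toℕ w) e q<ζ)))

  -- The cyclic successor of x opens the run that the block of y continues with.
  α-inside : ∀ {x y} → V x → V y → wrap N (suc (rk x)) ≡ μ (rk y) → α y ≡ zeta x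
  α-inside {x} {y} tx ty e = case zeta-cases x of λ where
      (inj₂ (l , ζ≡)) → α-wrap ζ-block
        (λ {q} y<q → gap y<q (s≤s⁻¹ (subst (toℕ q <_) (sym l) (Fin.toℕ<n q))))
        (λ {q} q<ζ → ⊥-elim (ℕ.n≮0 (subst (λ w → toℕ q < toℕ w) ζ≡ q<ζ)))
      (inj₁ (l , ζ≡)) → case toℕ y <? toℕ (zeta x) of λ where
        (yes y<ζ) → α-between y<ζ ζ-block λ {q} y<q q<ζ → gap y<q (s≤s⁻¹ (subst (toℕ q <_) ζ≡ q<ζ))
        (no y≮ζ) → let x<y = subst (_≤ toℕ y) ζ≡ (ℕ.≮⇒≥ y≮ζ) in α-wrap ζ-block (beyond x<y)
          (λ {q} q<ζ → before x<y (s≤s⁻¹ (subst (toℕ q <_) ζ≡ q<ζ)))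
    where
    r<N : rk x < N
    r<N = rank-<size v tx
    s<N : rk y < N
    s<N = rank-<size v ty
    crk-y : crk y ≡ rk y
    crk-y = cyclicRank-∈ v ty
    ζ-block : F (zeta x) ≡ F y
    ζ-block = sym (joined⇒ (inj₂ (trans (cyclicRank-zeta-∈ v tx) (trans e (cong μ (sym crk-y))))))
    separate : ∀ {q} → crk q ≢ rk y → crk q ≢ wrap N (suc (rk x)) → F q ≢ F y
    separate p p′ eq = [ (λ h → p (trans h crk-y)) , (λ h → p′ (trans h (trans (cong μ crk-y) (sym e)))) ] (⇒joined (sym eq))
    gap : ∀ {q} → toℕ y < toℕ q → toℕ q ≤ toℕ x → F q ≢ F y
    gap {q} y<q q≤x = separate (λ h → ℕ.<⇒≢ s<rq (trans (sym h) crk≡)) λ h → case ℕ.m≤n⇒m<n∨m≡n r<N of λ where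
        (inj₁ sr<N) → ℕ.<⇒≱ (ℕ.n<1+n (rk x)) (subst (_≤ rk x) (trans (sym crk≡) (trans h (wrap-< sr<N))) rq≤r)
        (inj₂ sr≡N) → ℕ.n≮0 (subst (rk y <_) (trans (sym crk≡) (trans h (trans (cong (wrap N) sr≡N) (wrap-self N)))) s<rq)
      where
      s<rq : rk y < rk q
      s<rq = rank-< v ty y<q
      rq≤r : rk q ≤ rk x
      rq≤r = rank-mono v q≤x
      crk≡ : crk q ≡ rk q
      crk≡ = rk<N⇒crk rq≤r r<N
    module _ (x<y : toℕ x < toℕ y) where
      r<s : rk x < rk y
      r<s = rank-< v tx x<y
      wrap≡ : wrap N (suc (rk x)) ≡ suc (rk x)
      wrap≡ = wrap-< (ℕ.≤-<-trans r<s s<N)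
      before : ∀ {q} → toℕ q ≤ toℕ x → F q ≢ F y
      before {q} q≤x = separate (λ h → ℕ.<⇒≢ (ℕ.≤-<-trans rq≤r r<s) (trans (sym crk≡) h))
          (λ h → ℕ.<⇒≢ (s≤s rq≤r) (trans (sym crk≡) (trans h wrap≡)))
        where
        rq≤r : rk q ≤ rk x
        rq≤r = rank-mono v q≤x
        crk≡ : crk q ≡ rk q
        crk≡ = rk<N⇒crk rq≤r r<N
      beyond : ∀ {q} → toℕ y < toℕ q → F q ≢ F y
      beyond {q} y<q = case ℕ.m≤n⇒m<n∨m≡n (rank-≤size v q) of λ where
          (inj₁ rq<N) → separate (λ h → ℕ.<⇒≢ s<rq (trans (sym h) (wrap-< rq<N)))
            (λ h → ℕ.<⇒≢ (ℕ.≤-<-trans r<s s<rq) (trans (sym wrap≡) (trans (sym h) (wrap-< rq<N))))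
          (inj₂ rq≡N) → separate (λ h → ℕ.n≮0 (subst (rk x <_) (trans (sym h) (crk≡0 rq≡N)) r<s))
            (λ h → ℕ.1+n≢0 (trans (sym wrap≡) (trans (sym h) (crk≡0 rq≡N))))
        where
        s<rq : rk y < rk q
        s<rq = rank-< v ty y<q
        crk≡0 : rk q ≡ N → crk q ≡ 0
        crk≡0 eq = trans (cong (wrap N) eq) (wrap-self N)

  β-outside : ∀ {x} → ¬ V x → β x ≡ x
  β-outside {x} ¬t = β-unique {x} (α-outside ¬t)

  -- The point ζ x opens the run after that of x, and α enters it from the end of the run joined to
  -- it.
  β-inside : ∀ {x} → V x → V (β x) × rk (β x) ≡ rotated N μ (rk x)
  β-inside {x} tx =
    let next<N = wrap-bound 0<N (rank-<size v tx)
        (y , ty , e) = element v (bounded next<N)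
        β≡y = β-unique {x} {y} (α-inside tx ty (trans (sym (involutive next<N)) (cong μ (sym e))))
    in subst V (sym β≡y) ty , trans (cong rk β≡y) e

  runEnd⇒inside : ∀ {x} → T (isRunEnd x) → V x
  runEnd⇒inside {x} t with T? (lookup v x)
  ... | yes tx = tx
  ... | no ¬t = ⊥-elim (isRunEnd⁻ {x} t (α-outside ¬t))

  -- The field `reduced` keeps consecutive runs in different blocks: α x = ζ x would make x a fixed
  -- point of β and its rank one of the rotation.
  inside⇒runEnd : ∀ {x} → V x → T (isRunEnd x)
  inside⇒runEnd {x} tx = isRunEnd⁺ {x} λ e →
    reduced (rank-<size v tx) (trans (sym (proj₂ (β-inside tx))) (cong rk (β-unique {x} e)))

  runEnds-size : length (fins isRunEnd) ≡ N
  runEnds-size = trans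
    (card-≡ (fins-unique isRunEnd) (fins-unique (lookup v))
      (λ {x} p → ∈-fins⁺ (lookup v) (runEnd⇒inside (∈-fins⁻ isRunEnd {x} p)))
      (λ {x} p → ∈-fins⁺ isRunEnd (inside⇒runEnd {x} (∈-fins⁻ (lookup v) p))))
    (sym (size-fins v))

  private
    e₁ e₂ : Fin (suc n) → Fin (suc n)
    e₁ x = proj₁ (element v (crk<N x))
    e₂ x = proj₁ (element v (bounded (crk<N x)))

    crk-e₁ : ∀ x → crk (e₁ x) ≡ crk x
    crk-e₁ x = let (_ , t , e) = element v (crk<N x) in trans (cyclicRank-∈ v t) e

    crk-e₂ : ∀ x → crk (e₂ x) ≡ μ (crk x)
    crk-e₂ x = let (_ , t , e) = element v (bounded (crk<N x)) in trans (cyclicRank-∈ v t) e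

  -- A block consists of the run of its minimum and the run joined to it; `e₁` and `e₂` give their
  -- ends.
  N≡2*blocks : N ≡ 2 * blocks f
  N≡2*blocks = trans (size-fins v) (trans
      (card-≡ (fins-unique (lookup v)) (blockPair-unique E₁ E₂ e₁≢e₂) to from)
      (blockPair-length e₁ e₂))
    where
    E₁ : ∀ x → F (e₁ x) ≡ F x
    E₁ x = sym (joined⇒ (inj₁ (crk-e₁ x)))
    E₂ : ∀ x → F (e₂ x) ≡ F x
    E₂ x = sym (joined⇒ (inj₂ (crk-e₂ x)))
    e₁≢e₂ : ∀ x → e₁ x ≢ e₂ x
    e₁≢e₂ x eq = irreflexive (crk<N x) (trans (sym (crk-e₂ x)) (trans (cong crk (sym eq)) (crk-e₁ x)))
    same : ∀ {x y} → V x → V y → crk x ≡ crk y → x ≡ y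
    same tx ty e = rank-injective v tx ty (trans (sym (cyclicRank-∈ v tx)) (trans e (cyclicRank-∈ v ty)))
    to : ∀ {x} → x ∈ fins (lookup v) → x ∈ map e₁ (fins isMin) ++ map e₂ (fins isMin)
    to {x} x∈ = case ⇒joined {F x} {x} (F-idem x) of λ where
        (inj₁ h) → ∈-++⁺ˡ (subst (_∈ map e₁ (fins isMin)) (same (proj₁ (proj₂ (element v (crk<N (F x))))) tx (trans (crk-e₁ (F x)) (sym h))) (∈-map⁺ e₁ min∈))
        (inj₂ h) → ∈-++⁺ʳ (map e₁ (fins isMin)) (subst (_∈ map e₂ (fins isMin)) (same (proj₁ (proj₂ (element v (bounded (crk<N (F x)))))) tx (trans (crk-e₂ (F x)) (sym h))) (∈-map⁺ e₂ min∈))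
      where
      tx = ∈-fins⁻ (lookup v) {x} x∈
      min∈ : F x ∈ fins isMin
      min∈ = ∈-fins⁺ isMin (isMin⁺ {F x} (F-idem x))
    from : ∀ {x} → x ∈ map e₁ (fins isMin) ++ map e₂ (fins isMin) → x ∈ fins (lookup v)
    from x∈ = case ∈-++⁻ (map e₁ (fins isMin)) x∈ of λ where
      (inj₁ p) → case ∈-map⁻ e₁ p of λ where (y , _ , refl) → ∈-fins⁺ (lookup v) (proj₁ (proj₂ (element v (crk<N y))))
      (inj₂ p) → case ∈-map⁻ e₂ p of λ where (y , _ , refl) → ∈-fins⁺ (lookup v) (proj₁ (proj₂ (element v (bounded (crk<N y)))))

  iter-outside : ∀ {x} → ¬ V x → ∀ m → iter β m x ≡ x
  iter-outside ¬t zero = refl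
  iter-outside ¬t (suc m) = trans (cong β (iter-outside ¬t m)) (β-outside ¬t)

  iter-inside : ∀ {x} → V x → ∀ m → V (iter β m x) × rk (iter β m x) ≡ fold (rk x) (rotated N μ) m
  iter-inside tx zero = tx , refl
  iter-inside tx (suc m) = let (t , e) = iter-inside tx m ; (t′ , e′) = β-inside t in t′ , trans e′ (cong (rotated N μ) e)

  weakAscent-min : ∀ x → toℕ x ≤ toℕ (β x) → T (isCycleMin β x)
  weakAscent-min x x≤ = isCycleMin⁺ β λ m → case T? (lookup v x) of λ where
    (no ¬t) → ℕ.≤-reflexive (cong toℕ (sym (iter-outside ¬t m)))
    (yes t) → ℕ.≮⇒≥ λ lt → let (t′ , e′) = iter-inside t m in
      ℕ.<⇒≱ (rank-< v t′ lt) (subst (rk x ≤_) (sym e′)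
        (ascentMin (rank-<size v t) (subst (rk x ≤_) (proj₂ (β-inside t)) (rank-mono v x≤)) m))

  -- Along a trivial cycle the number of the run does not change. Its block, however, contains the
  -- end `q` of the joined run, and a block is a single orbit of α.
  noTrivialCycle : ¬ HasTrivialCycle (suc n) α
  noTrivialCycle (i , p , p<n , steps , closes) = irreflexive (crk<N i) (trans (sym crk-q) (orbit-rank q∈))
    where
    Orbit : Fin (suc n) → Set
    Orbit x = ∃[ t ] t ≤ p × x ≡ shift i t
    α-orbit : ∀ {x} → Orbit x → Orbit (α x)
    α-orbit (t , t≤p , refl) with ℕ.m≤n⇒m<n∨m≡n t≤p
    ... | inj₁ t<p = suc t , t<p , steps t t<p
    ... | inj₂ refl = 0 , z≤n , trans closes (sym (shift-zero i))
    iter-orbit : ∀ m {x} → Orbit x → Orbit (iter α m x)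
    iter-orbit zero o = o
    iter-orbit (suc m) o = α-orbit (iter-orbit m o)
    orbit-α : ∀ {x} → Orbit (α x) → Orbit x
    orbit-α (zero , _ , e) = p , ℕ.≤-refl , α-injective (trans e (trans (shift-zero i) (sym closes)))
    orbit-α (suc t , t<p , e) = t , ℕ.<⇒≤ t<p , α-injective (trans e (sym (steps t t<p)))
    orbit-iter : ∀ m {x} → Orbit (iter α m x) → Orbit x
    orbit-iter zero o = o
    orbit-iter (suc m) o = orbit-iter m (orbit-α o)
    crk-shift : ∀ t → t ≤ p → crk (shift i t) ≡ crk i
    crk-shift zero _ = cong crk (shift-zero i)
    crk-shift (suc t) t<p = trans (cong crk (sym (shift-suc i t))) (trans
      (cyclicRank-zeta-∉ v {shift i t} λ t∈ → isRunEnd⁻ {shift i t} (inside⇒runEnd t∈) (trans (steps t t<p) (sym (shift-suc i t))))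
      (crk-shift t (ℕ.<⇒≤ t<p)))
    orbit-rank : ∀ {x} → Orbit x → crk x ≡ crk i
    orbit-rank (t , t≤p , refl) = crk-shift t t≤p
    q = e₂ i
    crk-q : crk q ≡ μ (crk i)
    crk-q = crk-e₂ i
    q∈ : Orbit q
    q∈ = let (m , _ , e) = reach-min (suc n) i (ℕ.m≤n+m (suc n) (toℕ i))
             (m′ , _ , e′) = reach-min (suc n) q (ℕ.m≤n+m (suc n) (toℕ q))
             Fi∈ = subst Orbit e (iter-orbit m (0 , z≤n , sym (shift-zero i)))
         in orbit-iter m′ (subst Orbit (trans (joined⇒ (inj₂ crk-q)) (sym e′)) Fi∈)

  reducedGenus1 : ∀ {k} → N ≡ 2 * k → IsReducedGenus1 (suc n) k f
  reducedGenus1 {k} N≡ = isPartition , ℕ.*-cancelˡ-≡ (blocks f) k 2 (trans (sym N≡2*blocks) N≡) , noTrivialCycle ,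
    genus1⇐ (trans runEnds-size N≡2*blocks) weakAscent-min

-- Contracting the runs of a reduced partition of genus one

firstBelow : ∀ {P : ℕ → Set} → (∀ i → Dec (P i)) → ∀ m →
             (∃[ i ] i < m × P i × (∀ {j} → j < i → ¬ P j)) ⊎ (∀ {j} → j < m → ¬ P j)
firstBelow P? zero = inj₂ λ ()
firstBelow P? (suc m) with firstBelow P? m
... | inj₁ (i , i<m , Pi , below) = inj₁ (i , ℕ.m≤n⇒m≤1+n i<m , Pi , below)
... | inj₂ none with P? m
...   | yes Pm = inj₁ (m , ℕ.≤-refl , Pm , none)
...   | no ¬Pm = inj₂ λ j< Pj → case ℕ.m≤n⇒m<n∨m≡n (s≤s⁻¹ j<) of λ where
          (inj₁ j<m) → none j<m Pj
          (inj₂ refl) → ¬Pm Pj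

module Contraction {n : ℕ} (f : Vec (Fin (suc n)) (suc n)) (isPartition : IsPartition (suc n) f)
  (k : ℕ) (0<k : 0 < k) (blocks≡k : blocks f ≡ k)
  (¬trivial : ¬ HasTrivialCycle (suc n) (partPerm f)) (genus1 : HasGenus (suc n) (partPerm f) 1) where

  open Partition f isPartition

  abstract
    v : Vec Bool (suc n)
    v = Vec.tabulate isRunEnd

    lookup-v : ∀ x → lookup v x ≡ isRunEnd x
    lookup-v = Vec.lookup∘tabulate isRunEnd

    size-v : size v ≡ length (fins isRunEnd)
    size-v = size-tabulate isRunEnd id

  N : ℕ
  N = size v

  rk crk : Fin (suc n) → ℕ
  rk x = rank v (toℕ x)
  crk = cyclicRank v

  V : Fin (suc n) → Set
  V x = T (lookup v x)

  V⁺ : ∀ {x} → T (isRunEnd x) → V x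
  V⁺ {x} = subst T (sym (lookup-v x))

  V⁻ : ∀ {x} → V x → T (isRunEnd x)
  V⁻ {x} = subst T (lookup-v x)

  outside : ∀ {x} → ¬ V x → α x ≡ zeta x
  outside {x} ¬t = ¬isRunEnd {x} (¬t ∘ V⁺)

  Run : Fin (suc n) → ℕ → Set
  Run y p = p < suc n × V (shift y p) × (∀ {t} → t < p → ¬ V (shift y t))

  run-step : ∀ y t → ¬ V (shift y t) → α (shift y t) ≡ shift y (suc t)
  run-step y t ¬t = trans (outside ¬t) (shift-suc y t)

  -- If no run ended, α would follow ζ all the way round, a trivial cycle through all points.
  run : ∀ y → ∃[ p ] Run y p
  run y with firstBelow (λ t → T? (lookup v (shift y t))) (suc n)
  ... | inj₁ (p , p<n , t , below) = p , p<n , t , below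
  ... | inj₂ none = ⊥-elim (¬trivial (y , n , ℕ.≤-refl ,
          (λ t t<n → run-step y t (none (ℕ.m≤n⇒m≤1+n t<n))) , trans (run-step y n (none ℕ.≤-refl)) (shift-period y)))

  runEnd : Fin (suc n) → Fin (suc n)
  runEnd y = shift y (proj₁ (run y))

  runEnd-inside : ∀ y → V (runEnd y)
  runEnd-inside y = proj₁ (proj₂ (proj₂ (run y)))

  -- Applied to the block and to the cyclic rank, both constant along a run.
  run-invariant : ∀ {A : Set} (g : Fin (suc n) → A) → (∀ {x} → ¬ V x → g (zeta x) ≡ g x) → ∀ y → g (runEnd y) ≡ g y
  run-invariant g inv y = go (proj₁ (run y)) ℕ.≤-refl
    where
    go : ∀ t → t ≤ proj₁ (run y) → g (shift y t) ≡ g y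
    go zero _ = cong g (shift-zero y)
    go (suc t) t< = trans (cong g (sym (shift-suc y t)))
      (trans (inv (proj₂ (proj₂ (proj₂ (run y))) t<)) (go t (ℕ.<⇒≤ t<)))

  runEnd-block : ∀ y → F (runEnd y) ≡ F y
  runEnd-block = run-invariant F λ {x} ¬t → trans (cong F (sym (outside ¬t))) (α-block x)

  runEnd-rank : ∀ y → rk (runEnd y) ≡ crk y
  runEnd-rank y = trans (sym (cyclicRank-∈ v (runEnd-inside y))) (run-invariant crk (cyclicRank-zeta-∉ v) y)

  -- For a run end x, `α x` opens the next run of the block.
  other : Fin (suc n) → Fin (suc n)
  other x = runEnd (α x)

  other-block : ∀ x → F (other x) ≡ F x
  other-block x = trans (runEnd-block (α x)) (α-block x)

  -- Otherwise the run from `α x` to x would be a whole trivial cycle.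
  other-≢ : ∀ x → other x ≢ x
  other-≢ x e = let (p , p<n , _ , below) = run (α x) in
    ¬trivial (α x , p , p<n , (λ t t<p → run-step (α x) t (below t<p)) , cong α e)

  e₁ e₂ : Fin (suc n) → Fin (suc n)
  e₁ = runEnd
  e₂ = other ∘ runEnd

  e₂-block : ∀ x → F (e₂ x) ≡ F x
  e₂-block x = trans (other-block (runEnd x)) (runEnd-block x)

  pairs : List (Fin (suc n))
  pairs = map e₁ (fins isMin) ++ map e₂ (fins isMin)

  pairs-unique : Unique pairs
  pairs-unique = blockPair-unique runEnd-block e₂-block (λ x e → other-≢ (runEnd x) (sym e))

  pairs⊆ : ∀ {x} → x ∈ pairs → x ∈ fins isRunEnd
  pairs⊆ x∈ = case ∈-++⁻ (map e₁ (fins isMin)) x∈ of λ where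
    (inj₁ p) → case ∈-map⁻ e₁ p of λ where (y , _ , refl) → ∈-fins⁺ isRunEnd {e₁ y} (V⁻ (runEnd-inside y))
    (inj₂ p) → case ∈-map⁻ e₂ p of λ where (y , _ , refl) → ∈-fins⁺ isRunEnd {e₂ y} (V⁻ (runEnd-inside (α (runEnd y))))

  extremal : length (fins isRunEnd) ≡ 2 * blocks f × (∀ x → toℕ x ≤ toℕ (β x) → T (isCycleMin β x))
  extremal = genus1⇒ genus1 (subst (_≤ length (fins isRunEnd)) (blockPair-length e₁ e₂) (card-≤ pairs-unique pairs⊆))

  N≡2k : N ≡ 2 * k
  N≡2k = trans size-v (trans (proj₁ extremal) (cong (2 *_) blocks≡k))

  0<N : 0 < N
  0<N = subst (0 <_) (sym N≡2k) (lia 1 (λ k → # 0 :< k ⇒ # 0 :< 2 :* k) k 0<k)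

  ⊆pairs : ∀ {x} → V x → x ≡ e₁ (F x) ⊎ x ≡ e₂ (F x)
  ⊆pairs {x} t = case ∈-++⁻ (map e₁ (fins isMin)) x∈ of λ where
      (inj₁ p) → case ∈-map⁻ e₁ p of λ where
        (y , y∈ , e) → inj₁ (trans e (cong e₁ (min y∈ (trans (cong F e) (runEnd-block y)))))
      (inj₂ p) → case ∈-map⁻ e₂ p of λ where
        (y , y∈ , e) → inj₂ (trans e (cong e₂ (min y∈ (trans (cong F e) (e₂-block y)))))
    where
    x∈ : x ∈ pairs
    x∈ = card-⊇ pairs-unique pairs⊆ (ℕ.≤-reflexive (trans (proj₁ extremal) (sym (blockPair-length e₁ e₂))))
           (∈-fins⁺ isRunEnd {x} (V⁻ t))
    min : ∀ {y} → y ∈ fins isMin → F x ≡ F y → y ≡ F x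
    min {y} y∈ e = trans (sym (isMin⁻ {y} (∈-fins⁻ isMin y∈))) (sym e)

  -- A block has only two run ends, so two of x, y and `other x` agree, and x differs from
  -- `other x`.
  same-block : ∀ {x y} → V x → V y → F x ≡ F y → y ≡ x ⊎ y ≡ other x
  same-block {x} {y} tx ty e = pick (⊆pairs tx) (⊆pairs ty) (⊆pairs (runEnd-inside (α x)))
    where
    y⇒ : ∀ (g : Fin (suc n) → Fin (suc n)) → y ≡ g (F y) → y ≡ g (F x)
    y⇒ g h = trans h (cong g (sym e))
    o⇒ : ∀ (g : Fin (suc n) → Fin (suc n)) → other x ≡ g (F (other x)) → other x ≡ g (F x)
    o⇒ g h = trans h (cong g (other-block x))
    pick : x ≡ e₁ (F x) ⊎ x ≡ e₂ (F x) → y ≡ e₁ (F y) ⊎ y ≡ e₂ (F y) →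
           other x ≡ e₁ (F (other x)) ⊎ other x ≡ e₂ (F (other x)) → y ≡ x ⊎ y ≡ other x
    pick (inj₁ a) (inj₁ b) _ = inj₁ (trans (y⇒ e₁ b) (sym a))
    pick (inj₂ a) (inj₂ b) _ = inj₁ (trans (y⇒ e₂ b) (sym a))
    pick _ (inj₁ b) (inj₁ c) = inj₂ (trans (y⇒ e₁ b) (sym (o⇒ e₁ c)))
    pick _ (inj₂ b) (inj₂ c) = inj₂ (trans (y⇒ e₂ b) (sym (o⇒ e₂ c)))
    pick (inj₁ a) (inj₂ _) (inj₁ c) = ⊥-elim (other-≢ x (trans (o⇒ e₁ c) (sym a)))
    pick (inj₂ a) (inj₁ _) (inj₂ c) = ⊥-elim (other-≢ x (trans (o⇒ e₂ c) (sym a)))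

  other-involutive : ∀ {x} → V x → other (other x) ≡ x
  other-involutive {x} t = case same-block (runEnd-inside (α x)) t (other-block x) of λ where
    (inj₁ e) → ⊥-elim (other-≢ x (sym e))
    (inj₂ e) → sym e

  μ : ℕ → ℕ
  μ r with r <? N
  ... | yes r<N = rk (other (proj₁ (element v r<N)))
  -- An arbitrary value beyond the 2k points.
  ... | no _ = 0

  μ-rank : ∀ {x} → V x → μ (rk x) ≡ rk (other x)
  μ-rank {x} t with rk x <? N
  ... | yes r<N = let (_ , t′ , e) = element v r<N in cong (rk ∘ other) (rank-injective v t′ t e)
  ... | no r≮N = ⊥-elim (r≮N (rank-<size v t))

  -- α maps `β x` to ζ x, which opens the run after that of x; hence that run is joined to the run
  -- ending at `β x`.
  β-inside : ∀ {x} → V x → V (β x) × rk (β x) ≡ rotated N μ (rk x)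
  β-inside {x} tx = ty , trans (cong rk (sym (other-involutive ty))) (trans (sym (μ-rank (runEnd-inside (α y)))) (cong μ rank-other))
    where
    y = β x
    ty : V y
    ty = case T? (lookup v y) of λ where
      (yes t) → t
      (no ¬t) → ⊥-elim (¬t (subst V (zeta-injective (trans (sym (αβ x)) (outside ¬t))) tx))
    rank-other : rk (other y) ≡ wrap N (suc (rk x))
    rank-other = trans (runEnd-rank (α y)) (trans (cong crk (αβ x)) (cyclicRank-zeta-∈ v tx))

  iter-inside : ∀ {x} → V x → ∀ m → V (iter β m x) × rk (iter β m x) ≡ fold (rk x) (rotated N μ) m
  iter-inside tx zero = tx , refl
  iter-inside tx (suc m) = let (t , e) = iter-inside tx m ; (t′ , e′) = β-inside t in t′ , trans e′ (cong (rotated N μ) e)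

  iter-return : ∀ m x → ∃[ m′ ] iter β m′ (iter β m x) ≡ x
  iter-return zero x = 0 , refl
  iter-return (suc m) x =
    let (m′ , e) = iter-return m x
        (p , _ , e′) = period β-injective (iter β m x)
    in m′ + p , trans (iter-+ β m′ p _) (trans (cong (iter β m′) (trans (iter-suc β p _) e′)) e)

  private
    rank-≤⇒ : ∀ {x y} → V x → V y → rk x ≤ rk y → toℕ x ≤ toℕ y
    rank-≤⇒ tx ty le = ℕ.≮⇒≥ λ lt → ℕ.<⇒≱ (rank-< v ty lt) le

    ascent-min : ∀ {x} → V x → rk x ≤ rotated N μ (rk x) → ∀ m → toℕ x ≤ toℕ (iter β m x)
    ascent-min {x} t le = isCycleMin⁻∞ β-injective (proj₂ extremal x
      (rank-≤⇒ t (proj₁ (β-inside t)) (subst (rk x ≤_) (sym (proj₂ (β-inside t))) le)))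

  withRank : ∀ {Q : ℕ → Set} → (∀ {x} → V x → Q (rk x)) → ∀ {r} → r < N → Q r
  withRank {Q} H r<N = let (_ , t , e) = element v r<N in subst Q e (H t)

  chordDiagram : ChordDiagram N μ
  chordDiagram = record
    { bounded = withRank {λ r → μ r < N} λ {x} t → subst (_< N) (sym (μ-rank t)) (rank-<size v (runEnd-inside (α x)))
    ; involutive = withRank {λ r → μ (μ r) ≡ r} λ {x} t → trans (cong μ (μ-rank t)) (trans (μ-rank (runEnd-inside (α x))) (cong rk (other-involutive t)))
    ; irreflexive = withRank {λ r → μ r ≢ r} λ {x} t e → other-≢ x (rank-injective v (runEnd-inside (α x)) t (trans (sym (μ-rank t)) e))
    ; reduced = withRank {λ r → rotated N μ r ≢ r} λ {x} t e → isRunEnd⁻ {x} (V⁻ t) (subst (λ y → α y ≡ zeta x)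
        (rank-injective v (proj₁ (β-inside t)) t (trans (proj₂ (β-inside t)) e)) (αβ x))
    ; ascentMin = withRank {λ r → r ≤ rotated N μ r → ∀ m → r ≤ fold r (rotated N μ) m} λ {x} t le m →
        subst (rk x ≤_) (proj₂ (iter-inside t m)) (rank-mono v (ascent-min t le m))
    }

  -- Both ascents are minima of the same cycle of β; `iter-return` makes each an iterate of the
  -- other.
  uniqueAscent : ∀ {r} → r < N → r ≤ rotated N μ r → ∀ m →
    fold r (rotated N μ) m ≤ rotated N μ (fold r (rotated N μ) m) → fold r (rotated N μ) m ≡ r
  uniqueAscent = withRank {λ r → r ≤ rotated N μ r → ∀ m → fold r (rotated N μ) m ≤ rotated N μ (fold r (rotated N μ) m) → fold r (rotated N μ) m ≡ r}
    λ {x} t le m le′ →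
      let (t′ , e′) = iter-inside t m
          (m′ , back) = iter-return m x
      in trans (sym e′) (cong rk (Fin.toℕ-injective (ℕ.≤-antisym
           (subst (λ y → toℕ (iter β m x) ≤ toℕ y) back
             (ascent-min t′ (subst (λ r → r ≤ rotated N μ r) (sym e′) le′) m′))
           (ascent-min t le m))))

  realizes : Realizes f v μ
  realizes x y = mk⇔ to from
    where
    to : F x ≡ F y → Joined μ (crk x) (crk y)
    to e = case same-block (runEnd-inside x) (runEnd-inside y) (trans (runEnd-block x) (trans e (sym (runEnd-block y)))) of λ where
      (inj₁ h) → inj₁ (trans (sym (runEnd-rank y)) (trans (cong rk h) (runEnd-rank x)))
      (inj₂ h) → inj₂ (trans (sym (runEnd-rank y)) (trans (cong rk h)
        (trans (sym (μ-rank (runEnd-inside x))) (cong μ (runEnd-rank x)))))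
    from : Joined μ (crk x) (crk y) → F x ≡ F y
    from (inj₁ h) = trans (sym (runEnd-block x)) (trans (cong F (rank-injective v (runEnd-inside x) (runEnd-inside y)
      (trans (runEnd-rank x) (trans (sym h) (sym (runEnd-rank y)))))) (runEnd-block y))
    from (inj₂ h) = trans (sym (runEnd-block x)) (trans (sym (other-block (runEnd x))) (trans
      (cong F (rank-injective v (runEnd-inside (α (runEnd x))) (runEnd-inside y)
        (trans (sym (μ-rank (runEnd-inside x))) (trans (cong μ (runEnd-rank x)) (trans (sym h) (sym (runEnd-rank y)))))))
      (runEnd-block y)))

  parameters : ∃[ a ] ∃[ b ] ∃[ t ] a < b × b < t × t ≤ k × Shape k a b t μ
  parameters = Complete.parameters k 0<k μ (subst (λ m → ChordDiagram m μ) N≡2k chordDiagram)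
    (λ {r} → subst (λ m → r < m → r ≤ rotated m μ r → ∀ i → fold r (rotated m μ) i ≤ rotated m μ (fold r (rotated m μ) i) →
      fold r (rotated m μ) i ≡ r) N≡2k uniqueAscent)

-- Subsets and descending tuples, counted by binomial coefficients

length-cartesianProduct : ∀ {A B : Set} (xs : List A) (ys : List B) →
                          length (cartesianProduct xs ys) ≡ length xs * length ys
length-cartesianProduct [] ys = refl
length-cartesianProduct (x ∷ xs) ys = trans (length-++ (map (x ,_) ys))
  (cong₂ _+_ (length-map (x ,_) ys) (length-cartesianProduct xs ys))

subsets : ∀ n → ℕ → List (Vec Bool n)
subsets zero zero = [] ∷ []
subsets zero (suc m) = []
subsets (suc n) zero = map (false ∷_) (subsets n zero)
subsets (suc n) (suc m) = map (true ∷_) (subsets n m) ++ map (false ∷_) (subsets n (suc m))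

subsets-size : ∀ {n m} {v : Vec Bool n} → v ∈ subsets n m → size v ≡ m
subsets-size {zero} {zero} (here refl) = refl
subsets-size {suc n} {zero} v∈ with ∈-map⁻ (false ∷_) v∈
... | _ , u∈ , refl = subsets-size u∈
subsets-size {suc n} {suc m} v∈ with ∈-++⁻ (map (true ∷_) (subsets n m)) v∈
... | inj₁ p with ∈-map⁻ (true ∷_) p
...   | _ , u∈ , refl = cong suc (subsets-size u∈)
subsets-size {suc n} {suc m} v∈ | inj₂ p with ∈-map⁻ (false ∷_) p
...   | _ , u∈ , refl = subsets-size u∈

∈-subsets : ∀ {n} (v : Vec Bool n) → v ∈ subsets n (size v)
∈-subsets [] = here refl
∈-subsets (true ∷ v) = ∈-++⁺ˡ (∈-map⁺ (true ∷_) (∈-subsets v))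
∈-subsets {suc n} (false ∷ v) = into (∈-subsets v)
  where
  into : ∀ {m} → v ∈ subsets n m → false ∷ v ∈ subsets (suc n) m
  into {zero} p = ∈-map⁺ (false ∷_) p
  into {suc m} p = ∈-++⁺ʳ (map (true ∷_) (subsets n m)) (∈-map⁺ (false ∷_) p)

subsets-unique : ∀ n m → Unique (subsets n m)
subsets-unique zero zero = [] ∷ []
subsets-unique zero (suc m) = []
subsets-unique (suc n) zero = Unique.map⁺ Vec.∷-injectiveʳ (subsets-unique n zero)
subsets-unique (suc n) (suc m) = Unique.++⁺ (Unique.map⁺ Vec.∷-injectiveʳ (subsets-unique n m))
  (Unique.map⁺ Vec.∷-injectiveʳ (subsets-unique n (suc m)))
  λ (p , q) → case ∈-map⁻ (true ∷_) p , ∈-map⁻ (false ∷_) q of λ where ((_ , _ , refl) , (_ , _ , ()))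

subsets-length : ∀ n m → length (subsets n m) ≡ n C m
subsets-length zero zero = refl
subsets-length zero (suc m) = refl
subsets-length (suc n) zero = trans (length-map (false ∷_) (subsets n zero)) (subsets-length n zero)
subsets-length (suc n) (suc m) = trans (length-++ (map (true ∷_) (subsets n m)))
  (trans (cong₂ _+_ (trans (length-map (true ∷_) (subsets n m)) (subsets-length n m))
                    (trans (length-map (false ∷_) (subsets n (suc m))) (subsets-length n (suc m))))
    (nCk+nC[k+1]≡[n+1]C[k+1] n m))

Descending : ∀ {m} → ℕ → Vec ℕ m → Set
Descending n [] = ⊤
Descending n (x ∷ xs) = x < n × Descending x xs

descending : ℕ → ∀ m → List (Vec ℕ m)
descending n zero = [] ∷ []
descending zero (suc m) = []
descending (suc n) (suc m) = map (n ∷_) (descending n m) ++ descending n (suc m)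

descending⁻ : ∀ {n m} {v : Vec ℕ m} → v ∈ descending n m → Descending n v
descending⁻ {n} {zero} (here refl) = tt
descending⁻ {suc n} {suc m} v∈ with ∈-++⁻ (map (n ∷_) (descending n m)) v∈
... | inj₁ p with ∈-map⁻ (n ∷_) p
...   | _ , u∈ , refl = ℕ.≤-refl , descending⁻ u∈
descending⁻ {suc n} {suc m} {x ∷ xs} v∈ | inj₂ p = let (x<n , d) = descending⁻ {n} p in ℕ.m≤n⇒m≤1+n x<n , d

descending⁺ : ∀ {n m} {v : Vec ℕ m} → Descending n v → v ∈ descending n m
descending⁺ {n} {zero} {[]} _ = here refl
descending⁺ {suc n} {suc m} {x ∷ xs} (x< , d) with ℕ.m≤n⇒m<n∨m≡n (s≤s⁻¹ x<)
... | inj₁ x<n = ∈-++⁺ʳ (map (n ∷_) (descending n m)) (descending⁺ (x<n , d))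
... | inj₂ refl = ∈-++⁺ˡ (∈-map⁺ (n ∷_) (descending⁺ d))

descending-unique : ∀ n m → Unique (descending n m)
descending-unique n zero = [] ∷ []
descending-unique zero (suc m) = []
descending-unique (suc n) (suc m) = Unique.++⁺ (Unique.map⁺ Vec.∷-injectiveʳ (descending-unique n m))
  (descending-unique n (suc m))
  λ (p , q) → case ∈-map⁻ (n ∷_) p of λ where (_ , _ , refl) → ℕ.<-irrefl refl (proj₁ (descending⁻ {n} q))

descending-length : ∀ n m → length (descending n m) ≡ n C m
descending-length zero zero = refl
descending-length (suc n) zero = refl
descending-length zero (suc m) = refl
descending-length (suc n) (suc m) = trans (length-++ (map (n ∷_) (descending n m)))
  (trans (cong₂ _+_ (trans (length-map (n ∷_) (descending n m)) (descending-length n m)) (descending-length n (suc m)))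
    (nCk+nC[k+1]≡[n+1]C[k+1] n m))

-- Partitions as equivalence relations, and the partition of a coded diagram

partition-unique : ∀ {n} {f g : Vec (Fin n) n} → IsPartition n f → IsPartition n g →
                   (∀ x y → lookup f x ≡ lookup f y ⇔ lookup g x ≡ lookup g y) → f ≡ g
partition-unique {f = f} {g} pf pg same = trans (sym (Vec.tabulate∘lookup f))
  (trans (Vec.tabulate-cong λ x → Fin.toℕ-injective (ℕ.≤-antisym
      (below {f = f} pf (Equivalence.from (same _ _) (proj₂ (pg x))))
      (below {f = g} pg (Equivalence.to (same _ _) (proj₂ (pf x)))))) (Vec.tabulate∘lookup g))
  where
  below : ∀ {n} {f : Vec (Fin n) n} → IsPartition n f → ∀ {x y} → lookup f y ≡ lookup f x → toℕ (lookup f x) ≤ toℕ y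
  below pf {x} {y} e = subst (λ w → toℕ w ≤ toℕ y) e (proj₁ (pf y))

kernel : ∀ {n} → (Fin n → ℕ) → Vec (Fin n) n
kernel w = Vec.tabulate λ x → firstOr x (fins (λ y → w y ≡ᵇ w x))

module _ {n : ℕ} (w : Fin n → ℕ) where

  kernel-spec : ∀ x → w (lookup (kernel w) x) ≡ w x × (∀ {y} → w y ≡ w x → toℕ (lookup (kernel w) x) ≤ toℕ y)
  kernel-spec x = subst (λ r → w r ≡ w x × (∀ {y} → w y ≡ w x → toℕ r ≤ toℕ y))
    (sym (Vec.lookup∘tabulate (λ x → firstOr x (fins (λ y → w y ≡ᵇ w x))) x)) spec
    where
    spec : let r = firstOr x (fins (λ y → w y ≡ᵇ w x)) in w r ≡ w x × (∀ {y} → w y ≡ w x → toℕ r ≤ toℕ y)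
    spec with firstOr-spec (λ y → w y ≡ᵇ w x) x id
    ... | inj₁ (i , e , t , least) = trans (cong w e) (ℕ.≡ᵇ⇒≡ _ _ t) ,
            λ {y} h → subst (λ r → toℕ r ≤ toℕ y) (sym e) (least y (ℕ.≡⇒≡ᵇ _ _ h))
    ... | inj₂ (_ , none) = ⊥-elim (none x (ℕ.≡⇒≡ᵇ (w x) _ refl))

  kernel-⇔ : ∀ x y → lookup (kernel w) x ≡ lookup (kernel w) y ⇔ w x ≡ w y
  kernel-⇔ x y = mk⇔
    (λ e → trans (sym (proj₁ (kernel-spec x))) (trans (cong w e) (proj₁ (kernel-spec y))))
    (λ e → Fin.toℕ-injective (ℕ.≤-antisym
      (proj₂ (kernel-spec x) (trans (proj₁ (kernel-spec y)) (sym e)))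
      (proj₂ (kernel-spec y) (trans (proj₁ (kernel-spec x)) e))))

  kernel-isPartition : IsPartition n (kernel w)
  kernel-isPartition x = proj₂ (kernel-spec x) refl , Equivalence.from (kernel-⇔ _ _) (proj₁ (kernel-spec x))

module _ {N : ℕ} {μ : ℕ → ℕ} (D : ChordDiagram N μ) where
  open ChordDiagram D

  opener-⇔ : ∀ {r s} → r < N → s < N → r ⊓ μ r ≡ s ⊓ μ s ⇔ Joined μ r s
  opener-⇔ {r} {s} r<N s<N = mk⇔ to from
    where
    to : r ⊓ μ r ≡ s ⊓ μ s → Joined μ r s
    to e with ℕ.⊓-sel r (μ r) | ℕ.⊓-sel s (μ s)
    ... | inj₁ p | inj₁ q = inj₁ (trans (sym q) (trans (sym e) p))
    ... | inj₁ p | inj₂ q = inj₂ (trans (sym (involutive s<N)) (cong μ (trans (sym q) (trans (sym e) p))))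
    ... | inj₂ p | inj₁ q = inj₂ (trans (sym q) (trans (sym e) p))
    ... | inj₂ p | inj₂ q = inj₁ (trans (sym (involutive s<N)) (trans (cong μ (trans (sym q) (trans (sym e) p))) (involutive r<N)))
    from : Joined μ r s → r ⊓ μ r ≡ s ⊓ μ s
    from (inj₁ refl) = refl
    from (inj₂ refl) = trans (ℕ.⊓-comm r (μ r)) (cong (μ r ⊓_) (sym (involutive r<N)))

-- The label is the opening end of the chord at the run of x, so that equal labels mean joined runs
-- (`opener-⇔`).
chordLabel : ∀ {n} → Vec Bool n → (ℕ → ℕ) → Fin n → ℕ
chordLabel v μ x = cyclicRank v x ⊓ μ (cyclicRank v x)

unfold : ∀ {n} → Vec Bool n → (ℕ → ℕ) → Vec (Fin n) n
unfold v μ = kernel (chordLabel v μ)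

unfold-realizes : ∀ {n} (v : Vec Bool (suc n)) {μ} → 0 < size v → ChordDiagram (size v) μ → Realizes (unfold v μ) v μ
unfold-realizes v {μ} 0<N D x y = mk⇔ (Equivalence.to o ∘ Equivalence.to κ) (Equivalence.from κ ∘ Equivalence.from o)
  where
  κ = kernel-⇔ (chordLabel v μ) x y
  o = opener-⇔ D (cyclicRank-bound v 0<N x) (cyclicRank-bound v 0<N y)

realizes-unique : ∀ {n} {f g : Vec (Fin (suc n)) (suc n)} {v μ ν} → 0 < size v → IsPartition (suc n) f → IsPartition (suc n) g →
                  Realizes f v μ → Realizes g v ν → (∀ {r} → r < size v → μ r ≡ ν r) → f ≡ g
realizes-unique {v = v} {μ} {ν} 0<N pf pg Rf Rg μ≗ν = partition-unique pf pg λ x y → mk⇔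
  (Equivalence.from (Rg x y) ∘ transport {μ} {ν} (μ≗ν (cyclicRank-bound v 0<N x)) ∘ Equivalence.to (Rf x y))
  (Equivalence.from (Rf x y) ∘ transport {ν} {μ} (sym (μ≗ν (cyclicRank-bound v 0<N x))) ∘ Equivalence.to (Rg x y))
  where
  transport : ∀ {μ ν : ℕ → ℕ} {r s} → μ r ≡ ν r → Joined μ r s → Joined ν r s
  transport e (inj₁ h) = inj₁ h
  transport e (inj₂ h) = inj₂ (trans h e)

-- The bijection between codes and reduced partitions of genus one

module Enumeration (n k : ℕ) (0<k : 0 < k) where

  -- The set of run ends together with the triple in the order t, b, a: a descending vector below k
  -- + 1 is exactly a choice of a < b < t ≤ k.
  Code : Set
  Code = Vec Bool (suc n) × Vec ℕ 3

  diagram : Vec ℕ 3 → ℕ → ℕ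
  diagram (t ∷ b ∷ a ∷ []) = chord k a b t

  decode : Code → Vec (Fin (suc n)) (suc n)
  decode (v , τ) = unfold v (diagram τ)

  codes : List Code
  codes = cartesianProduct (subsets (suc n) (2 * k)) (descending (suc k) 3)

  codes⁻ : ∀ {v τ} → (v , τ) ∈ codes → size v ≡ 2 * k × Descending (suc k) τ
  codes⁻ c∈ = let (p , q) = ∈-cartesianProduct⁻ (subsets (suc n) (2 * k)) (descending (suc k) 3) c∈
              in subsets-size p , descending⁻ q

  diagram-shape : ∀ {a b t} → Descending (suc k) (t ∷ b ∷ a ∷ []) → Shape k a b t (chord k a b t)
  diagram-shape (t≤k , b<t , a<b , _) = chord-shape a<b b<t (s≤s⁻¹ t≤k)

  diagram-chords : ∀ {τ} → Descending (suc k) τ → ChordDiagram (2 * k) (diagram τ)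
  diagram-chords {t ∷ b ∷ a ∷ []} d@(t≤k , b<t , a<b , _) =
    ShapeProperties.chordDiagram a<b b<t (s≤s⁻¹ t≤k) (diagram-shape d)

  module Decoded {v τ} (c∈ : (v , τ) ∈ codes) where
    N≡ : size v ≡ 2 * k
    N≡ = proj₁ (codes⁻ c∈)

    0<N : 0 < size v
    0<N = subst (0 <_) (sym N≡) (lia 1 (λ k → # 0 :< k ⇒ # 0 :< 2 :* k) k 0<k)

    chords : ChordDiagram (size v) (diagram τ)
    chords = subst (λ m → ChordDiagram m (diagram τ)) (sym N≡) (diagram-chords (proj₂ (codes⁻ c∈)))

    isPartition : IsPartition (suc n) (decode (v , τ))
    isPartition = kernel-isPartition (chordLabel v (diagram τ))

    realizes : Realizes (decode (v , τ)) v (diagram τ)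
    realizes = unfold-realizes v 0<N chords

    open Realization (decode (v , τ)) isPartition v (diagram τ) 0<N chords realizes public

    runEnds≡ : Vec.tabulate (Partition.isRunEnd (decode (v , τ)) isPartition) ≡ v
    runEnds≡ = trans (Vec.tabulate-cong λ x → T-ext (runEnd⇒inside {x}) inside⇒runEnd) (Vec.tabulate∘lookup v)
      where
      T-ext : ∀ {b c} → (T b → T c) → (T c → T b) → b ≡ c
      T-ext {true} {true} _ _ = refl
      T-ext {false} {false} _ _ = refl
      T-ext {true} {false} h _ = ⊥-elim (h _)
      T-ext {false} {true} _ h = ⊥-elim (h _)

  sound : ∀ {c} → c ∈ codes → IsReducedGenus1 (suc n) k (decode c)
  sound c∈ = Decoded.reducedGenus1 c∈ (Decoded.N≡ c∈)

  runEnds-determined : ∀ {f g : Vec (Fin (suc n)) (suc n)} (pf : IsPartition (suc n) f) (pg : IsPartition (suc n) g) → f ≡ g →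
                       Vec.tabulate (Partition.isRunEnd f pf) ≡ Vec.tabulate (Partition.isRunEnd g pg)
  runEnds-determined pf pg refl = refl

  diagram-determined : ∀ {τ τ′} → Descending (suc k) τ → Descending (suc k) τ′ →
                       (∀ {r} → r < 2 * k → diagram τ r ≡ diagram τ′ r) → τ ≡ τ′
  diagram-determined {t ∷ b ∷ a ∷ []} {t′ ∷ b′ ∷ a′ ∷ []} d@(t≤k , b<t , a<b , _) d′@(t≤k′ , b<t′ , a<b′ , _) e
    = case shape-parameters a<b b<t (s≤s⁻¹ t≤k) a<b′ b<t′ (s≤s⁻¹ t≤k′) (diagram-shape d) (diagram-shape d′) e of
        λ where (refl , refl , refl) → refl

  -- The subset is recovered as the set of run ends. A chord is visible as two run ends in one
  -- block, so the diagrams agree, and with them the triples.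
  decode-injective : ∀ {c c′} → c ∈ codes → c′ ∈ codes → decode c ≡ decode c′ → c ≡ c′
  decode-injective {v , τ} {v′ , τ′} c∈ c∈′ e = same-subset c∈ c∈′ e
      (trans (sym (Decoded.runEnds≡ c∈)) (trans (runEnds-determined (Decoded.isPartition c∈) (Decoded.isPartition c∈′) e) (Decoded.runEnds≡ c∈′)))
    where
    same-subset : ∀ {v τ v′ τ′} → (v , τ) ∈ codes → (v′ , τ′) ∈ codes → decode (v , τ) ≡ decode (v′ , τ′) →
                  v ≡ v′ → (v , τ) ≡ (v′ , τ′)
    same-subset {v} {τ} {_} {τ′} c∈ c∈′ e refl =
        cong (v ,_) (diagram-determined (proj₂ (codes⁻ c∈)) (proj₂ (codes⁻ c∈′)) λ {r} r<N → agree (subst (r <_) (sym D.N≡) r<N))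
      where
      module D = Decoded c∈
      open ChordDiagram D.chords
      agree : ∀ {r} → r < size v → diagram τ r ≡ diagram τ′ r
      agree {r} r<N =
        let (x , tx , ex) = element v r<N
            (y , ty , ey) = element v (bounded r<N)
            crk-x = trans (cyclicRank-∈ v {x} tx) ex
            crk-y = trans (cyclicRank-∈ v {y} ty) ey
            same = Equivalence.from (D.realizes x y) (inj₂ (trans crk-y (cong (diagram τ) (sym crk-x))))
        in case Equivalence.to (Decoded.realizes c∈′ x y) (subst (λ f → lookup f x ≡ lookup f y) e same) of λ where
          (inj₁ h) → ⊥-elim (irreflexive r<N (trans (sym crk-y) (trans h crk-x)))
          (inj₂ h) → trans (sym crk-y) (trans h (cong (diagram τ′) crk-x))

  realized∈ : ∀ {f v μ} → IsPartition (suc n) f → size v ≡ 2 * k → Realizes f v μ →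
              (∃[ a ] ∃[ b ] ∃[ t ] a < b × b < t × t ≤ k × Shape k a b t μ) → f ∈ map decode codes
  realized∈ {f} {v} {μ} pf N≡ R (a , b , t , a<b , b<t , t≤k , S) = subst (_∈ map decode codes)
      (sym (realizes-unique {v = v} {μ} (Decoded.0<N c∈) pf (Decoded.isPartition c∈) R (Decoded.realizes c∈)
        λ {r} r<N → shape-unique a<b b<t t≤k S (diagram-shape d) (subst (r <_) N≡ r<N)))
      (∈-map⁺ decode c∈)
    where
    d : Descending (suc k) (t ∷ b ∷ a ∷ [])
    d = s≤s t≤k , b<t , a<b , tt
    c∈ : (v , t ∷ b ∷ a ∷ []) ∈ codes
    c∈ = ∈-cartesianProduct⁺ (subst (λ m → v ∈ subsets (suc n) m) N≡ (∈-subsets v)) (descending⁺ d)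

  complete : ∀ {f} → IsReducedGenus1 (suc n) k f → f ∈ map decode codes
  complete {f} (pf , blocks≡k , ¬trivial , genus1) = realized∈ {v = C.v} {C.μ} pf C.N≡2k C.realizes C.parameters
    where module C = Contraction f pf k 0<k blocks≡k ¬trivial genus1

  hasCard : HasCard (IsReducedGenus1 (suc n) k) ((suc n C (2 * k)) * (suc k C 3))
  hasCard = map decode codes ,
    map-unique (Unique.cartesianProduct⁺ (subsets-unique (suc n) (2 * k)) (descending-unique (suc k) 3)) decode-injective ,
    (λ f → mk⇔ (λ f∈ → case ∈-map⁻ decode f∈ of λ where (c , c∈ , refl) → sound c∈) complete) ,
    trans (length-map decode codes) (trans (length-cartesianProduct (subsets (suc n) (2 * k)) (descending (suc k) 3))
      (cong₂ _*_ (subsets-length (suc n) (2 * k)) (descending-length (suc k) 3)))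

-- The generating function

module PowerSeries (R : CommutativeRing 0ℓ 0ℓ) where

  open CommutativeRing R using (Carrier; _≈_; setoid; 0#; 1#; isEquivalence; +-isAbelianGroup) renaming (_+_ to _⊞_; _*_ to _⊠_)
  module R = CommutativeRing R
  open SetoidReasoning setoid

  _≋_ : (ℕ → Carrier) → (ℕ → Carrier) → Set
  F ≋ G = ∀ n → F n ≈ G n

  -- Recursion on the first factor, F = F 0 + x (F ∘ suc).
  _⋆_ : (ℕ → Carrier) → (ℕ → Carrier) → ℕ → Carrier
  (F ⋆ G) zero = F 0 ⊠ G 0
  (F ⋆ G) (suc n) = (F 0 ⊠ G (suc n)) ⊞ ((F ∘ suc) ⋆ G) n

  one : ℕ → Carrier
  one zero = 1#
  one (suc _) = 0#

  ⋆-cong : ∀ {F F′ G G′} → F ≋ F′ → G ≋ G′ → (F ⋆ G) ≋ (F′ ⋆ G′)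
  ⋆-cong p q zero = R.*-cong (p 0) (q 0)
  ⋆-cong p q (suc n) = R.+-cong (R.*-cong (p 0) (q (suc n))) (⋆-cong (p ∘ suc) q n)

  -- The recursion from the other end of the sum; commutativity exchanges it with the defining one.
  ⋆-last : ∀ F G n → (F ⋆ G) (suc n) ≈ ((F ⋆ (G ∘ suc)) n ⊞ (F (suc n) ⊠ G 0))
  ⋆-last F G zero = R.refl
  ⋆-last F G (suc n) = R.trans (R.+-cong R.refl (⋆-last (F ∘ suc) G n)) (R.sym (R.+-assoc _ _ _))

  ⋆-comm : ∀ F G → (F ⋆ G) ≋ (G ⋆ F)
  ⋆-comm F G zero = R.*-comm _ _
  ⋆-comm F G (suc n) = begin
    (F 0 ⊠ G (suc n)) ⊞ ((F ∘ suc) ⋆ G) n ≈⟨ R.+-cong (R.*-comm _ _) (⋆-comm (F ∘ suc) G n) ⟩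
    (G (suc n) ⊠ F 0) ⊞ (G ⋆ (F ∘ suc)) n ≈⟨ R.+-comm _ _ ⟩
    (G ⋆ (F ∘ suc)) n ⊞ (G (suc n) ⊠ F 0) ≈⟨ R.sym (⋆-last G F n) ⟩
    (G ⋆ F) (suc n) ∎

  ⊞-interchange : ∀ a b c d → ((a ⊞ b) ⊞ (c ⊞ d)) ≈ ((a ⊞ c) ⊞ (b ⊞ d))
  ⊞-interchange a b c d = begin
    (a ⊞ b) ⊞ (c ⊞ d) ≈⟨ R.+-assoc _ _ _ ⟩
    a ⊞ (b ⊞ (c ⊞ d)) ≈⟨ R.+-cong R.refl (R.sym (R.+-assoc _ _ _)) ⟩
    a ⊞ ((b ⊞ c) ⊞ d) ≈⟨ R.+-cong R.refl (R.+-cong (R.+-comm _ _) R.refl) ⟩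
    a ⊞ ((c ⊞ b) ⊞ d) ≈⟨ R.+-cong R.refl (R.+-assoc _ _ _) ⟩
    a ⊞ (c ⊞ (b ⊞ d)) ≈⟨ R.sym (R.+-assoc _ _ _) ⟩
    (a ⊞ c) ⊞ (b ⊞ d) ∎

  ⋆-distribʳ : ∀ H F G → ((λ n → F n ⊞ G n) ⋆ H) ≋ (λ n → (F ⋆ H) n ⊞ (G ⋆ H) n)
  ⋆-distribʳ H F G zero = R.distribʳ _ _ _
  ⋆-distribʳ H F G (suc n) =
    R.trans (R.+-cong (R.distribʳ _ _ _) (⋆-distribʳ H (F ∘ suc) (G ∘ suc) n)) (⊞-interchange _ _ _ _)

  ⋆-scale : ∀ a F G → ((λ n → a ⊠ F n) ⋆ G) ≋ (λ n → a ⊠ (F ⋆ G) n)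
  ⋆-scale a F G zero = R.*-assoc _ _ _
  ⋆-scale a F G (suc n) = R.trans (R.+-cong (R.*-assoc _ _ _) (⋆-scale a (F ∘ suc) G n)) (R.sym (R.distribˡ _ _ _))

  ⋆-assoc : ∀ F G H → ((F ⋆ G) ⋆ H) ≋ (F ⋆ (G ⋆ H))
  ⋆-assoc F G H zero = R.*-assoc _ _ _
  ⋆-assoc F G H (suc n) = begin
    ((F 0 ⊠ G 0) ⊠ H (suc n)) ⊞ ((λ m → (F 0 ⊠ G (suc m)) ⊞ ((F ∘ suc) ⋆ G) m) ⋆ H) n
      ≈⟨ R.+-cong (R.*-assoc _ _ _) (⋆-distribʳ H (λ m → F 0 ⊠ G (suc m)) ((F ∘ suc) ⋆ G) n) ⟩
    (F 0 ⊠ (G 0 ⊠ H (suc n))) ⊞ (((λ m → F 0 ⊠ G (suc m)) ⋆ H) n ⊞ (((F ∘ suc) ⋆ G) ⋆ H) n)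
      ≈⟨ R.sym (R.+-assoc _ _ _) ⟩
    ((F 0 ⊠ (G 0 ⊠ H (suc n))) ⊞ ((λ m → F 0 ⊠ G (suc m)) ⋆ H) n) ⊞ (((F ∘ suc) ⋆ G) ⋆ H) n
      ≈⟨ R.+-cong (R.trans (R.+-cong R.refl (⋆-scale (F 0) (G ∘ suc) H n)) (R.sym (R.distribˡ _ _ _))) (⋆-assoc (F ∘ suc) G H n) ⟩
    (F ⋆ (G ⋆ H)) (suc n) ∎

  ⋆-zeroˡ : ∀ {F} G → F ≋ (λ _ → 0#) → (F ⋆ G) ≋ (λ _ → 0#)
  ⋆-zeroˡ G z zero = R.trans (R.*-cong (z 0) R.refl) (R.zeroˡ _)
  ⋆-zeroˡ G z (suc n) = R.trans (R.+-cong (R.trans (R.*-cong (z 0) R.refl) (R.zeroˡ _)) (⋆-zeroˡ G (z ∘ suc) n)) (R.+-identityˡ _)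

  ⋆-constˡ : ∀ F G → (F ∘ suc) ≋ (λ _ → 0#) → (F ⋆ G) ≋ (λ n → F 0 ⊠ G n)
  ⋆-constˡ F G z zero = R.refl
  ⋆-constˡ F G z (suc n) = R.trans (R.+-cong R.refl (⋆-zeroˡ G z n)) (R.+-identityʳ _)

  ⋆-identityˡ : ∀ F → (one ⋆ F) ≋ F
  ⋆-identityˡ F n = R.trans (⋆-constˡ one F (λ _ → R.refl) n) (R.*-identityˡ _)

  commutativeRing : CommutativeRing 0ℓ 0ℓ
  commutativeRing = record
    { Carrier = ℕ → Carrier ; _≈_ = _≋_ ; _+_ = λ F G n → F n ⊞ G n ; _*_ = _⋆_ ; -_ = λ F n → R.- (F n)
    ; 0# = λ _ → 0# ; 1# = one
    ; isCommutativeRing = record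
      { isRing = record
        { +-isAbelianGroup = Pointwise.isAbelianGroup ℕ +-isAbelianGroup
        ; *-cong = ⋆-cong
        ; *-assoc = ⋆-assoc
        ; *-identity = ⋆-identityˡ , λ F n → R.trans (⋆-comm F one n) (⋆-identityˡ F n)
        ; distrib = (λ F G H n → R.trans (⋆-comm F _ n) (R.trans (⋆-distribʳ F G H n) (R.+-cong (⋆-comm G F n) (⋆-comm H F n))))
                  , ⋆-distribʳ
        }
      ; *-comm = ⋆-comm
      }
    }

-- Series in x with coefficients in series in y. The carrier of the ring from `X` is literally
-- `Series`, and only the products have to be compared.
module Y = PowerSeries ℤ.+-*-commutativeRing
module X = PowerSeries Y.commutativeRing

open CommutativeRing X.commutativeRing using () renaming
  (_≈_ to _≋_; _+_ to _⊞_; _*_ to _⊠_; -_ to ⊟_; setoid to series; commutativeSemiring to seriesSemiring)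
module S = CommutativeRing X.commutativeRing

sumTo-suc : ∀ n h → sumTo (suc n) h ≡ h 0 ℤ.+ sumTo n (h ∘ suc)
sumTo-suc zero h = refl
sumTo-suc (suc n) h = trans (cong (ℤ._+ h (suc (suc n))) (sumTo-suc n h)) (ℤ.+-assoc (h 0) _ _)

sumTo-cong : ∀ n {h h′} → (∀ i → h i ≡ h′ i) → sumTo n h ≡ sumTo n h′
sumTo-cong zero e = e 0
sumTo-cong (suc n) e = cong₂ ℤ._+_ (sumTo-cong n e) (e (suc n))

sumTo-⋆ : ∀ f g k → sumTo k (λ b → f b ℤ.* g (k ∸ b)) ≡ (f Y.⋆ g) k
sumTo-⋆ f g zero = refl
sumTo-⋆ f g (suc k) = trans (sumTo-suc k _) (cong (λ w → f 0 ℤ.* g (suc k) ℤ.+ w) (sumTo-⋆ (f ∘ suc) g k))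

⊗-⋆ : ∀ F G → (F ⊗ G) ≋ (F ⊠ G)
⊗-⋆ F G n k = trans (sumTo-cong n λ a → sumTo-⋆ (F a) (G (n ∸ a)) k) (outer F n)
  where
  outer : ∀ F n → sumTo n (λ a → (F a Y.⋆ G (n ∸ a)) k) ≡ (F ⊠ G) n k
  outer F zero = refl
  outer F (suc n) = trans (sumTo-suc n _) (cong (λ w → (F 0 Y.⋆ G (suc n)) k ℤ.+ w) (outer (F ∘ suc) n))

power : Series → ℕ → Series
power F zero = X.one
power F (suc m) = F ⊠ power F m

oneS≋ : oneS ≋ X.one
oneS≋ zero zero = refl
oneS≋ zero (suc k) = refl
oneS≋ (suc n) k = refl

powS≋ : ∀ {F F′} → F ≋ F′ → ∀ m → powS F m ≋ power F′ m
powS≋ e zero = oneS≋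
powS≋ {F} {F′} e (suc m) = S.trans {powS F (suc m)} {F ⊠ powS F m} {power F′ (suc m)} (⊗-⋆ F (powS F m))
  (S.*-cong {F} {F′} {powS F m} {power F′ m} e (powS≋ e m))

shiftX shiftY : Series → Series
shiftX F zero k = pos 0
shiftX F (suc n) k = F n k
shiftY F n zero = pos 0
shiftY F n (suc k) = F n k

xS-shift : ∀ F → (xS ⊠ F) ≋ shiftX F
xS-shift F zero k = Y.⋆-zeroˡ (F 0) (λ _ → refl) k
xS-shift F (suc n) k = trans (cong₂ ℤ._+_ (Y.⋆-zeroˡ (F (suc n)) (λ _ → refl) k)
    (trans (S.*-cong {xS ∘ suc} {X.one} {F} {F} tail (λ _ _ → refl) n k) (X.⋆-identityˡ F n k))) (ℤ.+-identityˡ _)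
  where
  tail : (xS ∘ suc) ≋ X.one
  tail zero zero = refl
  tail zero (suc k) = refl
  tail (suc n) k = refl

yS-shift : ∀ F → (yS ⊠ F) ≋ shiftY F
yS-shift F n k = trans (X.⋆-constˡ yS F (λ _ _ → refl) n k) (shifted k)
  where
  tail : (yS 0 ∘ suc) Y.≋ Y.one
  tail zero = refl
  tail (suc k) = refl
  shifted : ∀ k → (yS 0 Y.⋆ F n) k ≡ shiftY F n k
  shifted zero = ℤ.*-zeroˡ (F n 0)
  shifted (suc k) = trans (cong₂ ℤ._+_ (ℤ.*-zeroˡ (F n (suc k))) (trans (Y.⋆-cong {F′ = Y.one} {G = F n} tail (λ _ → refl) k) (Y.⋆-identityˡ (F n) k)))
    (ℤ.+-identityˡ _)

-- The recurrence for the series weighted by C(n,2k)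

weighted : (ℕ → ℕ) → Series
weighted c n k = pos ((n C (2 * k)) * c k)

2*suc : ∀ k → 2 * suc k ≡ suc (suc (2 * k))
2*suc k = ℕ.*-suc 2 k

-- The series c (1 - x): the part with k = 0 is c times the sum of all xⁿ, which (1 - x)² turns into
-- this.
boundary : ℕ → Series
boundary c zero zero = pos c
boundary c (suc zero) zero = ℤ.- pos c
boundary c _ _ = pos 0

-- The recurrence (1 - x)² Σ_n C(n,2k) xⁿ = x² Σ_n C(n,2k-2) xⁿ, cleared of subtractions.
weighted-pointwise : ∀ c Δ → (∀ k → Δ k + c k ≡ c (suc k)) → ∀ n k →
  let P = weighted c ; xP = shiftX P ; xxP = shiftX xP in
  P n k ℤ.+ xxP n k ≡ ((xP n k ℤ.+ xP n k) ℤ.+ (shiftY xxP n k ℤ.+ shiftX (shiftX (shiftY (weighted Δ))) n k)) ℤ.+ boundary (c 0) n k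
weighted-pointwise c Δ step zero zero = cong pos (lia 1 (λ c → (c :+ # 0) :+ # 0 :≡ c) (c 0))
weighted-pointwise c Δ step (suc zero) zero rewrite ℕ.+-identityʳ (c 0) = sym (trans (cong (ℤ._+ (ℤ.- a)) (ℤ.+-identityʳ (a ℤ.+ a)))
  (trans (ℤ.+-assoc a a (ℤ.- a)) (cong (λ w → a ℤ.+ w) (ℤ.+-inverseʳ a))))
  where a = pos (c 0)
weighted-pointwise c Δ step (suc (suc n)) zero = cong pos (lia 1 (λ c → (c :+ # 0) :+ (c :+ # 0) :≡ ((c :+ # 0) :+ (c :+ # 0) :+ # 0) :+ # 0) (c 0))
weighted-pointwise c Δ step zero (suc k) = refl
weighted-pointwise c Δ step (suc zero) (suc k) = cong (λ b → pos (b * c (suc k) + 0)) (cong (1 C_) (2*suc k))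
weighted-pointwise c Δ step (suc (suc n)) (suc k) = cong pos identity
  where
  u = n C (2 * k)
  w = n C suc (2 * k)
  v = n C (2 * suc k)
  d = c (suc k)
  pascal : ∀ n → suc n C (2 * suc k) ≡ n C suc (2 * k) + n C (2 * suc k)
  pascal n = trans (cong (suc n C_) (2*suc k)) (trans (sym (nCk+nC[k+1]≡[n+1]C[k+1] n (suc (2 * k))))
    (cong (λ q → n C suc (2 * k) + n C q) (sym (2*suc k))))
  C₁ : suc n C (2 * suc k) ≡ w + v
  C₁ = pascal n
  C₂ : suc (suc n) C (2 * suc k) ≡ (u + w) + (w + v)
  C₂ = trans (pascal (suc n)) (cong₂ _+_ (sym (nCk+nC[k+1]≡[n+1]C[k+1] n (2 * k))) C₁)
  C₁* : (suc n C (2 * suc k)) * d ≡ w * d + v * d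
  C₁* = trans (cong (_* d) C₁) (ℕ.*-distribʳ-+ d w v)
  C₂* : (suc (suc n) C (2 * suc k)) * d ≡ (u * d + w * d) + (w * d + v * d)
  C₂* = trans (cong (_* d) C₂) (trans (ℕ.*-distribʳ-+ d (u + w) (w + v)) (cong₂ _+_ (ℕ.*-distribʳ-+ d u w) (ℕ.*-distribʳ-+ d w v)))
  u* : u * d ≡ u * Δ k + u * c k
  u* = trans (cong (u *_) (sym (step k))) (ℕ.*-distribˡ-+ u (Δ k) (c k))
  identity : (suc (suc n) C (2 * suc k)) * d + v * d ≡
             (((suc n C (2 * suc k)) * d + (suc n C (2 * suc k)) * d) + (u * c k + u * Δ k)) + 0
  identity = lia 7 (λ A B ud wd vd uc uΔ → A :≡ (ud :+ wd) :+ (wd :+ vd) ⇒ B :≡ wd :+ vd ⇒ ud :≡ uΔ :+ uc ⇒ A :+ vd :≡ ((B :+ B) :+ (uc :+ uΔ)) :+ # 0)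
    ((suc (suc n) C (2 * suc k)) * d) ((suc n C (2 * suc k)) * d) (u * d) (w * d) (v * d) (u * c k) (u * Δ k) C₂* C₁* u*

shiftX-cong : ∀ {F G} → F ≋ G → shiftX F ≋ shiftX G
shiftX-cong e zero k = refl
shiftX-cong e (suc n) k = e n k

shiftY-cong : ∀ {F G} → F ≋ G → shiftY F ≋ shiftY G
shiftY-cong e n zero = refl
shiftY-cong e n (suc k) = e n k

x∙ y∙ : Series → Series
x∙ = xS ⊠_
y∙ = yS ⊠_

xx-shift : ∀ F → x∙ (x∙ F) ≋ shiftX (shiftX F)
xx-shift F n k = trans (xS-shift (x∙ F) n k) (shiftX-cong {x∙ F} {shiftX F} (xS-shift F) n k)

weighted-recurrence : ∀ c Δ → (∀ k → Δ k + c k ≡ c (suc k)) → let P = weighted c in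
  (P ⊞ x∙ (x∙ P)) ≋ (((x∙ P ⊞ x∙ P) ⊞ (y∙ (x∙ (x∙ P)) ⊞ x∙ (x∙ (y∙ (weighted Δ))))) ⊞ boundary (c 0))
weighted-recurrence c Δ step n k = trans (cong (λ w → P n k ℤ.+ w) (xx-shift P n k)) (trans (weighted-pointwise c Δ step n k)
    (sym (cong (λ w → w ℤ.+ boundary (c 0) n k) (cong₂ ℤ._+_ (cong₂ ℤ._+_ (xS-shift P n k) (xS-shift P n k)) (cong₂ ℤ._+_
      (trans (yS-shift (x∙ (x∙ P)) n k) (shiftY-cong {x∙ (x∙ P)} {shiftX (shiftX P)} (xx-shift P) n k))
      (trans (xx-shift (y∙ Q) n k) (shiftX-cong {shiftX (y∙ Q)} {shiftX (shiftY Q)} (shiftX-cong {y∙ Q} {shiftY Q} (yS-shift Q)) n k)))))))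
  where
  P = weighted c
  Q = weighted Δ

-- Clearing the denominator in an arbitrary commutative ring

module Denominator (R : CommutativeRing 0ℓ 0ℓ) where

  open CommutativeRing R hiding (refl; sym; trans) renaming (_+_ to _⊕_; _*_ to _⊛_)
  private module R = CommutativeRing R
  open SetoidReasoning setoid
  open RingSolver commutativeSemiring using (solve; _:=_; con) renaming (_:+_ to _⊕ᵖ_; _:*_ to _⊛ᵖ_)
  open import Algebra.Properties.Ring R.ring using (-‿distribˡ-*; -‿distribʳ-*)
  open import Algebra.Properties.Group R.+-group using (⁻¹-involutive)

  module _ (x y : Carrier) where

    u m D : Carrier
    u = 1# ⊕ - x
    m = x ⊛ (x ⊛ y)
    D = (u ⊛ (u ⊛ 1#)) ⊕ - (y ⊛ (x ⊛ (x ⊛ 1#)))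

    -x*-x : - x ⊛ - x ≈ x ⊛ x
    -x*-x = R.trans (R.sym (-‿distribˡ-* x (- x))) (R.trans (-‿cong (R.sym (-‿distribʳ-* x x))) (⁻¹-involutive (x ⊛ x)))

    -- The solver works in semirings, so - x and - (y x²) are atoms for it. They are cancelled by
    -- hand, after D has been expanded and the hypothesis substituted.
    eliminate-D : ∀ {P Q T} → P ⊕ x ⊛ (x ⊛ P) ≈ ((x ⊛ P ⊕ x ⊛ P) ⊕ (y ⊛ (x ⊛ (x ⊛ P)) ⊕ x ⊛ (x ⊛ (y ⊛ Q)))) ⊕ T →
                D ⊛ P ≈ m ⊛ Q ⊕ T
    eliminate-D {P} {Q} {T} e = begin
      D ⊛ P
        ≈⟨ solve 3 (λ x⁻ z P → ((con 1 ⊕ᵖ x⁻) ⊛ᵖ ((con 1 ⊕ᵖ x⁻) ⊛ᵖ con 1) ⊕ᵖ z) ⊛ᵖ P := (P ⊕ᵖ (x⁻ ⊛ᵖ x⁻) ⊛ᵖ P) ⊕ᵖ (x⁻ ⊛ᵖ P ⊕ᵖ x⁻ ⊛ᵖ P ⊕ᵖ z ⊛ᵖ P)) R.refl (- x) q P ⟩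
      (P ⊕ (- x ⊛ - x) ⊛ P) ⊕ (- x ⊛ P ⊕ - x ⊛ P ⊕ q ⊛ P)
        ≈⟨ +-congʳ (+-congˡ (R.trans (*-congʳ -x*-x) (*-assoc x x P))) ⟩
      (P ⊕ x ⊛ (x ⊛ P)) ⊕ (- x ⊛ P ⊕ - x ⊛ P ⊕ q ⊛ P)
        ≈⟨ +-congʳ e ⟩
      (((x ⊛ P ⊕ x ⊛ P) ⊕ (y ⊛ (x ⊛ (x ⊛ P)) ⊕ x ⊛ (x ⊛ (y ⊛ Q)))) ⊕ T) ⊕ (- x ⊛ P ⊕ - x ⊛ P ⊕ q ⊛ P)
        ≈⟨ solve 7 (λ x y x⁻ z P Q T → (((x ⊛ᵖ P ⊕ᵖ x ⊛ᵖ P) ⊕ᵖ (y ⊛ᵖ (x ⊛ᵖ (x ⊛ᵖ P)) ⊕ᵖ x ⊛ᵖ (x ⊛ᵖ (y ⊛ᵖ Q)))) ⊕ᵖ T) ⊕ᵖ (x⁻ ⊛ᵖ P ⊕ᵖ x⁻ ⊛ᵖ P ⊕ᵖ z ⊛ᵖ P)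
              := ((x ⊕ᵖ x⁻) ⊛ᵖ (P ⊕ᵖ P) ⊕ᵖ (y ⊛ᵖ (x ⊛ᵖ (x ⊛ᵖ con 1)) ⊕ᵖ z) ⊛ᵖ P) ⊕ᵖ ((x ⊛ᵖ (x ⊛ᵖ y)) ⊛ᵖ Q ⊕ᵖ T)) R.refl x y (- x) q P Q T ⟩
      ((x ⊕ - x) ⊛ (P ⊕ P) ⊕ (y ⊛ (x ⊛ (x ⊛ 1#)) ⊕ q) ⊛ P) ⊕ (m ⊛ Q ⊕ T)
        ≈⟨ +-congʳ (+-cong (R.trans (*-congʳ (-‿inverseʳ x)) (zeroˡ _)) (R.trans (*-congʳ (-‿inverseʳ _)) (zeroˡ P))) ⟩
      (0# ⊕ 0#) ⊕ (m ⊛ Q ⊕ T)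
        ≈⟨ R.trans (+-congʳ (+-identityˡ 0#)) (+-identityˡ _) ⟩
      m ⊛ Q ⊕ T ∎
      where q = - (y ⊛ (x ⊛ (x ⊛ 1#)))

    m⊕D : m ⊕ D ≈ u ⊛ (u ⊛ 1#)
    m⊕D = begin
      m ⊕ D
        ≈⟨ solve 4 (λ x y w z → x ⊛ᵖ (x ⊛ᵖ y) ⊕ᵖ (w ⊕ᵖ z) := w ⊕ᵖ (y ⊛ᵖ (x ⊛ᵖ (x ⊛ᵖ con 1)) ⊕ᵖ z)) R.refl x y (u ⊛ (u ⊛ 1#)) (- (y ⊛ (x ⊛ (x ⊛ 1#)))) ⟩
      (u ⊛ (u ⊛ 1#)) ⊕ (y ⊛ (x ⊛ (x ⊛ 1#)) ⊕ - (y ⊛ (x ⊛ (x ⊛ 1#))))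
        ≈⟨ R.trans (+-congˡ (-‿inverseʳ _)) (+-identityʳ _) ⟩
      u ⊛ (u ⊛ 1#) ∎

    -- With m = x² y, D⁴ P₃ = m² D (m P₀ + u) = m² (m u + D u), and m + D = u² leaves m² u³.
    clear-denominator : ∀ {P₀ P₁ P₂ P₃} → D ⊛ P₃ ≈ m ⊛ P₂ → D ⊛ P₂ ≈ m ⊛ P₁ → D ⊛ P₁ ≈ m ⊛ P₀ ⊕ u → D ⊛ P₀ ≈ u →
      P₃ ⊛ (D ⊛ (D ⊛ (D ⊛ (D ⊛ 1#)))) ≈ (y ⊛ (y ⊛ 1#)) ⊛ ((x ⊛ (x ⊛ (x ⊛ (x ⊛ 1#)))) ⊛ (u ⊛ (u ⊛ (u ⊛ 1#))))
    clear-denominator {P₀} {P₁} {P₂} {P₃} e₃ e₂ e₁ e₀ = begin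
      P₃ ⊛ (D ⊛ (D ⊛ (D ⊛ (D ⊛ 1#))))
        ≈⟨ solve 2 (λ P D → P ⊛ᵖ (D ⊛ᵖ (D ⊛ᵖ (D ⊛ᵖ (D ⊛ᵖ con 1)))) := D ⊛ᵖ (D ⊛ᵖ (D ⊛ᵖ (D ⊛ᵖ P)))) R.refl P₃ D ⟩
      D ⊛ (D ⊛ (D ⊛ (D ⊛ P₃)))
        ≈⟨ *-congˡ (*-congˡ (*-congˡ e₃)) ⟩
      D ⊛ (D ⊛ (D ⊛ (m ⊛ P₂)))
        ≈⟨ solve 3 (λ P D m → D ⊛ᵖ (D ⊛ᵖ (D ⊛ᵖ (m ⊛ᵖ P))) := m ⊛ᵖ (D ⊛ᵖ (D ⊛ᵖ (D ⊛ᵖ P)))) R.refl P₂ D m ⟩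
      m ⊛ (D ⊛ (D ⊛ (D ⊛ P₂)))
        ≈⟨ *-congˡ (*-congˡ (*-congˡ e₂)) ⟩
      m ⊛ (D ⊛ (D ⊛ (m ⊛ P₁)))
        ≈⟨ solve 3 (λ P D m → m ⊛ᵖ (D ⊛ᵖ (D ⊛ᵖ (m ⊛ᵖ P))) := m ⊛ᵖ (m ⊛ᵖ (D ⊛ᵖ (D ⊛ᵖ P)))) R.refl P₁ D m ⟩
      m ⊛ (m ⊛ (D ⊛ (D ⊛ P₁)))
        ≈⟨ *-congˡ (*-congˡ (*-congˡ e₁)) ⟩
      m ⊛ (m ⊛ (D ⊛ (m ⊛ P₀ ⊕ u)))
        ≈⟨ solve 4 (λ P D m u → m ⊛ᵖ (m ⊛ᵖ (D ⊛ᵖ (m ⊛ᵖ P ⊕ᵖ u))) := m ⊛ᵖ (m ⊛ᵖ (m ⊛ᵖ (D ⊛ᵖ P) ⊕ᵖ D ⊛ᵖ u))) R.refl P₀ D m u ⟩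
      m ⊛ (m ⊛ (m ⊛ (D ⊛ P₀) ⊕ D ⊛ u))
        ≈⟨ *-congˡ (*-congˡ (R.trans (+-congʳ (*-congˡ e₀)) (R.trans (R.sym (distribʳ u m D)) (*-congʳ m⊕D)))) ⟩
      m ⊛ (m ⊛ ((u ⊛ (u ⊛ 1#)) ⊛ u))
        ≈⟨ solve 3 (λ x y u → (x ⊛ᵖ (x ⊛ᵖ y)) ⊛ᵖ ((x ⊛ᵖ (x ⊛ᵖ y)) ⊛ᵖ ((u ⊛ᵖ (u ⊛ᵖ con 1)) ⊛ᵖ u))
              := (y ⊛ᵖ (y ⊛ᵖ con 1)) ⊛ᵖ ((x ⊛ᵖ (x ⊛ᵖ (x ⊛ᵖ (x ⊛ᵖ con 1)))) ⊛ᵖ (u ⊛ᵖ (u ⊛ᵖ (u ⊛ᵖ con 1))))) R.refl x y u ⟩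
      (y ⊛ (y ⊛ 1#)) ⊛ ((x ⊛ (x ⊛ (x ⊛ (x ⊛ 1#)))) ⊛ (u ⊛ (u ⊛ (u ⊛ 1#)))) ∎

module Δ = Denominator X.commutativeRing

u D : Series
u = Δ.u xS yS
D = Δ.D xS yS

u≋ : (oneS ⊕ₛ (⊖ xS)) ≋ u
u≋ n k = cong (λ w → w ℤ.+ (ℤ.- (xS n k))) (oneS≋ n k)

⊗≋ : ∀ {F F′ G G′} → F ≋ F′ → G ≋ G′ → (F ⊗ G) ≋ (F′ ⊠ G′)
⊗≋ {F} {F′} {G} {G′} p q n k = trans (⊗-⋆ F G n k) (S.*-cong {F} {F′} {G} {G′} p q n k)

refl≋ : ∀ {F : Series} → F ≋ F
refl≋ n k = refl

denom≋ : denomS ≋ power D 4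
denom≋ = powS≋ {F′ = D} (λ n k → cong₂ ℤ._+_ (powS≋ u≋ 2 n k) (cong ℤ.-_ (⊗≋ {yS} (refl≋ {yS}) (powS≋ {xS} (refl≋ {xS}) 2) n k))) 4

numer≋ : numerS ≋ (power yS 2 ⊠ (power xS 4 ⊠ power u 3))
numer≋ = ⊗≋ {powS yS 2} {power yS 2} (powS≋ {yS} (refl≋ {yS}) 2)
  (⊗≋ {powS xS 4} {power xS 4} (powS≋ {xS} (refl≋ {xS}) 4) (powS≋ u≋ 3))

boundary-0 : boundary 0 ≋ (λ _ _ → pos 0)
boundary-0 zero zero = refl
boundary-0 zero (suc k) = refl
boundary-0 (suc zero) zero = refl
boundary-0 (suc zero) (suc k) = refl
boundary-0 (suc (suc n)) k = refl

boundary-1 : boundary 1 ≋ u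
boundary-1 zero zero = refl
boundary-1 zero (suc k) = refl
boundary-1 (suc zero) zero = refl
boundary-1 (suc zero) (suc k) = refl
boundary-1 (suc (suc n)) k = refl

choose : ℕ → Series
choose j = weighted λ k → suc k C j

-- By Pascal's rule the difference of C(k+1,j+1) is C(k+1,j). The boundary coefficient C(1,j+1)
-- survives only for j = 0.
choose-recurrence : ∀ j → (D ⊠ choose (suc j)) ≋ ((Δ.m xS yS ⊠ choose j) ⊞ boundary (1 C suc j))
choose-recurrence j = Δ.eliminate-D xS yS (weighted-recurrence (λ k → suc k C suc j) (λ k → suc k C j)
  λ k → nCk+nC[k+1]≡[n+1]C[k+1] (suc k) j)

generatingFunction : (choose 3 ⊗ denomS) ≋ numerS
generatingFunction n k = trans (⊗≋ {choose 3} (refl≋ {choose 3}) denom≋ n k)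
  (trans (Δ.clear-denominator xS yS {choose 0} {choose 1} {choose 2} {choose 3} e₃ e₂ e₁ e₀ n k) (sym (numer≋ n k)))
  where
  m = Δ.m xS yS
  e₃ : (D ⊠ choose 3) ≋ (m ⊠ choose 2)
  e₃ n k = trans (choose-recurrence 2 n k) (trans (cong (λ w → (m ⊠ choose 2) n k ℤ.+ w) (boundary-0 n k)) (ℤ.+-identityʳ _))
  e₂ : (D ⊠ choose 2) ≋ (m ⊠ choose 1)
  e₂ n k = trans (choose-recurrence 1 n k) (trans (cong (λ w → (m ⊠ choose 1) n k ℤ.+ w) (boundary-0 n k)) (ℤ.+-identityʳ _))
  e₁ : (D ⊠ choose 1) ≋ ((m ⊠ choose 0) ⊞ u)
  e₁ n k = trans (choose-recurrence 0 n k) (cong (λ w → (m ⊠ choose 0) n k ℤ.+ w) (boundary-1 n k))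
  nothing : weighted (λ _ → 0) ≋ (λ _ _ → pos 0)
  nothing n k = cong pos (ℕ.*-zeroʳ (n C (2 * k)))
  -- The constant sequence 1 has zero difference, so only the boundary remains.
  e₀ : (D ⊠ choose 0) ≋ u
  e₀ n k = trans (Δ.eliminate-D xS yS (weighted-recurrence (λ k → suc k C 0) (λ _ → 0) (λ _ → refl)) n k)
    (trans (cong₂ ℤ._+_ (trans (S.*-cong {m} {m} {weighted (λ _ → 0)} (refl≋ {m}) nothing n k) (S.zeroʳ m n k)) (boundary-1 n k)) (ℤ.+-identityˡ _))

-- The count and its generating function

countReducedGenus1 : (n k : ℕ) → 1 ≤ n → 1 ≤ k → HasCard (IsReducedGenus1 n k) ((n C (2 * k)) * ((suc k) C 3))
countReducedGenus1 (suc n) k _ 0<k = Enumeration.hasCard n k 0<k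

theorem4p2 : ((n k : ℕ) → 1 ≤ n → 1 ≤ k →
    HasCard (IsReducedGenus1 n k) ((n C (2 * k)) * ((suc k) C 3)))
    ×
    ((r : ℕ → ℕ → ℕ) →
    ((n k : ℕ) → 1 ≤ n → 1 ≤ k → HasCard (IsReducedGenus1 n k) (r n k)) →
    ((k : ℕ) → r zero k ≡ 0) →
    ((n : ℕ) → r n zero ≡ 0) →
    (n k : ℕ) → (fromNat r ⊗ denomS) n k ≡ numerS n k)

theorem4p2 = countReducedGenus1 , λ r card r-zero r-zero′ n k →
  trans (⊗≋ {fromNat r} {choose 3} {denomS} {denomS} (λ n k → cong pos (r≡ r card r-zero r-zero′ n k)) (refl≋ {denomS}) n k)
    (trans (sym (⊗-⋆ (choose 3) denomS n k)) (generatingFunction n k))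
  where
  r≡ : (r : ℕ → ℕ → ℕ) → ((n k : ℕ) → 1 ≤ n → 1 ≤ k → HasCard (IsReducedGenus1 n k) (r n k)) →
       ((k : ℕ) → r zero k ≡ 0) → ((n : ℕ) → r n zero ≡ 0) → ∀ n k → r n k ≡ (n C (2 * k)) * (suc k C 3)
  -- On the border the formula vanishes like r, since C(1,3) = 0 and C(0,2k) = 0 for k ≥ 1.
  r≡ r card r-zero r-zero′ n zero = trans (r-zero′ n) (sym (ℕ.*-zeroʳ (n C 0)))
  r≡ r card r-zero r-zero′ zero (suc k) = r-zero (suc k)
  r≡ r card r-zero r-zero′ (suc n) (suc k) =
    hasCard-unique (card (suc n) (suc k) (s≤s z≤n) (s≤s z≤n)) (countReducedGenus1 (suc n) (suc k) (s≤s z≤n) (s≤s z≤n))
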